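{- There are absolute constants $C,c>0$ such that for any graph $H$ on $h$ vertices and any $0<\epsilon<1/2$ there is $\delta>0$ with $\delta^{ -1}\le t_j(h)$ for some $j\le C\epsilon^{ -c}$, such that the following holds: if a graph $G$ on $n$ vertices has at most $\delta n^h$ induced copies of $H$, then one can add or delete at most $\epsilon n^2$ edges of $G$ to obtain a graph with no induced copy of $H$.
   Context: The tower function $t_i(x)$ is defined by $t_0(x)=x$ and $t_{i+1}(x)=2^{t_i(x)}$ (a tower in $x$ of height $i$). -}

module Defs where

open import Data.Nat as ℕ using (ℕ; zero; suc; _∸_)
open import Data.Integer using (+_)
open import Data.Rational as ℚ using (ℚ; _/_; 1ℚ; _*_)
open import Data.Bool using (Bool; true; false; _∧_; not)
open import Data.Fin using (Fin; toℕ; _≟_)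
open import Data.Nat using (_<ᵇ_)
open import Data.List using (List; []; _∷_; concatMap; map; filter; length; foldr)
open import Data.List using (allFin)
open import Relation.Nullary.Decidable using (⌊_⌋)
open import Relation.Binary.PropositionalEquality using (_≡_)

t : ℕ → ℕ → ℕ
t zero x = x
t (suc i) x = 2 ℕ.^ t i x

ℕ→ℚ : ℕ → ℚ
ℕ→ℚ n = + n / 1

_^ℚ_ : ℚ → ℕ → ℚ
q ^ℚ zero = 1ℚ
q ^ℚ suc k = q * (q ^ℚ k)

record Graph (n : ℕ) : Set where
  field
    adj   : Fin n → Fin n → Bool
    sym   : ∀ i j → adj i j ≡ adj j i
    irrfl : ∀ i → adj i i ≡ false
open Graph public

_==_ : Bool → Bool → Bool
true  == b = b
false == b = not b

maps : (h n : ℕ) → List (Fin h → Fin n)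
maps zero n = (λ ()) ∷ []
maps (suc h) n =
  concatMap (λ v → map (λ f → λ { Data.Fin.zero → v ; (Data.Fin.suc i) → f i }) (maps h n))
            (allFin n)

allB : {A : Set} → (A → Bool) → List A → Bool
allB p = foldr (λ x b → p x ∧ b) true

isInducedEmbedding : ∀ {h n} → Graph h → Graph n → (Fin h → Fin n) → Bool
isInducedEmbedding {h} H G f =
  allB (λ i → allB (λ j →
         ⌊ i ≟ j ⌋ ∨' (not ⌊ f i ≟ f j ⌋ ∧ (adj H i j == adj G (f i) (f j))))
       (allFin h)) (allFin h)
  where
  _∨'_ : Bool → Bool → Bool
  true ∨' _ = true
  false ∨' b = b

inducedCount : ∀ {h n} → Graph h → Graph n → ℕ
inducedCount {h} {n} H G = length (filter (λ f → isInducedEmbedding H G f Data.Bool.≟ true) (maps h n))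

editDistance : ∀ {n} → Graph n → Graph n → ℕ
editDistance {n} G G' =
  length (filter (λ p → (toℕ (proj₁' p) <ᵇ toℕ (proj₂' p)) ∧ not (adj G (proj₁' p) (proj₂' p) == adj G' (proj₁' p) (proj₂' p)) Data.Bool.≟ true)
    (concatMap (λ i → map (λ j → pair i j) (allFin n)) (allFin n)))
  where
  record Pair : Set where
    constructor pair
    field proj₁' proj₂' : Fin n
  open Pair

{-# OPTIONS --safe #-}
module Submission where

-- Call a pair of vertex sets robust in a colour (edge or non-edge) if all large subsets still have a positive density of
-- that colour.  Starting from a k-part partition, split a k-tuple of sets (W₁,…,W_k), one per part, along a witness of
-- non-robustness; the mean square density increases, so after poly(k) splits most leaves of this binary tree are tuples all
-- of whose pairs are, in each colour, robust or sparse (cylinder regularity, Duke–Lefmann–Rödl).  The common refinement of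
-- all sets in the tree has only doubly exponentially many parts.  Either its index exceeds that of the partition by a
-- fixed amount, and we continue with it (at most 2N²+1 times, a bounded tower each time), or, by convexity, on average over
-- the leaves the densities d(Wᵢ,Wⱼ) are close to the densities of the parts.  In the latter case some leaf is both
-- good and representative (Conlon–Fox).  The graph is edited by forbidding between parts i and j each colour that is sparse
-- on (Wᵢ,Wⱼ) and by making each part homogeneous, in a colour for which Ramsey's theorem provides h subsets of Wᵢ that are
-- pairwise robust.  A copy of H that survives the editing can be counted, greedily, inside the original graph.

open import Algebra.Bundles using (CommutativeRing; RawRing; Semiring)
import Algebra.Properties.Semiring.Sum as SemiringSum
import Algebra.Solver.Ring
open import Algebra.Solver.Ring.AlmostCommutativeRing
  using (_-Raw-AlmostCommutative⟶_; fromCommutativeRing)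
open import Algebra.Structures using (IsCommutativeRing)
open import Data.Bool as Bool using (Bool; true; false; _∧_; not; if_then_else_)
import Data.Bool.Properties as Boolₚ
open import Data.Fin as Fin using (Fin; zero; suc; combine; toℕ; fromℕ<; _≟_)
import Data.Fin.Properties as Finₚ
open import Data.Integer as ℤ using (ℤ)
import Data.Integer.Properties as ℤₚ
import Data.Maybe
open import Data.Nat as ℕ using (ℕ; zero; suc; s≤s; z≤n; ⌊_/2⌋)
import Data.Nat.Properties as ℕₚ
open import Data.Product using (_×_; _,_; proj₁; proj₂; ∃; ∃-syntax; Σ)
open import Data.Rational as ℚ using (ℚ)
import Data.Rational.Properties as ℚₚ
import Data.Rational.Unnormalised as ℚᵘ
import Data.Rational.Unnormalised.Properties as ℚᵘₚ
open import Data.Sum using (_⊎_; inj₁; inj₂)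
open import Data.Vec.Functional using (updateAt)
open import Data.Vec.Functional.Properties using (updateAt-updates; updateAt-minimal)
import Defs
open import Function using (_∘_; id)
open import Level using (0ℓ)
open import Relation.Binary using (Poset; IsPartialOrder)
open import Relation.Binary.Definitions using (tri<; tri≈; tri>)
open import Relation.Binary.PropositionalEquality
import Relation.Binary.Reasoning.PartialOrder
open import Relation.Nullary using (¬_; Dec; yes; no; contradiction)
open import Relation.Nullary.Decidable using (⌊_⌋; does; dec⇒maybe; map′; _×-dec_; _→-dec_)

-- The obstacle is the bound. The edits are dictated by the representatives `Wᵢ`, which have to
-- mirror the densities of nearly all pairs of parts at once; regularity of accuracy growing with
-- the number k of parts would cost a tower in every round. Here pseudo-randomness is asked of a
-- single tuple, one-sidedly (sets of a fixed share keep a fixed density), at scales depending on h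
-- and ε alone. The number k enters only through the tree, so a round costs a bounded number of
-- exponentials, and O(1/ε²) rounds give the height. Two scales are needed. The homogeneous pieces
-- are found inside each `Wᵢ` once the representatives are chosen, by splitting Ramsey-many copies
-- of `Wᵢ`; robustness of (`Wᵢ`, `Wⱼ`) must then apply to subsets of these pieces. Hence the ratio
-- `inner` used inside a part is fixed first, and `outer` is `inner` times the loss in passing to a
-- piece. The iteration starts from residue classes modulo some N of order 1/ε, so that pairs inside
-- a part, all of which may be recoloured, are few.

-- The library's sum is a fold on its implicit length, which unification cannot invert; opacity makes it a rigid symbol.
module OpaqueSum (R : Semiring 0ℓ 0ℓ) where
  open Semiring R using (Carrier; _≈_; _+_; _*_; 0#) renaming (refl to ≈-refl)
  private module S = SemiringSum R

  opaque
    sum : ∀ {n} → (Fin n → Carrier) → Carrier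
    sum = S.sum

    sum-[] : (f : Fin 0 → Carrier) → sum f ≈ 0#
    sum-[] f = ≈-refl

    sum-∷ : ∀ {n} (f : Fin (suc n) → Carrier) → sum f ≈ f zero + sum (λ i → f (suc i))
    sum-∷ f = ≈-refl

    sum-cong : ∀ {n} {f g : Fin n → Carrier} → (∀ i → f i ≡ g i) → sum f ≡ sum g
    sum-cong = S.sum-cong-≗

    sum-0 : ∀ n → sum {n} (λ _ → 0#) ≈ 0#
    sum-0 = S.sum-replicate-zero

    sum-+ : ∀ {n} (f g : Fin n → Carrier) → sum (λ i → f i + g i) ≈ sum f + sum g
    sum-+ = S.∑-distrib-+

    sum-comm : ∀ {m n} (f : Fin m → Fin n → Carrier) → sum (λ i → sum (f i)) ≈ sum (λ j → sum (λ i → f i j))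
    sum-comm = S.∑-comm

    sum-*ˡ : ∀ {n} c (f : Fin n → Carrier) → c * sum f ≈ sum (λ i → c * f i)
    sum-*ˡ = S.*-distribˡ-sum

module ℕΣ = OpaqueSum ℕₚ.+-*-semiring

-- Ordered-field arithmetic of the rationals

module Field where

  infixl 6 _+_ _-_
  infixl 7 _*_
  infix  8 -_
  infix  4 _≤_

  opaque
    -- Rational arithmetic is sealed, so that fractions are not normalised during type checking. Up
    -- to the final translation only the ordered-ring laws, the embedding of the integers and `inv`
    -- are used.
    F : Set
    F = ℚ

    _+_ _*_ : F → F → F
    _+_ = ℚ._+_
    _*_ = ℚ._*_

    -_ : F → F
    -_ = ℚ.-_

    _≤_ : F → F → Set
    _≤_ = ℚ._≤_

    ⟦_⟧ : ℤ → F
    ⟦ z ⟧ = ℚ.fromℚᵘ (ℚᵘ.mkℚᵘ z 0)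

  ι : ℕ → F
  ι m = ⟦ ℤ.+ m ⟧

  _-_ : F → F → F
  x - y = x + - y

  opaque
    unfolding F _+_ _*_ -_ _≤_ ⟦_⟧

    isCommutativeRing : IsCommutativeRing _≡_ _+_ _*_ -_ ⟦ ℤ.+ 0 ⟧ ⟦ ℤ.+ 1 ⟧
    isCommutativeRing = ℚₚ.+-*-isCommutativeRing

    ⟦⟧-+ : ∀ x y → ⟦ x ℤ.+ y ⟧ ≡ ⟦ x ⟧ + ⟦ y ⟧
    ⟦⟧-+ x y = ℚₚ.toℚᵘ-injective (ℚᵘₚ.≃-trans (ℚₚ.toℚᵘ-fromℚᵘ (ℚᵘ.mkℚᵘ (x ℤ.+ y) 0))
      (ℚᵘₚ.≃-trans
        (ℚᵘ.*≡* (cong (ℤ._* ℤ.+ 1) (cong₂ ℤ._+_ (sym (ℤₚ.*-identityʳ x)) (sym (ℤₚ.*-identityʳ y)))))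
        (ℚᵘₚ.≃-sym (ℚᵘₚ.≃-trans (ℚₚ.toℚᵘ-homo-+ ⟦ x ⟧ ⟦ y ⟧)
          (ℚᵘₚ.+-cong (ℚₚ.toℚᵘ-fromℚᵘ (ℚᵘ.mkℚᵘ x 0)) (ℚₚ.toℚᵘ-fromℚᵘ (ℚᵘ.mkℚᵘ y 0)))))))

    ⟦⟧-* : ∀ x y → ⟦ x ℤ.* y ⟧ ≡ ⟦ x ⟧ * ⟦ y ⟧
    ⟦⟧-* x y = ℚₚ.toℚᵘ-injective (ℚᵘₚ.≃-trans (ℚₚ.toℚᵘ-fromℚᵘ (ℚᵘ.mkℚᵘ (x ℤ.* y) 0))
      (ℚᵘₚ.≃-sym (ℚᵘₚ.≃-trans (ℚₚ.toℚᵘ-homo-* ⟦ x ⟧ ⟦ y ⟧)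
          (ℚᵘₚ.*-cong (ℚₚ.toℚᵘ-fromℚᵘ (ℚᵘ.mkℚᵘ x 0)) (ℚₚ.toℚᵘ-fromℚᵘ (ℚᵘ.mkℚᵘ y 0))))))

    ⟦⟧-neg : ∀ x → ⟦ ℤ.- x ⟧ ≡ - ⟦ x ⟧
    ⟦⟧-neg x = ℚₚ.toℚᵘ-injective (ℚᵘₚ.≃-trans (ℚₚ.toℚᵘ-fromℚᵘ (ℚᵘ.mkℚᵘ (ℤ.- x) 0))
      (ℚᵘₚ.≃-sym (ℚᵘₚ.≃-trans (ℚₚ.toℚᵘ-homo‿- ⟦ x ⟧)
          (ℚᵘₚ.-‿cong (ℚₚ.toℚᵘ-fromℚᵘ (ℚᵘ.mkℚᵘ x 0))))))

    ⟦⟧-mono : ∀ {x y} → x ℤ.≤ y → ⟦ x ⟧ ≤ ⟦ y ⟧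
    ⟦⟧-mono {x} {y} p = ℚₚ.toℚᵘ-cancel-≤
      (ℚᵘₚ.≤-trans (ℚᵘₚ.≤-reflexive (ℚₚ.toℚᵘ-fromℚᵘ (ℚᵘ.mkℚᵘ x 0)))
      (ℚᵘₚ.≤-trans (ℚᵘ.*≤* (ℤₚ.*-monoʳ-≤-nonNeg (ℤ.+ 1) p))
        (ℚᵘₚ.≤-reflexive (ℚᵘₚ.≃-sym (ℚₚ.toℚᵘ-fromℚᵘ (ℚᵘ.mkℚᵘ y 0))))))

    ⟦⟧-cancel : ∀ {x y} → ⟦ x ⟧ ≤ ⟦ y ⟧ → x ℤ.≤ y
    ⟦⟧-cancel {x} {y} p with
      (ℚᵘₚ.≤-trans (ℚᵘₚ.≤-reflexive (ℚᵘₚ.≃-sym (ℚₚ.toℚᵘ-fromℚᵘ (ℚᵘ.mkℚᵘ x 0))))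
      (ℚᵘₚ.≤-trans (ℚₚ.toℚᵘ-mono-≤ p)
        (ℚᵘₚ.≤-reflexive (ℚₚ.toℚᵘ-fromℚᵘ (ℚᵘ.mkℚᵘ y 0)))))
    ... | ℚᵘ.*≤* q = subst₂ ℤ._≤_ (ℤₚ.*-identityʳ x) (ℤₚ.*-identityʳ y) q

    ≤-isPartialOrder : IsPartialOrder _≡_ _≤_
    ≤-isPartialOrder = ℚₚ.≤-isPartialOrder

    ≤-total : ∀ x y → x ≤ y ⊎ y ≤ x
    ≤-total = ℚₚ.≤-total

    _≤?_ : ∀ x y → Dec (x ≤ y)
    _≤?_ = ℚ._≤?_

    +-mono-≤ : ∀ {x y u v} → x ≤ y → u ≤ v → x + u ≤ y + v
    +-mono-≤ = ℚₚ.+-mono-≤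

    *-nonneg : ∀ {x y} → ⟦ ℤ.+ 0 ⟧ ≤ x → ⟦ ℤ.+ 0 ⟧ ≤ y → ⟦ ℤ.+ 0 ⟧ ≤ x * y
    *-nonneg {x} {y} p q = ℚₚ.≤-trans (ℚₚ.≤-reflexive (sym (ℚₚ.*-zeroʳ x)))
      (ℚₚ.*-monoˡ-≤-nonNeg x {{ℚ.nonNegative p}} q)

    -- The value 0 at 0 makes weights over an empty set vanish, so that `μ` and `ratio` are
    -- nonnegative without any side condition.
    inv : ℕ → F
    inv zero    = ℚ.0ℚ
    inv (suc m) = ℤ.+ 1 ℚ./ suc m

    inv-nonneg : ∀ m → ⟦ ℤ.+ 0 ⟧ ≤ inv m
    inv-nonneg zero    = ℚₚ.≤-refl
    inv-nonneg (suc m) = ℚₚ.nonNegative⁻¹ _ {{ℚₚ.normalize-nonNeg 1 (suc m)}}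

    ι-*-inv : ∀ m → ι (suc m) * inv (suc m) ≡ ⟦ ℤ.+ 1 ⟧
    ι-*-inv m = ℚₚ.toℚᵘ-injective (ℚᵘₚ.≃-trans (ℚₚ.toℚᵘ-homo-* ⟦ ℤ.+ suc m ⟧ (ℤ.+ 1 ℚ./ suc m))
      (ℚᵘₚ.≃-trans (ℚᵘₚ.*-cong (ℚₚ.toℚᵘ-fromℚᵘ (ℚᵘ.mkℚᵘ (ℤ.+ suc m) 0))
                               (ℚₚ.toℚᵘ-fromℚᵘ (ℚᵘ.mkℚᵘ (ℤ.+ 1) m)))
        (ℚᵘ.*≡* (trans (ℤₚ.*-identityʳ (ℤ.+ suc m ℤ.* ℤ.+ 1)) (trans (ℤₚ.*-identityʳ (ℤ.+ suc m))
           (sym (trans (ℤₚ.*-identityˡ _) (cong ℤ.+_ (ℕₚ.+-identityʳ (suc m))))))))))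

  commutativeRing : CommutativeRing _ _
  commutativeRing = record { isCommutativeRing = isCommutativeRing }

  open CommutativeRing commutativeRing public
    using (+-comm; +-assoc; +-identityˡ; +-identityʳ; *-comm; *-assoc; *-identityˡ; *-identityʳ;
           distribˡ; distribʳ; zeroˡ; zeroʳ; semiring; -‿inverseʳ)
  open OpaqueSum semiring public

  ℤ-coefficients : RawRing _ _
  ℤ-coefficients = CommutativeRing.rawRing ℤₚ.+-*-commutativeRing

  ℤ-morphism : ℤ-coefficients -Raw-AlmostCommutative⟶ fromCommutativeRing commutativeRing
  ℤ-morphism = record
    { ⟦_⟧ = ⟦_⟧ ; +-homo = ⟦⟧-+ ; *-homo = ⟦⟧-* ; -‿homo = ⟦⟧-neg ; 0-homo = refl ; 1-homo = refl }

  open Algebra.Solver.Ring ℤ-coefficients (fromCommutativeRing commutativeRing) ℤ-morphism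
    (λ x y → Data.Maybe.map (cong ⟦_⟧) (dec⇒maybe (x ℤ.≟ y))) public
    using (solve; _:=_; con; _:+_; _:*_; _:-_; :-_)

  0F 1F : F
  0F = ι 0
  1F = ι 1


  ≤-poset : Poset _ _ _
  ≤-poset = record { isPartialOrder = ≤-isPartialOrder }

  open IsPartialOrder ≤-isPartialOrder public using () renaming (refl to ≤-refl; trans to ≤-trans; reflexive to ≤-reflexive)
  module ≤-Reasoning = Relation.Binary.Reasoning.PartialOrder ≤-poset

  ι-+ : ∀ a b → ι (a ℕ.+ b) ≡ ι a + ι b
  ι-+ a b = ⟦⟧-+ (ℤ.+ a) (ℤ.+ b)

  ι-* : ∀ a b → ι (a ℕ.* b) ≡ ι a * ι b
  ι-* a b = trans (cong ⟦_⟧ (ℤₚ.pos-* a b)) (⟦⟧-* (ℤ.+ a) (ℤ.+ b))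

  ι-mono : ∀ {a b} → a ℕ.≤ b → ι a ≤ ι b
  ι-mono p = ⟦⟧-mono (ℤ.+≤+ p)

  ι-cancel : ∀ {a b} → ι a ≤ ι b → a ℕ.≤ b
  ι-cancel p with ⟦⟧-cancel p
  ... | ℤ.+≤+ q = q

  ι-nonneg : ∀ a → 0F ≤ ι a
  ι-nonneg a = ι-mono ℕ.z≤n

  ι-sum : ∀ {m} (f : Fin m → ℕ) → ι (ℕΣ.sum f) ≡ sum (λ i → ι (f i))
  ι-sum {zero}  f = trans (cong ι (ℕΣ.sum-[] f)) (sym (sum-[] _))
  ι-sum {suc m} f = begin
    ι (ℕΣ.sum f) ≡⟨ cong ι (ℕΣ.sum-∷ f) ⟩
    ι (f zero ℕ.+ ℕΣ.sum (λ i → f (suc i))) ≡⟨ ι-+ (f zero) _ ⟩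
    ι (f zero) + ι (ℕΣ.sum (λ i → f (suc i))) ≡⟨ cong (ι (f zero) +_) (ι-sum (λ i → f (suc i))) ⟩
    ι (f zero) + sum (λ i → ι (f (suc i))) ≡⟨ sym (sum-∷ _) ⟩
    sum (λ i → ι (f i)) ∎
    where open ≡-Reasoning

  ≤-by : ∀ {x y} c → 0F ≤ c → y ≡ x + c → x ≤ y
  ≤-by {x} {y} c p q = begin
    x ≡⟨ sym (+-identityʳ x) ⟩
    x + 0F ≤⟨ +-mono-≤ ≤-refl p ⟩
    x + c ≡⟨ sym q ⟩
    y ∎
    where open ≤-Reasoning

  ≤⇒0≤- : ∀ {x y} → x ≤ y → 0F ≤ y - x
  ≤⇒0≤- {x} {y} p = begin
    0F ≡⟨ sym (-‿inverseʳ x) ⟩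
    x - x ≤⟨ +-mono-≤ p ≤-refl ⟩
    y - x ∎
    where open ≤-Reasoning

  0≤-⇒≤ : ∀ {x y} → 0F ≤ y - x → x ≤ y
  0≤-⇒≤ {x} {y} p = ≤-by (y - x) p (solve 2 (λ x y → y := x :+ (y :- x)) refl x y)

  +-nonneg : ∀ {x y} → 0F ≤ x → 0F ≤ y → 0F ≤ x + y
  +-nonneg {x} {y} p q = ≤-trans (≤-reflexive (sym (+-identityˡ 0F))) (+-mono-≤ p q)

  *-monoˡ-≤ : ∀ {x y z} → 0F ≤ z → x ≤ y → z * x ≤ z * y
  *-monoˡ-≤ {x} {y} {z} p q = ≤-by (z * (y - x)) (*-nonneg p (≤⇒0≤- q))
    (solve 3 (λ x y z → z :* y := z :* x :+ z :* (y :- x)) refl x y z)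

  *-mono-≤ : ∀ {x y u v} → 0F ≤ x → 0F ≤ u → x ≤ y → u ≤ v → x * u ≤ y * v
  *-mono-≤ {x} {y} {u} {v} px pu p q = begin
    x * u ≤⟨ *-monoˡ-≤ px q ⟩
    x * v ≡⟨ *-comm x v ⟩
    v * x ≤⟨ *-monoˡ-≤ (≤-trans pu q) p ⟩
    v * y ≡⟨ *-comm v y ⟩
    y * v ∎
    where open ≤-Reasoning

  sq-nonneg : ∀ x → 0F ≤ x * x
  sq-nonneg x with ≤-total 0F x
  ... | inj₁ p = *-nonneg p p
  ... | inj₂ p = subst (0F ≤_) (solve 1 (λ x → (con (ℤ.+ 0) :- x) :* (con (ℤ.+ 0) :- x) := x :* x) refl x)
                   (*-nonneg (≤⇒0≤- p) (≤⇒0≤- p))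

  sum-mono-≤ : ∀ {m} {f g : Fin m → F} → (∀ i → f i ≤ g i) → sum f ≤ sum g
  sum-mono-≤ {zero}  p = ≤-reflexive (trans (sum-[] _) (sym (sum-[] _)))
  sum-mono-≤ {suc m} p = subst₂ _≤_ (sym (sum-∷ _)) (sym (sum-∷ _))
    (+-mono-≤ (p zero) (sum-mono-≤ (λ i → p (suc i))))

  sum-mono-≤-gap : ∀ {m} {f g : Fin m → F} {γ} → (∀ i → f i ≤ g i) → ∀ k → f k + γ ≤ g k → sum f + γ ≤ sum g
  sum-mono-≤-gap {suc m} {f} {g} {γ} p zero q = begin
    sum f + γ ≡⟨ cong (_+ γ) (sum-∷ f) ⟩
    f zero + s + γ ≡⟨ solve 3 (λ a s c → a :+ s :+ c := a :+ c :+ s) refl (f zero) s γ ⟩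
    f zero + γ + s ≤⟨ +-mono-≤ q (sum-mono-≤ (λ i → p (suc i))) ⟩
    g zero + sum (λ i → g (suc i)) ≡⟨ sym (sum-∷ g) ⟩
    sum g ∎
    where open ≤-Reasoning
          s = sum (λ i → f (suc i))
  sum-mono-≤-gap {suc m} {f} {g} {γ} p (suc k) q = begin
    sum f + γ ≡⟨ cong (_+ γ) (sum-∷ f) ⟩
    f zero + s + γ ≡⟨ +-assoc (f zero) s γ ⟩
    f zero + (s + γ) ≤⟨ +-mono-≤ (p zero) (sum-mono-≤-gap (λ i → p (suc i)) k q) ⟩
    g zero + sum (λ i → g (suc i)) ≡⟨ sym (sum-∷ g) ⟩
    sum g ∎
    where open ≤-Reasoning
          s = sum (λ i → f (suc i))

  sum-zero : ∀ {m} {f : Fin m → F} → (∀ i → f i ≡ 0F) → sum f ≡ 0F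
  sum-zero {m} p = trans (sum-cong p) (sum-0 m)

  inv-inverse : ∀ {m} → 0 ℕ.< m → ι m * inv m ≡ 1F
  inv-inverse {suc m} _ = ι-*-inv m

  inv-* : ∀ {a b} → 0 ℕ.< a → 0 ℕ.< b → inv (a ℕ.* b) ≡ inv a * inv b
  inv-* {a} {b} pa pb = begin
    i ≡⟨ solve 1 (λ i → i := (con (ℤ.+ 1) :* con (ℤ.+ 1)) :* i) refl i ⟩
    (1F * 1F) * i ≡⟨ cong (_* i) (sym (cong₂ _*_ (inv-inverse pa) (inv-inverse pb))) ⟩
    ι a * inv a * (ι b * inv b) * i ≡⟨ solve 5 (λ a b x y i → a :* x :* (b :* y) :* i := x :* y :* (a :* b :* i)) refl (ι a) (ι b) (inv a) (inv b) i ⟩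
    inv a * inv b * (ι a * ι b * i) ≡⟨ cong (λ z → inv a * inv b * (z * i)) (sym (ι-* a b)) ⟩
    inv a * inv b * (ι (a ℕ.* b) * i) ≡⟨ cong (inv a * inv b *_) (inv-inverse (ℕₚ.*-mono-< pa pb)) ⟩
    inv a * inv b * 1F ≡⟨ *-identityʳ _ ⟩
    inv a * inv b ∎
    where open ≡-Reasoning
          i = inv (a ℕ.* b)

  module _ {a b m : ℕ} (0<a : 0 ℕ.< a) (0<m : 0 ℕ.< m) where

    private
      scale : F
      scale = inv a * inv m

      0≤scale : 0F ≤ scale
      0≤scale = *-nonneg (inv-nonneg a) (inv-nonneg m)

      scale-a : scale * ι a ≡ inv m
      scale-a = trans (solve 3 (λ i j x → i :* j :* x := j :* (x :* i)) refl (inv a) (inv m) (ι a))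
        (trans (cong (inv m *_) (inv-inverse 0<a)) (*-identityʳ (inv m)))

      scale-mb : scale * ι (m ℕ.* b) ≡ inv a * ι b
      scale-mb = trans (cong (scale *_) (ι-* m b))
        (trans (solve 4 (λ i j x y → i :* j :* (x :* y) := x :* j :* (i :* y)) refl (inv a) (inv m) (ι m) (ι b))
          (trans (cong (_* (inv a * ι b)) (inv-inverse 0<m)) (*-identityˡ _)))

    inv-≤-ratio : a ℕ.≤ m ℕ.* b → inv m ≤ inv a * ι b
    inv-≤-ratio p = subst₂ _≤_ scale-a scale-mb (*-monoˡ-≤ 0≤scale (ι-mono p))

    ratio-≤-inv : m ℕ.* b ℕ.≤ a → inv a * ι b ≤ inv m
    ratio-≤-inv p = subst₂ _≤_ scale-mb scale-a (*-monoˡ-≤ 0≤scale (ι-mono p))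

module Arithmetic where

  open import Data.Nat public using (_+_; _*_; _∸_; _^_; _≤_; _<_; _<ᵇ_)
  open import Data.Nat.Properties public hiding (_≟_)
  open import Data.Nat.Tactic.RingSolver public using (solve-∀)

-- Vertex sets and edge counts

module Sets where

  open Arithmetic

  infix  4 _⊆_
  infixl 6 _∩_ _∖_

  Sub : ℕ → Set
  Sub n = Fin n → Bool

  Rel : ℕ → Set
  Rel n = Fin n → Fin n → Bool

  𝟙 : Bool → ℕ
  𝟙 true  = 1
  𝟙 false = 0

  𝟙-≤1 : ∀ b → 𝟙 b ≤ 1
  𝟙-≤1 true  = ℕ.s≤s ℕ.z≤n
  𝟙-≤1 false = ℕ.z≤n

  ∣_∣ : ∀ {n} → Sub n → ℕ
  ∣ X ∣ = ℕΣ.sum (λ u → 𝟙 (X u))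

  _⊆_ : ∀ {n} → Sub n → Sub n → Set
  X ⊆ Y = ∀ u → X u ≡ true → Y u ≡ true

  _∩_ _∖_ : ∀ {n} → Sub n → Sub n → Sub n
  (X ∩ Y) u = X u ∧ Y u
  (X ∖ Y) u = X u ∧ not (Y u)

  edges : ∀ {n} → Rel n → Sub n → Sub n → ℕ
  edges E X Y = ℕΣ.sum (λ u → ℕΣ.sum (λ v → 𝟙 (X u) * (𝟙 (Y v) * 𝟙 (E u v))))

  ℕ-sum-mono : ∀ {m} {f g : Fin m → ℕ} → (∀ i → f i ≤ g i) → ℕΣ.sum f ≤ ℕΣ.sum g
  ℕ-sum-mono {zero}  p = ≤-reflexive (trans (ℕΣ.sum-[] _) (sym (ℕΣ.sum-[] _)))
  ℕ-sum-mono {suc m} p = subst₂ ℕ._≤_ (sym (ℕΣ.sum-∷ _)) (sym (ℕΣ.sum-∷ _)) (+-mono-≤ (p zero) (ℕ-sum-mono (p ∘ suc)))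

  ∣∣-split : ∀ {n} (X Y : Sub n) → ∣ X ∣ ≡ ∣ X ∩ Y ∣ + ∣ X ∖ Y ∣
  ∣∣-split X Y = trans (ℕΣ.sum-cong (λ u → pointwise (X u) (Y u))) (ℕΣ.sum-+ _ _)
    where
    pointwise : ∀ a b → 𝟙 a ≡ 𝟙 (a ∧ b) + 𝟙 (a ∧ not b)
    pointwise true  true  = refl
    pointwise true  false = refl
    pointwise false _     = refl

  ∩-⊆ : ∀ {n} (X Y : Sub n) → X ∩ Y ⊆ X
  ∩-⊆ X Y u p with X u
  ... | true = refl

  ∖-⊆ : ∀ {n} (X Y : Sub n) → X ∖ Y ⊆ X
  ∖-⊆ X Y u p with X u
  ... | true = refl

  ⊆⇒∩ : ∀ {n} {X Y : Sub n} → Y ⊆ X → ∀ u → (X ∩ Y) u ≡ Y u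
  ⊆⇒∩ {X = X} {Y} s u with Y u in eq
  ... | true  rewrite s u eq = refl
  ... | false with X u
  ... | true = refl
  ... | false = refl

  𝟙-mono : ∀ {a b} → (a ≡ true → b ≡ true) → 𝟙 a ≤ 𝟙 b
  𝟙-mono {false} p = ℕ.z≤n
  𝟙-mono {true}  p rewrite p refl = ≤-refl

  ⊆⇒≤ : ∀ {n} {X Y : Sub n} → X ⊆ Y → ∣ X ∣ ≤ ∣ Y ∣
  ⊆⇒≤ s = ℕ-sum-mono (λ u → 𝟙-mono (s u))

  ∣∣-cong : ∀ {n} {X Y : Sub n} → X ≗ Y → ∣ X ∣ ≡ ∣ Y ∣
  ∣∣-cong p = ℕΣ.sum-cong (λ u → cong 𝟙 (p u))

  edges-cong : ∀ {n} (E : Rel n) {X X′ Y Y′ : Sub n} → X ≗ X′ → Y ≗ Y′ → edges E X Y ≡ edges E X′ Y′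
  edges-cong E p q = ℕΣ.sum-cong (λ u → ℕΣ.sum-cong (λ v →
    cong₂ ℕ._*_ (cong 𝟙 (p u)) (cong (λ b → 𝟙 b * 𝟙 (E u v)) (q v))))

  ⌊suc≟suc⌋ : ∀ {k} (a i : Fin k) → ⌊ suc a ≟ suc i ⌋ ≡ ⌊ a ≟ i ⌋
  ⌊suc≟suc⌋ a i with a ≟ i
  ... | yes _ = refl
  ... | no  _ = refl

  ℕ-sum-pick : ∀ {k} (a : Fin k) (f : Fin k → ℕ) → ℕΣ.sum (λ i → 𝟙 ⌊ a ≟ i ⌋ * f i) ≡ f a
  ℕ-sum-pick {suc k} zero f = trans (ℕΣ.sum-∷ _) (trans (cong₂ ℕ._+_ (*-identityˡ (f zero)) (ℕΣ.sum-0 k)) (+-identityʳ _))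
  ℕ-sum-pick (suc a) f = trans (ℕΣ.sum-∷ _) (trans (ℕΣ.sum-cong (λ i → cong (λ b → 𝟙 b * f (suc i)) (⌊suc≟suc⌋ a i))) (ℕ-sum-pick a (f ∘ suc)))

  ℕ-sum-const : ∀ m x → ℕΣ.sum {m} (λ _ → x) ≡ m * x
  ℕ-sum-const zero    x = ℕΣ.sum-[] _
  ℕ-sum-const (suc m) x = trans (ℕΣ.sum-∷ _) (cong (x +_) (ℕ-sum-const m x))

-- Averages over pairs of vertex sets and their behaviour under splitting

module Averages {n : ℕ} where

  open Field
  open Sets

  sum₂ : ∀ {m k} → (Fin m → Fin k → F) → F
  sum₂ f = sum (λ i → sum (λ j → f i j))

  sum₂-cong : ∀ {m k} {f g : Fin m → Fin k → F} → (∀ i j → f i j ≡ g i j) → sum₂ f ≡ sum₂ g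
  sum₂-cong p = sum-cong (λ i → sum-cong (p i))

  sum₂-+ : ∀ {m k} (f g : Fin m → Fin k → F) → sum₂ (λ i j → f i j + g i j) ≡ sum₂ f + sum₂ g
  sum₂-+ f g = trans (sum-cong (λ i → sum-+ (f i) (g i))) (sum-+ _ _)

  sum₂-* : ∀ {m k} c (f : Fin m → Fin k → F) → sum₂ (λ i j → c * f i j) ≡ c * sum₂ f
  sum₂-* c f = trans (sum-cong (λ i → sym (sum-*ˡ c (f i)))) (sym (sum-*ˡ c (λ i → sum (f i))))

  sum₂-mono : ∀ {m k} {f g : Fin m → Fin k → F} → (∀ i j → f i j ≤ g i j) → sum₂ f ≤ sum₂ g
  sum₂-mono p = sum-mono-≤ (λ i → sum-mono-≤ (p i))

  sum₂-1 : ∀ m → sum₂ {m} {m} (λ _ _ → 1F) ≡ ι (m ℕ.* m)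
  sum₂-1 m = begin
    sum₂ {m} {m} (λ _ _ → 1F) ≡⟨ sum-cong {m} (λ _ → trans (sum-1 m) (sym (*-identityʳ _))) ⟩
    sum {m} (λ _ → ι m * 1F) ≡⟨ sym (sum-*ˡ {m} (ι m) (λ _ → 1F)) ⟩
    ι m * sum {m} (λ _ → 1F) ≡⟨ cong (ι m *_) (sum-1 m) ⟩
    ι m * ι m ≡⟨ sym (ι-* m m) ⟩
    ι (m ℕ.* m) ∎
    where
    open ≡-Reasoning
    sum-1 : ∀ m → sum {m} (λ _ → 1F) ≡ ι m
    sum-1 zero    = sum-[] _
    sum-1 (suc m) = trans (sum-∷ _) (trans (cong (1F +_) (sum-1 m)) (sym (ι-+ 1 m)))

  -- The uniform probability measure on a nonempty X. With densities written as integrals against a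
  -- product of two such measures, splitting a set becomes a convex decomposition of the measure.
  μ : Sub n → Fin n → F
  μ X u = inv ∣ X ∣ * ι (𝟙 (X u))

  avg : Sub n → Sub n → (Fin n → Fin n → F) → F
  avg X Y φ = sum₂ (λ u v → μ X u * (μ Y v * φ u v))

  ratio : Sub n → Sub n → F
  ratio X Y = inv ∣ X ∣ * ι ∣ Y ∣

  μ-nonneg : ∀ X u → 0F ≤ μ X u
  μ-nonneg X u = *-nonneg (inv-nonneg ∣ X ∣) (ι-nonneg _)

  ratio-nonneg : ∀ X Y → 0F ≤ ratio X Y
  ratio-nonneg X Y = *-nonneg (inv-nonneg ∣ X ∣) (ι-nonneg _)

  sum-μ : ∀ {X} → 0 ℕ.< ∣ X ∣ → sum (μ X) ≡ 1F
  sum-μ {X} p = begin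
    sum (μ X) ≡⟨ sym (sum-*ˡ (inv ∣ X ∣) _) ⟩
    inv ∣ X ∣ * sum (λ u → ι (𝟙 (X u))) ≡⟨ cong (inv ∣ X ∣ *_) (sym (ι-sum (λ u → 𝟙 (X u)))) ⟩
    inv ∣ X ∣ * ι ∣ X ∣ ≡⟨ *-comm _ _ ⟩
    ι ∣ X ∣ * inv ∣ X ∣ ≡⟨ inv-inverse p ⟩
    1F ∎
    where open ≡-Reasoning

  avg-+ : ∀ X Y φ ψ → avg X Y (λ u v → φ u v + ψ u v) ≡ avg X Y φ + avg X Y ψ
  avg-+ X Y φ ψ = trans
    (sum₂-cong (λ u v → solve 4 (λ a b x y → a :* (b :* (x :+ y)) := a :* (b :* x) :+ a :* (b :* y)) refl (μ X u) (μ Y v) (φ u v) (ψ u v)))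
    (sum₂-+ _ _)

  avg-* : ∀ X Y c φ → avg X Y (λ u v → c * φ u v) ≡ c * avg X Y φ
  avg-* X Y c φ = trans
    (sum₂-cong (λ u v → solve 4 (λ a b x y → a :* (b :* (x :* y)) := x :* (a :* (b :* y))) refl (μ X u) (μ Y v) c (φ u v)))
    (sum₂-* c _)

  avg-cong : ∀ X Y {φ ψ} → (∀ u v → φ u v ≡ ψ u v) → avg X Y φ ≡ avg X Y ψ
  avg-cong X Y p = sum₂-cong (λ u v → cong (λ z → μ X u * (μ Y v * z)) (p u v))

  avg-const : ∀ {X Y} → 0 ℕ.< ∣ X ∣ → 0 ℕ.< ∣ Y ∣ → ∀ c → avg X Y (λ _ _ → c) ≡ c
  avg-const {X} {Y} p q c = begin
    sum₂ (λ u v → μ X u * (μ Y v * c))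
      ≡⟨ sum-cong (λ u → trans (sum-cong (λ v → solve 3 (λ a b c → a :* (b :* c) := (a :* c) :* b) refl (μ X u) (μ Y v) c)) (sym (sum-*ˡ (μ X u * c) (μ Y)))) ⟩
    sum (λ u → μ X u * c * sum (μ Y)) ≡⟨ sum-cong (λ u → trans (cong (μ X u * c *_) (sum-μ q)) (solve 2 (λ a c → a :* c :* con (ℤ.+ 1) := c :* a) refl (μ X u) c)) ⟩
    sum (λ u → c * μ X u) ≡⟨ sym (sum-*ˡ c (μ X)) ⟩
    c * sum (μ X) ≡⟨ cong (c *_) (sum-μ p) ⟩
    c * 1F ≡⟨ *-identityʳ c ⟩
    c ∎
    where open ≡-Reasoning

  avg-mono-on : ∀ X Y {φ ψ} → (∀ u v → X u ≡ true → Y v ≡ true → φ u v ≤ ψ u v) → avg X Y φ ≤ avg X Y ψ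
  avg-mono-on X Y {φ} {ψ} p = sum₂-mono step
    where
    off : ∀ Z u x → Z u ≡ false → μ Z u * x ≡ 0F
    off Z u x eq rewrite eq = solve 2 (λ a x → a :* con (ℤ.+ 0) :* x := con (ℤ.+ 0)) refl (inv ∣ Z ∣) x
    step : ∀ u v → μ X u * (μ Y v * φ u v) ≤ μ X u * (μ Y v * ψ u v)
    step u v = go (X u) refl (Y v) refl
      where
      go : ∀ a → X u ≡ a → ∀ b → Y v ≡ b → μ X u * (μ Y v * φ u v) ≤ μ X u * (μ Y v * ψ u v)
      go true  e true  f = *-monoˡ-≤ (μ-nonneg X u) (*-monoˡ-≤ (μ-nonneg Y v) (p u v e f))
      go true  e false f = ≤-reflexive (cong (μ X u *_) (trans (off Y v _ f) (sym (off Y v _ f))))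
      go false e _     _ = ≤-reflexive (trans (off X u _ e) (sym (off X u _ e)))

  avg-mono : ∀ X Y {φ ψ} → (∀ u v → φ u v ≤ ψ u v) → avg X Y φ ≤ avg X Y ψ
  avg-mono X Y p = avg-mono-on X Y (λ u v _ _ → p u v)

  ratio-split : ∀ X S → 0 ℕ.< ∣ X ∣ → ratio X (X ∩ S) + ratio X (X ∖ S) ≡ 1F
  ratio-split X S p = begin
    inv ∣ X ∣ * ι ∣ X ∩ S ∣ + inv ∣ X ∣ * ι ∣ X ∖ S ∣ ≡⟨ sym (distribˡ _ _ _) ⟩
    inv ∣ X ∣ * (ι ∣ X ∩ S ∣ + ι ∣ X ∖ S ∣) ≡⟨ cong (inv ∣ X ∣ *_) (sym (trans (cong ι (∣∣-split X S)) (ι-+ _ _))) ⟩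
    inv ∣ X ∣ * ι ∣ X ∣ ≡⟨ *-comm _ _ ⟩
    ι ∣ X ∣ * inv ∣ X ∣ ≡⟨ inv-inverse p ⟩
    1F ∎
    where open ≡-Reasoning

  μ-split : ∀ X S → 0 ℕ.< ∣ X ∩ S ∣ → 0 ℕ.< ∣ X ∖ S ∣ → ∀ u →
            μ X u ≡ ratio X (X ∩ S) * μ (X ∩ S) u + ratio X (X ∖ S) * μ (X ∖ S) u
  μ-split X S p q u = begin
    inv ∣ X ∣ * ι (𝟙 (X u)) ≡⟨ cong (inv ∣ X ∣ *_) (pointwise (X u) (S u)) ⟩
    inv ∣ X ∣ * (i + j) ≡⟨ distribˡ _ _ _ ⟩
    inv ∣ X ∣ * i + inv ∣ X ∣ * j ≡⟨ cong₂ _+_ (lemma p i) (lemma q j) ⟩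
    _ ∎
    where
    open ≡-Reasoning
    i = ι (𝟙 ((X ∩ S) u))
    j = ι (𝟙 ((X ∖ S) u))
    pointwise : ∀ a b → ι (𝟙 a) ≡ ι (𝟙 (a ∧ b)) + ι (𝟙 (a ∧ not b))
    pointwise true  true  = sym (+-identityʳ 1F)
    pointwise true  false = sym (+-identityˡ 1F)
    pointwise false _     = sym (+-identityˡ 0F)
    lemma : ∀ {m} → 0 ℕ.< m → ∀ x → inv ∣ X ∣ * x ≡ inv ∣ X ∣ * ι m * (inv m * x)
    lemma {m} r x = begin
      inv ∣ X ∣ * x ≡⟨ cong (inv ∣ X ∣ *_) (sym (*-identityˡ x)) ⟩
      inv ∣ X ∣ * (1F * x) ≡⟨ cong (λ z → inv ∣ X ∣ * (z * x)) (sym (inv-inverse r)) ⟩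
      inv ∣ X ∣ * (ι m * inv m * x) ≡⟨ solve 4 (λ a b c x → a :* (b :* c :* x) := a :* b :* (c :* x)) refl (inv ∣ X ∣) (ι m) (inv m) x ⟩
      inv ∣ X ∣ * ι m * (inv m * x) ∎

  avg-splitˡ : ∀ X S Y φ → 0 ℕ.< ∣ X ∩ S ∣ → 0 ℕ.< ∣ X ∖ S ∣ →
               avg X Y φ ≡ ratio X (X ∩ S) * avg (X ∩ S) Y φ + ratio X (X ∖ S) * avg (X ∖ S) Y φ
  avg-splitˡ X S Y φ p q = begin
    avg X Y φ ≡⟨ sum₂-cong (λ u v → trans (cong (_* (μ Y v * φ u v)) (μ-split X S p q u))
        (solve 5 (λ a x b y z → (a :* x :+ b :* y) :* z := a :* (x :* z) :+ b :* (y :* z)) refl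
          (ratio X (X ∩ S)) (μ (X ∩ S) u) (ratio X (X ∖ S)) (μ (X ∖ S) u) (μ Y v * φ u v))) ⟩
    _ ≡⟨ sum₂-+ _ _ ⟩
    _ ≡⟨ cong₂ _+_ (sum₂-* _ _) (sum₂-* _ _) ⟩
    _ ∎
    where open ≡-Reasoning

  avg-splitʳ : ∀ X Y S φ → 0 ℕ.< ∣ Y ∩ S ∣ → 0 ℕ.< ∣ Y ∖ S ∣ →
               avg X Y φ ≡ ratio Y (Y ∩ S) * avg X (Y ∩ S) φ + ratio Y (Y ∖ S) * avg X (Y ∖ S) φ
  avg-splitʳ X Y S φ p q = begin
    avg X Y φ ≡⟨ sum₂-cong (λ u v → trans (cong (λ z → μ X u * (z * φ u v)) (μ-split Y S p q v))
        (solve 6 (λ a x b y w z → w :* ((a :* x :+ b :* y) :* z) := a :* (w :* (x :* z)) :+ b :* (w :* (y :* z))) refl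
          (ratio Y (Y ∩ S)) (μ (Y ∩ S) v) (ratio Y (Y ∖ S)) (μ (Y ∖ S) v) (μ X u) (φ u v))) ⟩
    _ ≡⟨ sum₂-+ _ _ ⟩
    _ ≡⟨ cong₂ _+_ (sum₂-* _ _) (sum₂-* _ _) ⟩
    _ ∎
    where open ≡-Reasoning

  avg-edges : ∀ (E : Rel n) X Y → 0 ℕ.< ∣ X ∣ → 0 ℕ.< ∣ Y ∣ →
              avg X Y (λ u v → ι (𝟙 (E u v))) ≡ inv (∣ X ∣ ℕ.* ∣ Y ∣) * ι (edges E X Y)
  avg-edges E X Y p q = begin
    avg X Y (λ u v → ι (𝟙 (E u v)))
      ≡⟨ sum₂-cong (λ u v → trans
          (solve 5 (λ a b c d e → a :* b :* (c :* d :* e) := a :* c :* (b :* (d :* e))) refl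
            (inv ∣ X ∣) (ι (𝟙 (X u))) (inv ∣ Y ∣) (ι (𝟙 (Y v))) (ι (𝟙 (E u v))))
          (cong (inv ∣ X ∣ * inv ∣ Y ∣ *_) (sym (trans (ι-* _ _) (cong (ι (𝟙 (X u)) *_) (ι-* _ _)))))) ⟩
    sum₂ (λ u v → inv ∣ X ∣ * inv ∣ Y ∣ * ι (e u v)) ≡⟨ sum₂-* _ _ ⟩
    inv ∣ X ∣ * inv ∣ Y ∣ * sum₂ (λ u v → ι (e u v)) ≡⟨ cong₂ _*_ (sym (inv-* p q))
        (sym (trans (ι-sum _) (sum-cong (λ u → ι-sum (e u))))) ⟩
    inv (∣ X ∣ ℕ.* ∣ Y ∣) * ι (edges E X Y) ∎
    where
    open ≡-Reasoning
    e : Fin n → Fin n → ℕ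
    e u v = 𝟙 (X u) ℕ.* (𝟙 (Y v) ℕ.* 𝟙 (E u v))

-- Robust pairs and their decidability

module Robustness where

  open Arithmetic
  open Sets
  open import Data.Vec using (lookup; tabulate)
  open import Data.Vec.Properties using (lookup∘tabulate)
  open import Data.Fin.Subset.Properties using (anySubset?)

  module _ {n : ℕ} (A r : ℕ) (E : Rel n) (W W′ : Sub n) where

    -- The upper bounds of one half keep the complement of a witness large too, so that splitting
    -- along a witness leaves a substantial share on either side.
    Admissible : Sub n → Sub n → Set
    Admissible X Y = X ⊆ W × Y ⊆ W′ × ∣ W ∣ ≤ A * ∣ X ∣ × 2 * ∣ X ∣ ≤ ∣ W ∣
                   × ∣ W′ ∣ ≤ A * ∣ Y ∣ × 2 * ∣ Y ∣ ≤ ∣ W′ ∣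

    Robust : Set
    Robust = ∀ X Y → Admissible X Y → ∣ X ∣ * ∣ Y ∣ ≤ r * edges E X Y

    Sparse : Sub n → Sub n → Set
    Sparse X Y = Admissible X Y × r * edges E X Y < ∣ X ∣ * ∣ Y ∣

  -- Vertex sets are enumerated as bit vectors. A set agrees with the lookup function of its table
  -- only pointwise, hence the demand that P respect pointwise equality.
  search : ∀ {n} {P : Sub n → Set} → (∀ {X Y} → X ≗ Y → P X → P Y) → (∀ X → Dec (P X)) → Dec (∃ P)
  search {P = P} resp P? = map′ (λ (S , p) → lookup S , p)
    (λ (X , p) → tabulate X , resp (λ u → sym (lookup∘tabulate X u)) p) (anySubset? (λ S → P? (lookup S)))

  ⊆? : ∀ {n} (X Y : Sub n) → Dec (X ⊆ Y)
  ⊆? X Y = Finₚ.all? (λ u → (X u Boolₚ.≟ true) →-dec (Y u Boolₚ.≟ true))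

  Sparse-resp : ∀ {n} A r (E : Rel n) (W W′ : Sub n) {X X′ Y Y′ : Sub n} → X ≗ X′ → Y ≗ Y′ →
                Sparse A r E W W′ X Y → Sparse A r E W W′ X′ Y′
  Sparse-resp A r E W W′ p q ((a , b , c , d , e , f) , g) =
    ((λ u x → a u (trans (p u) x)) , (λ u x → b u (trans (q u) x)) ,
     subst (λ z → ∣ W ∣ ≤ A * z) (∣∣-cong p) c , subst (λ z → 2 * z ≤ ∣ W ∣) (∣∣-cong p) d ,
     subst (λ z → ∣ W′ ∣ ≤ A * z) (∣∣-cong q) e , subst (λ z → 2 * z ≤ ∣ W′ ∣) (∣∣-cong q) f) ,
    subst₂ ℕ._<_ (cong (r *_) (edges-cong E p q)) (cong₂ ℕ._*_ (∣∣-cong p) (∣∣-cong q)) g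

  sparse? : ∀ {n} A r (E : Rel n) W W′ X Y → Dec (Sparse A r E W W′ X Y)
  sparse? A r E W W′ X Y =
    (⊆? X W ×-dec ⊆? Y W′ ×-dec (∣ W ∣ ℕ.≤? A * ∣ X ∣) ×-dec (2 * ∣ X ∣ ℕ.≤? ∣ W ∣)
      ×-dec (∣ W′ ∣ ℕ.≤? A * ∣ Y ∣) ×-dec (2 * ∣ Y ∣ ℕ.≤? ∣ W′ ∣))
    ×-dec (r * edges E X Y ℕ.<? ∣ X ∣ * ∣ Y ∣)

  robust-or-sparse : ∀ {n} A r (E : Rel n) W W′ → Robust A r E W W′ ⊎ (∃[ X ] ∃[ Y ] Sparse A r E W W′ X Y)
  robust-or-sparse A r E W W′
    with search (λ e (Y , s) → Y , Sparse-resp A r E W W′ e (λ _ → refl) s)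
                (λ X → search (λ e → Sparse-resp A r E W W′ (λ _ → refl) e) (sparse? A r E W W′ X))
  ... | yes s = inj₂ s
  ... | no ¬s = inj₁ (λ X Y adm → ≮⇒≥ (λ lt → ¬s (X , Y , adm , lt)))

  all-or-any : ∀ {m} {P Q : Fin m → Set} → (∀ i → P i ⊎ Q i) → (∀ i → P i) ⊎ ∃ Q
  all-or-any {zero}  f = inj₁ λ ()
  all-or-any {suc m} f with f zero | all-or-any (f ∘ suc)
  ... | inj₂ q | _            = inj₂ (zero , q)
  ... | inj₁ _ | inj₂ (i , q) = inj₂ (suc i , q)
  ... | inj₁ p | inj₁ ps      = inj₁ λ { zero → p ; (suc i) → ps i }

-- Convexity of the square

module Convexity where

  open Field

  sq : F → F
  sq x = x * x

  module _ {p q : F} (p+q : p + q ≡ 1F) where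

    p≡1-q : p ≡ 1F - q
    p≡1-q = trans (solve 2 (λ p q → p := p :+ q :- q) refl p q) (cong (_- q) p+q)

    mix-const : ∀ x → p * x + q * x ≡ x
    mix-const x = trans (sym (distribʳ x p q)) (trans (cong (_* x) p+q) (*-identityˡ x))

    module _ (0≤p : 0F ≤ p) (0≤q : 0F ≤ q) where

      sq-convex : ∀ x y → sq (p * x + q * y) ≤ p * sq x + q * sq y
      sq-convex x y = ≤-by (p * q * sq (x - y)) (*-nonneg (*-nonneg 0≤p 0≤q) (sq-nonneg (x - y)))
        (subst (λ p → p * sq x + q * sq y ≡ sq (p * x + q * y) + p * q * sq (x - y)) (sym p≡1-q)
          (solve 3 (λ q x y → (con (ℤ.+ 1) :- q) :* (x :* x) :+ q :* (y :* y)
             := ((con (ℤ.+ 1) :- q) :* x :+ q :* y) :* ((con (ℤ.+ 1) :- q) :* x :+ q :* y)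
                :+ (con (ℤ.+ 1) :- q) :* q :* ((x :- y) :* (x :- y))) refl q x y))

      mix-mono : ∀ {x x′ y y′} → x ≤ x′ → y ≤ y′ → p * x + q * y ≤ p * x′ + q * y′
      mix-mono a b = +-mono-≤ (*-monoˡ-≤ 0≤p a) (*-monoˡ-≤ 0≤q b)

  sq-mono : ∀ {x y} → 0F ≤ x → x ≤ y → sq x ≤ sq y
  sq-mono p q = *-mono-≤ p p q q

  -- Variance of a three-point distribution with weights p p′, p q′, q is at least the contribution of the first point.
  sq-gap : ∀ {p q p′ q′} → p + q ≡ 1F → p′ + q′ ≡ 1F → 0F ≤ p → 0F ≤ q → 0F ≤ p′ → 0F ≤ q′ → ∀ x y z →
           let D = p * (p′ * x + q′ * y) + q * z in
           sq D + p * p′ * sq (D - x) ≤ p * (p′ * sq x + q′ * sq y) + q * sq z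
  sq-gap {p} {q} {p′} {q′} e e′ 0≤p 0≤q 0≤p′ 0≤q′ x y z =
    ≤-by (p * q′ * sq (D - y) + q * sq (D - z))
      (+-nonneg (*-nonneg (*-nonneg 0≤p 0≤q′) (sq-nonneg _)) (*-nonneg 0≤q (sq-nonneg _)))
      (subst₂ Identity (sym (p≡1-q e)) (sym (p≡1-q e′))
        (solve 5 (λ q q′ x y z →
          let p  = con (ℤ.+ 1) :- q
              p′ = con (ℤ.+ 1) :- q′
              D  = p :* (p′ :* x :+ q′ :* y) :+ q :* z in
          p :* (p′ :* (x :* x) :+ q′ :* (y :* y)) :+ q :* (z :* z)
          := D :* D :+ p :* p′ :* ((D :- x) :* (D :- x))
             :+ (p :* q′ :* ((D :- y) :* (D :- y)) :+ q :* ((D :- z) :* (D :- z))))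
          refl q q′ x y z))
    where
    D = p * (p′ * x + q′ * y) + q * z
    Identity : F → F → Set
    Identity p p′ = let D = p * (p′ * x + q′ * y) + q * z in
      p * (p′ * sq x + q′ * sq y) + q * sq z
      ≡ sq D + p * p′ * sq (D - x) + (p * q′ * sq (D - y) + q * sq (D - z))

module Densities {n : ℕ} where

  open Field
  open Sets
  open Averages {n}
  open Convexity

  density : Rel n → Sub n → Sub n → F
  density R X Y = avg X Y (λ u v → ι (𝟙 (R u v)))

  density-nonneg : ∀ R X Y → 0F ≤ density R X Y
  density-nonneg R X Y = ≤-trans (≤-reflexive (sym zero-sum)) (sum₂-mono (λ u v →
      *-nonneg (μ-nonneg X u) (*-nonneg (μ-nonneg Y v) (ι-nonneg _))))
    where
    zero-sum : sum₂ {n} {n} (λ _ _ → 0F) ≡ 0F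
    zero-sum = sum-zero (λ _ → sum-0 n)

  density-≤1 : ∀ R {X Y} → 0 ℕ.< ∣ X ∣ → 0 ℕ.< ∣ Y ∣ → density R X Y ≤ 1F
  density-≤1 R {X} {Y} p q = ≤-trans (avg-mono X Y (λ u v → ι-mono (𝟙-≤1 (R u v)))) (≤-reflexive (avg-const p q 1F))

  -- The mean square error of a constant s exceeds that of the mean d by exactly (s - d)². This is
  -- used twice: a leaf density that deviates from s yields a gain, and the cell density is the best
  -- constant on a pair of cells.
  variance : ∀ (R : Rel n) {X Y} → 0 ℕ.< ∣ X ∣ → 0 ℕ.< ∣ Y ∣ → ∀ s → let d = density R X Y; g = λ u v → ι (𝟙 (R u v)) in
    avg X Y (λ u v → sq (g u v - s)) ≡ avg X Y (λ u v → sq (g u v - d)) + sq (s - d)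
  variance R {X} {Y} p q s = begin
    avg X Y (λ u v → sq (g u v - s))
      ≡⟨ avg-cong X Y (λ u v → solve 3 (λ g s d → (g :- s) :* (g :- s) := (g :- d) :* (g :- d) :+ (con (ℤ.+ 2) :* (d :- s) :* g :+ (s :* s :- d :* d))) refl (g u v) s d) ⟩
    _ ≡⟨ trans (avg-+ X Y _ _) (cong (avg X Y (λ u v → sq (g u v - d)) +_) (trans (avg-+ X Y _ _) (cong₂ _+_ (avg-* X Y _ _) (avg-const p q _)))) ⟩
    avg X Y (λ u v → sq (g u v - d)) + (ι 2 * (d - s) * d + (s * s - d * d))
      ≡⟨ cong (avg X Y (λ u v → sq (g u v - d)) +_) (solve 2 (λ s d → con (ℤ.+ 2) :* (d :- s) :* d :+ (s :* s :- d :* d) := (s :- d) :* (s :- d)) refl s d) ⟩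
    _ ∎
    where
    open ≡-Reasoning
    d = density R X Y
    g : Fin n → Fin n → F
    g u v = ι (𝟙 (R u v))

-- Tuples of vertex sets and binary trees of splits

module Cylinders {n : ℕ} (E : Bool → Sets.Rel n) (N A : ℕ) (0<N : 0 ℕ.< N) (2≤A : 2 ℕ.≤ A) (K : ℕ) where

  open Field
  open Sets
  open Averages {n}
  open Robustness
  open Convexity

  Cyl : Set
  Cyl = Fin K → Sub n

  Nonempty : Cyl → Set
  Nonempty W = ∀ i → 0 ℕ.< ∣ W i ∣

  upd : Cyl → Fin K → Sub n → Cyl
  upd W l X = updateAt W l (λ _ → X)

  -- A violation is a drop from density at least 1/N to below 1/(2N), hence a gap of at least 1/(2N)
  -- to feed the energy increment. Both colours are treated alike, since either may be prescribed by
  -- H.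
  Good : Cyl → Set
  Good W = ∀ c i j → i ≢ j → ∣ W i ∣ ℕ.* ∣ W j ∣ ℕ.≤ N ℕ.* edges (E c) (W i) (W j) →
           Robust A (2 ℕ.* N) (E c) (W i) (W j)

  Bad : Cyl → Set
  Bad W = ∃[ c ] ∃[ i ] ∃[ j ] i ≢ j × ∣ W i ∣ ℕ.* ∣ W j ∣ ℕ.≤ N ℕ.* edges (E c) (W i) (W j) ×
          (∃[ X ] ∃[ Y ] Sparse A (2 ℕ.* N) (E c) (W i) (W j) X Y)

  good? : ∀ W → Good W ⊎ Bad W
  good? W with colour true | colour false
    where
    colour : ∀ c → (∀ i j → i ≢ j → ∣ W i ∣ ℕ.* ∣ W j ∣ ℕ.≤ N ℕ.* edges (E c) (W i) (W j) →
                     Robust A (2 ℕ.* N) (E c) (W i) (W j))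
             ⊎ (∃[ i ] ∃[ j ] i ≢ j × ∣ W i ∣ ℕ.* ∣ W j ∣ ℕ.≤ N ℕ.* edges (E c) (W i) (W j) ×
                 (∃[ X ] ∃[ Y ] Sparse A (2 ℕ.* N) (E c) (W i) (W j) X Y))
    colour c = all-or-any (λ i → all-or-any (λ j → pair i j))
      where
      pair : ∀ i j → _ ⊎ _
      pair i j with i ≟ j | ∣ W i ∣ ℕ.* ∣ W j ∣ ℕ.≤? N ℕ.* edges (E c) (W i) (W j)
      ... | yes e | _    = inj₁ (λ i≢j _ → contradiction e i≢j)
      ... | no  _ | no ¬d = inj₁ (λ _ d → contradiction d ¬d)
      ... | no i≢j | yes d with robust-or-sparse A (2 ℕ.* N) (E c) (W i) (W j)
      ... | inj₁ rb = inj₁ (λ _ _ → rb)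
      ... | inj₂ sp = inj₂ (i≢j , d , sp)
  ... | inj₂ b | _      = inj₂ (true , b)
  ... | inj₁ _ | inj₂ b = inj₂ (false , b)
  ... | inj₁ g | inj₁ h = inj₁ λ { true → g ; false → h }

  isGood : Cyl → Bool
  isGood W with good? W
  ... | inj₁ _ = true
  ... | inj₂ _ = false

  isGood-sound : ∀ W → isGood W ≡ true → Good W
  isGood-sound W e with good? W
  ... | inj₁ g = g

  Balanced : Sub n → Sub n → Set
  Balanced X S = ∣ X ∣ ℕ.≤ A ℕ.* ∣ X ∩ S ∣ × ∣ X ∣ ℕ.≤ A ℕ.* ∣ X ∖ S ∣

  pos-of-≤* : ∀ {a b m} → 0 ℕ.< a → a ℕ.≤ m ℕ.* b → 0 ℕ.< b
  pos-of-≤* {b = zero} {m} p q = contradiction (ℕₚ.≤-trans p (ℕₚ.≤-trans q (ℕₚ.≤-reflexive (ℕₚ.*-zeroʳ m)))) ℕₚ.1+n≰n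
  pos-of-≤* {b = suc b} p q = s≤s z≤n

  -- A leaf is allowed at every index, so the index bounds the depth and branches may stop early.
  data Tree : ℕ → Cyl → Set where
    leaf : ∀ {t W} → Tree t W
    node : ∀ {t W} l S → Balanced (W l) S →
           Tree t (upd W l (W l ∩ S)) → Tree t (upd W l (W l ∖ S)) → Tree (suc t) W

  -- The expectation over the random leaf reached when every node chooses a side with probability
  -- proportional to its size.
  AVG : ∀ {t W} → Tree t W → (Cyl → F) → F
  AVG {W = W} leaf f = f W
  AVG {W = W} (node l S _ a b) f = ratio (W l) (W l ∩ S) * AVG a f + ratio (W l) (W l ∖ S) * AVG b f

  upd-at : ∀ W l X → upd W l X l ≡ X
  upd-at W l X = updateAt-updates l W

  upd-off : ∀ W {l i} X → i ≢ l → upd W l X i ≡ W i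
  upd-off W {l} {i} X ne = updateAt-minimal i l W ne

  upd-⊆ : ∀ W l {X} → X ⊆ W l → ∀ i → upd W l X i ⊆ W i
  upd-⊆ W l {X} s i with i ≟ l
  ... | yes refl = subst (_⊆ W i) (sym (upd-at W l X)) s
  ... | no ne = subst (_⊆ W i) (sym (upd-off W X ne)) (λ _ e → e)

  1≤A : 1 ℕ.≤ A
  1≤A = ℕₚ.≤-trans (ℕₚ.n≤1+n 1) 2≤A

  upd-size : ∀ W l {X} → ∣ W l ∣ ℕ.≤ A ℕ.* ∣ X ∣ → ∀ i → ∣ W i ∣ ℕ.≤ A ℕ.* ∣ upd W l X i ∣
  upd-size W l {X} s i with i ≟ l
  ... | yes refl = subst (λ Z → ∣ W i ∣ ℕ.≤ A ℕ.* ∣ Z ∣) (sym (upd-at W l X)) s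
  ... | no ne = subst (λ Z → ∣ W i ∣ ℕ.≤ A ℕ.* ∣ Z ∣) (sym (upd-off W X ne))
                  (ℕₚ.≤-trans (ℕₚ.≤-reflexive (sym (ℕₚ.*-identityˡ _))) (ℕₚ.*-monoˡ-≤ ∣ W i ∣ 1≤A))

  upd-nonempty : ∀ W l {X} → Nonempty W → ∣ W l ∣ ℕ.≤ A ℕ.* ∣ X ∣ → Nonempty (upd W l X)
  upd-nonempty W l ne s i = pos-of-≤* {m = A} (ne i) (upd-size W l s i)

  module _ {W : Cyl} {l : Fin K} {S : Sub n} (ne : Nonempty W) (bal : Balanced (W l) S) where

    child₁ : Nonempty (upd W l (W l ∩ S))
    child₁ = upd-nonempty W l ne (proj₁ bal)

    child₂ : Nonempty (upd W l (W l ∖ S))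
    child₂ = upd-nonempty W l ne (proj₂ bal)

    weights : ratio (W l) (W l ∩ S) + ratio (W l) (W l ∖ S) ≡ 1F
    weights = ratio-split (W l) S (ne l)

    -- The martingale property of densities: since i and j differ, a split of part l cuts at most
    -- one of the two sets, and if it cuts neither, the two children carry equal values.
    avg-node : ∀ {i j} → i ≢ j → ∀ φ →
               avg (W i) (W j) φ ≡ ratio (W l) (W l ∩ S) * avg (upd W l (W l ∩ S) i) (upd W l (W l ∩ S) j) φ
                                 + ratio (W l) (W l ∖ S) * avg (upd W l (W l ∖ S) i) (upd W l (W l ∖ S) j) φ
    avg-node {i} {j} i≢j φ with i ≟ l | j ≟ l
    ... | yes refl | yes refl = contradiction refl i≢j
    ... | yes refl | no j≢l = trans (avg-splitˡ (W l) S (W j) φ (pos-of-≤* {m = A} (ne l) (proj₁ bal)) (pos-of-≤* {m = A} (ne l) (proj₂ bal)))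
      (cong₂ _+_ (cong (_ *_) (cong₂ (λ X Y → avg X Y φ) (sym (upd-at W l _)) (sym (upd-off W _ j≢l))))
                 (cong (_ *_) (cong₂ (λ X Y → avg X Y φ) (sym (upd-at W l _)) (sym (upd-off W _ j≢l)))))
    ... | no i≢l | yes refl = trans (avg-splitʳ (W i) (W l) S φ (pos-of-≤* {m = A} (ne l) (proj₁ bal)) (pos-of-≤* {m = A} (ne l) (proj₂ bal)))
      (cong₂ _+_ (cong (_ *_) (cong₂ (λ X Y → avg X Y φ) (sym (upd-off W _ i≢l)) (sym (upd-at W l _))))
                 (cong (_ *_) (cong₂ (λ X Y → avg X Y φ) (sym (upd-off W _ i≢l)) (sym (upd-at W l _)))))
    ... | no i≢l | no j≢l = trans (sym (mix-const weights _))
      (cong₂ _+_ (cong (_ *_) (cong₂ (λ X Y → avg X Y φ) (sym (upd-off W _ i≢l)) (sym (upd-off W _ j≢l))))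
                 (cong (_ *_) (cong₂ (λ X Y → avg X Y φ) (sym (upd-off W _ i≢l)) (sym (upd-off W _ j≢l)))))

  AVG-cong : ∀ {t W} (τ : Tree t W) {f g} → (∀ V → f V ≡ g V) → AVG τ f ≡ AVG τ g
  AVG-cong {W = W} leaf p = p W
  AVG-cong (node l S bal a b) p = cong₂ (λ y z → _ * y + _ * z) (AVG-cong a p) (AVG-cong b p)

  AVG-const : ∀ {t W} (τ : Tree t W) → Nonempty W → ∀ x → AVG τ (λ _ → x) ≡ x
  AVG-const leaf ne x = refl
  AVG-const (node l S bal a b) ne x =
    trans (cong₂ (λ y z → _ * y + _ * z) (AVG-const a (child₁ ne bal) x) (AVG-const b (child₂ ne bal) x))
          (mix-const (weights ne bal) x)

  AVG-+ : ∀ {t W} (τ : Tree t W) f g → AVG τ (λ V → f V + g V) ≡ AVG τ f + AVG τ g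
  AVG-+ leaf f g = refl
  AVG-+ {W = W} (node l S bal a b) f g =
    trans (cong₂ (λ y z → _ * y + _ * z) (AVG-+ a f g) (AVG-+ b f g))
      (solve 6 (λ p q x y z w → p :* (x :+ y) :+ q :* (z :+ w) := p :* x :+ q :* z :+ (p :* y :+ q :* w)) refl
        (ratio (W l) (W l ∩ S)) (ratio (W l) (W l ∖ S)) (AVG a f) (AVG a g) (AVG b f) (AVG b g))

  AVG-* : ∀ {t W} (τ : Tree t W) c f → AVG τ (λ V → c * f V) ≡ c * AVG τ f
  AVG-* leaf c f = refl
  AVG-* {W = W} (node l S bal a b) c f =
    trans (cong₂ (λ y z → _ * y + _ * z) (AVG-* a c f) (AVG-* b c f))
      (solve 5 (λ p q c x y → p :* (c :* x) :+ q :* (c :* y) := c :* (p :* x :+ q :* y)) refl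
        (ratio (W l) (W l ∩ S)) (ratio (W l) (W l ∖ S)) c (AVG a f) (AVG b f))

  AVG-sum : ∀ {t W m} (τ : Tree t W) (f : Fin m → Cyl → F) → AVG τ (λ V → sum (λ i → f i V)) ≡ sum (λ i → AVG τ (f i))
  AVG-sum leaf f = refl
  AVG-sum {W = W} (node l S bal a b) f =
    trans (cong₂ (λ y z → _ * y + _ * z) (AVG-sum a f) (AVG-sum b f))
      (trans (cong₂ _+_ (sum-*ˡ _ _) (sum-*ˡ _ _)) (sym (sum-+ _ _)))

  AVG-mono : ∀ {t W} (τ : Tree t W) → Nonempty W → ∀ {f g} → (∀ V → Nonempty V → f V ≤ g V) → AVG τ f ≤ AVG τ g
  AVG-mono {W = W} leaf ne p = p W ne
  AVG-mono {W = W} (node l S bal a b) ne p =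
    mix-mono (weights ne bal) (ratio-nonneg (W l) _) (ratio-nonneg (W l) _)
      (AVG-mono a (child₁ ne bal) p) (AVG-mono b (child₂ ne bal) p)

  -- Strict positivity is expressed as a failure of `_≤_`, the only order on F.
  Descendant : ℕ → (Cyl → F) → Cyl → Set
  Descendant t f W = ∃[ V ] Nonempty V × (∀ i → V i ⊆ W i) × (∀ i → ∣ W i ∣ ℕ.≤ A ℕ.^ t ℕ.* ∣ V i ∣) × ¬ (f V ≤ 0F)

  descend : ∀ {t f} W l {X} → X ⊆ W l → ∣ W l ∣ ℕ.≤ A ℕ.* ∣ X ∣ → Descendant t f (upd W l X) → Descendant (suc t) f W
  descend W l s z (V , ne′ , s′ , z′ , q) = V , ne′ , (λ i u e → upd-⊆ W l s i u (s′ i u e)) ,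
    (λ i → ℕₚ.≤-trans (upd-size W l z i) (ℕₚ.≤-trans (ℕₚ.*-monoʳ-≤ A (z′ i)) (ℕₚ.≤-reflexive (sym (ℕₚ.*-assoc A _ _))))) , q

  -- First-moment argument made effective: if the mean over a tree is positive, it is positive over
  -- one of the two subtrees, and comparison is decidable. Every level costs a factor A in size.
  AVG-positive : ∀ {t W} (τ : Tree t W) → Nonempty W → ∀ {f} → ¬ (AVG τ f ≤ 0F) → Descendant t f W
  AVG-positive {t} {W} leaf ne p = W , ne , (λ _ _ e → e) ,
    (λ i → ℕₚ.≤-trans (ℕₚ.≤-reflexive (sym (ℕₚ.*-identityˡ _))) (ℕₚ.*-monoˡ-≤ ∣ W i ∣ (ℕₚ.^-monoʳ-≤ A {{ℕ.>-nonZero 1≤A}} {0} {t} z≤n))) , p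
  AVG-positive {suc t} {W} (node l S bal a b) ne {f} p with AVG a f ≤? 0F | AVG b f ≤? 0F
  ... | yes u | yes v = contradiction (≤-trans (mix-mono (weights ne bal) (ratio-nonneg (W l) _) (ratio-nonneg (W l) _) u v)
                          (≤-reflexive (mix-const (weights ne bal) 0F))) p
  ... | no u  | _     = descend {t = t} {f = f} W l (∩-⊆ (W l) S) (proj₁ bal) (AVG-positive a (child₁ ne bal) u)
  ... | yes _ | no v  = descend {t = t} {f = f} W l (∖-⊆ (W l) S) (proj₂ bal) (AVG-positive b (child₂ ne bal) v)

-- The energy increment

module CylinderRegularity {n : ℕ} (E : Bool → Sets.Rel n) (N A : ℕ) (0<N : 0 ℕ.< N) (2≤A : 2 ℕ.≤ A) (K : ℕ) where

  open Field
  open Sets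
  open Averages {n}
  open Robustness
  open Convexity
  open Densities {n}
  open Cylinders E N A 0<N 2≤A K public

  -- Splitting part l changes both arguments of the pair (l, l), whose density is then not a mixture
  -- of the new ones. The diagonal therefore stays out of the energy.
  offDiagonal : Fin K → Fin K → F → F
  offDiagonal i j x = if ⌊ i ≟ j ⌋ then 0F else x

  energyTerm : Bool → Cyl → Fin K → Fin K → F
  energyTerm c W i j = offDiagonal i j (sq (density (E c) (W i) (W j)))

  energy : Cyl → F
  energy W = sum₂ (energyTerm true W) + sum₂ (energyTerm false W)

  energyTerm-≤1 : ∀ c {W} → Nonempty W → ∀ i j → energyTerm c W i j ≤ 1F
  energyTerm-≤1 c {W} ne i j with i ≟ j
  ... | yes _ = ι-mono z≤n
  ... | no _  = ≤-trans (sq-mono (density-nonneg (E c) (W i) (W j)) (density-≤1 (E c) (ne i) (ne j))) (≤-reflexive (*-identityˡ 1F))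

  energy-≤ : ∀ {W} → Nonempty W → energy W ≤ ι (2 ℕ.* (K ℕ.* K))
  energy-≤ {W} ne = begin
    energy W ≤⟨ +-mono-≤ (sum₂-mono (energyTerm-≤1 true ne)) (sum₂-mono (energyTerm-≤1 false ne)) ⟩
    sum₂ (λ _ _ → 1F) + sum₂ (λ _ _ → 1F) ≡⟨ cong₂ _+_ (sum₂-1 K) (sum₂-1 K) ⟩
    ι (K ℕ.* K) + ι (K ℕ.* K) ≡⟨ sym (ι-+ (K ℕ.* K) (K ℕ.* K)) ⟩
    ι (K ℕ.* K ℕ.+ K ℕ.* K) ≡⟨ cong (λ z → ι (K ℕ.* K ℕ.+ z)) (sym (ℕₚ.+-identityʳ _)) ⟩
    ι (2 ℕ.* (K ℕ.* K)) ∎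
    where open ≤-Reasoning

  energy-nonneg : ∀ W → 0F ≤ energy W
  energy-nonneg W = +-nonneg (term true) (term false)
    where
    term : ∀ c → 0F ≤ sum₂ (energyTerm c W)
    term c = ≤-trans (≤-reflexive (sym (sum-zero {K} (λ _ → sum-0 K)))) (sum₂-mono pointwise)
      where
      pointwise : ∀ i j → 0F ≤ energyTerm c W i j
      pointwise i j with i ≟ j
      ... | yes _ = ≤-refl
      ... | no _  = sq-nonneg _

  sum₂-mono-gap : ∀ {m k} {f g : Fin m → Fin k → F} {γ} → (∀ i j → f i j ≤ g i j) →
                  ∀ i j → f i j + γ ≤ g i j → sum₂ f + γ ≤ sum₂ g
  sum₂-mono-gap p i j q = sum-mono-≤-gap (λ i → sum-mono-≤ (p i)) i (sum-mono-≤-gap (p i) j q)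

  sum₂-mix : ∀ {m k} p q (f g : Fin m → Fin k → F) → p * sum₂ f + q * sum₂ g ≡ sum₂ (λ i j → p * f i j + q * g i j)
  sum₂-mix p q f g = trans (cong₂ _+_ (sym (sum₂-* p f)) (sym (sum₂-* q g))) (sym (sum₂-+ _ _))

  energyTerm-node : ∀ {W l S} → Nonempty W → Balanced (W l) S → ∀ c i j →
    energyTerm c W i j ≤ ratio (W l) (W l ∩ S) * energyTerm c (upd W l (W l ∩ S)) i j
                       + ratio (W l) (W l ∖ S) * energyTerm c (upd W l (W l ∖ S)) i j
  energyTerm-node {W} {l} {S} ne bal c i j with i ≟ j
  ... | yes _ = ≤-reflexive (sym (mix-const (weights ne bal) 0F))
  ... | no i≢j = ≤-trans (≤-reflexive (cong sq (avg-node ne bal i≢j _)))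
                   (sq-convex (weights ne bal) (ratio-nonneg (W l) _) (ratio-nonneg (W l) _) _ _)

  -- The guaranteed gain of one step: the witness pair receives weight at least 1/A · 1/A in the
  -- mixture, and its density is off by at least 1/(2N).
  γ : F
  γ = inv A * inv A * sq (inv (2 ℕ.* N))

  0<A : 0 ℕ.< A
  0<A = 1≤A

  0<2N : 0 ℕ.< 2 ℕ.* N
  0<2N = ℕₚ.<-≤-trans 0<N (ℕₚ.m≤m+n N _)

  inv-N : inv N ≡ inv (2 ℕ.* N) + inv (2 ℕ.* N)
  inv-N = sym (begin
    i + i ≡⟨ cong₂ _+_ e e ⟩
    inv 2 * inv N + inv 2 * inv N ≡⟨ solve 2 (λ x y → x :* y :+ x :* y := con (ℤ.+ 2) :* x :* y) refl (inv 2) (inv N) ⟩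
    ι 2 * inv 2 * inv N ≡⟨ cong (_* inv N) (inv-inverse {2} (s≤s z≤n)) ⟩
    1F * inv N ≡⟨ *-identityˡ _ ⟩
    inv N ∎)
    where
    open ≡-Reasoning
    i = inv (2 ℕ.* N)
    e = inv-* {2} {N} (s≤s z≤n) 0<N

  density-gap : ∀ c {X Y X′ Y′} → 0 ℕ.< ∣ X ∣ → 0 ℕ.< ∣ Y ∣ → 0 ℕ.< ∣ X′ ∣ → 0 ℕ.< ∣ Y′ ∣ →
    ∣ X ∣ ℕ.* ∣ Y ∣ ℕ.≤ N ℕ.* edges (E c) X Y → 2 ℕ.* N ℕ.* edges (E c) X′ Y′ ℕ.≤ ∣ X′ ∣ ℕ.* ∣ Y′ ∣ →
    inv (2 ℕ.* N) ≤ density (E c) X Y - density (E c) X′ Y′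
  density-gap c {X} {Y} {X′} {Y′} x y x′ y′ p q = begin
    inv (2 ℕ.* N) ≡⟨ solve 1 (λ i → i := i :+ i :- i) refl _ ⟩
    inv (2 ℕ.* N) + inv (2 ℕ.* N) - inv (2 ℕ.* N) ≡⟨ cong (_- inv (2 ℕ.* N)) (sym inv-N) ⟩
    inv N - inv (2 ℕ.* N) ≤⟨ +-mono-≤ low (neg high) ⟩
    density (E c) X Y - density (E c) X′ Y′ ∎
    where
    open ≤-Reasoning
    low : inv N ≤ density (E c) X Y
    low = ≤-trans (inv-≤-ratio (ℕₚ.*-mono-< x y) 0<N p) (≤-reflexive (sym (avg-edges (E c) X Y x y)))
    high : density (E c) X′ Y′ ≤ inv (2 ℕ.* N)
    high = ≤-trans (≤-reflexive (avg-edges (E c) X′ Y′ x′ y′)) (ratio-≤-inv (ℕₚ.*-mono-< x′ y′) 0<2N q)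
    neg : ∀ {a b} → a ≤ b → - b ≤ - a
    neg {a} {b} h = ≤-by (b - a) (≤⇒0≤- h) (solve 2 (λ a b → :- a := :- b :+ (b :- a)) refl a b)

  -- One refinement step: split part i by X, then, inside X, part j by Y.
  module Step {W : Cyl} (ne : Nonempty W) {c i j} (i≢j : i ≢ j)
              (dense : ∣ W i ∣ ℕ.* ∣ W j ∣ ℕ.≤ N ℕ.* edges (E c) (W i) (W j))
              {X Y : Sub n} (sparse : Sparse A (2 ℕ.* N) (E c) (W i) (W j) X Y) where

    X⊆ : X ⊆ W i
    X⊆ = proj₁ (proj₁ sparse)
    Y⊆ : Y ⊆ W j
    Y⊆ = proj₁ (proj₂ (proj₁ sparse))

    -- The complement of V contains at least half of Z, which is a share of at least 1/A because 2 ≤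
    -- A.
    balanced : ∀ {Z V : Sub n} → V ⊆ Z → ∣ Z ∣ ℕ.≤ A ℕ.* ∣ V ∣ → 2 ℕ.* ∣ V ∣ ℕ.≤ ∣ Z ∣ → Balanced Z V
    balanced {Z} {V} s p q = subst (λ z → ∣ Z ∣ ℕ.≤ A ℕ.* z) (sym e) p , ℕₚ.≤-trans half (ℕₚ.*-monoˡ-≤ ∣ Z ∖ V ∣ 2≤A)
      where
      e : ∣ Z ∩ V ∣ ≡ ∣ V ∣
      e = ∣∣-cong (⊆⇒∩ s)
      split : ∣ Z ∣ ≡ ∣ V ∣ ℕ.+ ∣ Z ∖ V ∣
      split = trans (∣∣-split Z V) (cong (ℕ._+ ∣ Z ∖ V ∣) e)
      small : ∣ V ∣ ℕ.≤ ∣ Z ∖ V ∣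
      small = ℕₚ.+-cancelˡ-≤ ∣ V ∣ _ _ (ℕₚ.≤-trans (ℕₚ.≤-reflexive (cong (∣ V ∣ ℕ.+_) (sym (ℕₚ.+-identityʳ _))))
                (ℕₚ.≤-trans q (ℕₚ.≤-reflexive split)))
      half : ∣ Z ∣ ℕ.≤ 2 ℕ.* ∣ Z ∖ V ∣
      half = ℕₚ.≤-trans (ℕₚ.≤-reflexive split) (ℕₚ.≤-trans (ℕₚ.+-monoˡ-≤ _ small)
               (ℕₚ.≤-reflexive (cong (∣ Z ∖ V ∣ ℕ.+_) (sym (ℕₚ.+-identityʳ _)))))

    balX : Balanced (W i) X
    balX = balanced X⊆ (proj₁ (proj₂ (proj₂ (proj₁ sparse)))) (proj₁ (proj₂ (proj₂ (proj₂ (proj₁ sparse)))))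

    W₁ W₂ : Cyl
    W₁ = upd W i (W i ∩ X)
    W₂ = upd W i (W i ∖ X)

    W₁j : W₁ j ≡ W j
    W₁j = upd-off W _ (i≢j ∘ sym)

    balY : Balanced (W₁ j) Y
    balY = subst (λ Z → Balanced Z Y) (sym W₁j)
      (balanced Y⊆ (proj₁ (proj₂ (proj₂ (proj₂ (proj₂ (proj₁ sparse)))))) (proj₂ (proj₂ (proj₂ (proj₂ (proj₂ (proj₁ sparse)))))))

    W₁₁ W₁₂ : Cyl
    W₁₁ = upd W₁ j (W₁ j ∩ Y)
    W₁₂ = upd W₁ j (W₁ j ∖ Y)

    ne₁ : Nonempty W₁
    ne₁ = child₁ ne balX
    ne₂ : Nonempty W₂
    ne₂ = child₂ ne balX
    ne₁₁ : Nonempty W₁₁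
    ne₁₁ = child₁ ne₁ balY
    ne₁₂ : Nonempty W₁₂
    ne₁₂ = child₂ ne₁ balY

    p q p′ q′ : F
    p  = ratio (W i) (W i ∩ X)
    q  = ratio (W i) (W i ∖ X)
    p′ = ratio (W₁ j) (W₁ j ∩ Y)
    q′ = ratio (W₁ j) (W₁ j ∖ Y)

    0≤p : 0F ≤ p
    0≤p = ratio-nonneg (W i) _
    0≤q : 0F ≤ q
    0≤q = ratio-nonneg (W i) _
    0≤p′ : 0F ≤ p′
    0≤p′ = ratio-nonneg (W₁ j) _
    0≤q′ : 0F ≤ q′
    0≤q′ = ratio-nonneg (W₁ j) _

    mix : F → F → F → F
    mix x y z = p * (p′ * x + q′ * y) + q * z

    mix-mono₃ : ∀ {x x′ y y′ z z′} → x ≤ x′ → y ≤ y′ → z ≤ z′ → mix x y z ≤ mix x′ y′ z′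
    mix-mono₃ a b c = mix-mono (weights ne balX) 0≤p 0≤q (mix-mono (weights ne₁ balY) 0≤p′ 0≤q′ a b) c

    mix-sum₂ : ∀ (f g h : Fin K → Fin K → F) → mix (sum₂ f) (sum₂ g) (sum₂ h) ≡ sum₂ (λ k l → mix (f k l) (g k l) (h k l))
    mix-sum₂ f g h = trans (cong (λ z → p * z + q * sum₂ h) (sum₂-mix p′ q′ f g)) (sum₂-mix p q _ h)

    term-mono : ∀ c k l → energyTerm c W k l ≤ mix (energyTerm c W₁₁ k l) (energyTerm c W₁₂ k l) (energyTerm c W₂ k l)
    term-mono c k l = ≤-trans (energyTerm-node ne balX c k l)
      (mix-mono (weights ne balX) 0≤p 0≤q (energyTerm-node ne₁ balY c k l) ≤-refl)

    X≡ : W₁₁ i ≡ W i ∩ X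
    X≡ = trans (upd-off W₁ _ i≢j) (upd-at W i _)
    Y≡ : W₁₁ j ≡ W j ∩ Y
    Y≡ = trans (upd-at W₁ j _) (cong (_∩ Y) W₁j)

    gap : inv (2 ℕ.* N) ≤ density (E c) (W i) (W j) - density (E c) (W₁₁ i) (W₁₁ j)
    gap = density-gap c (ne i) (ne j) (ne₁₁ i) (ne₁₁ j) dense
      (subst₂ (λ X′ Y′ → 2 ℕ.* N ℕ.* edges (E c) X′ Y′ ℕ.≤ ∣ X′ ∣ ℕ.* ∣ Y′ ∣) (sym X≡) (sym Y≡)
        (subst₂ ℕ._≤_ (cong (2 ℕ.* N ℕ.*_) (edges-cong (E c) (λ u → sym (⊆⇒∩ X⊆ u)) (λ u → sym (⊆⇒∩ Y⊆ u))))
          (cong₂ ℕ._*_ (∣∣-cong (λ u → sym (⊆⇒∩ X⊆ u))) (∣∣-cong (λ u → sym (⊆⇒∩ Y⊆ u)))) (ℕₚ.<⇒≤ (proj₂ sparse))))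

    term-gap : energyTerm c W i j + γ ≤ mix (energyTerm c W₁₁ i j) (energyTerm c W₁₂ i j) (energyTerm c W₂ i j)
    term-gap with i ≟ j
    ... | yes e = contradiction e i≢j
    ... | no _ = begin
      sq (density (E c) (W i) (W j)) + γ ≤⟨ +-mono-≤ ≤-refl (*-mono-≤ (*-nonneg (inv-nonneg A) (inv-nonneg A)) (sq-nonneg _)
           (*-mono-≤ (inv-nonneg A) (inv-nonneg A) (inv-≤-ratio (ne i) 0<A (proj₁ balX)) (inv-≤-ratio (ne₁ j) 0<A (proj₁ balY)))
           (sq-mono (inv-nonneg _) gap)) ⟩
      sq D + p * p′ * sq (D - density (E c) (W₁₁ i) (W₁₁ j)) ≡⟨ cong (λ D → sq D + p * p′ * sq (D - density (E c) (W₁₁ i) (W₁₁ j))) average ⟩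
      _ ≤⟨ sq-gap (weights ne balX) (weights ne₁ balY) 0≤p 0≤q 0≤p′ 0≤q′ _ _ _ ⟩
      _ ∎
      where
      open ≤-Reasoning
      D = density (E c) (W i) (W j)
      average : D ≡ mix (density (E c) (W₁₁ i) (W₁₁ j)) (density (E c) (W₁₂ i) (W₁₂ j)) (density (E c) (W₂ i) (W₂ j))
      average = trans (avg-node ne balX i≢j _) (cong (λ z → p * z + q * density (E c) (W₂ i) (W₂ j)) (avg-node ne₁ balY i≢j _))

    energy-step : energy W + γ ≤ mix (energy W₁₁) (energy W₁₂) (energy W₂)
    energy-step = ≤-trans (colour c refl) (≤-reflexive regroup)
      where
      M : Bool → F
      M c = mix (sum₂ (energyTerm c W₁₁)) (sum₂ (energyTerm c W₁₂)) (sum₂ (energyTerm c W₂))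
      mono : ∀ c → sum₂ (energyTerm c W) ≤ M c
      mono c = ≤-trans (sum₂-mono (term-mono c)) (≤-reflexive (sym (mix-sum₂ _ _ _)))
      gapped : sum₂ (energyTerm c W) + γ ≤ M c
      gapped = ≤-trans (sum₂-mono-gap (term-mono c) i j term-gap) (≤-reflexive (sym (mix-sum₂ _ _ _)))
      colour : ∀ c′ → c ≡ c′ → energy W + γ ≤ M true + M false
      colour true refl = ≤-trans (≤-reflexive (solve 3 (λ a b c → a :+ b :+ c := a :+ c :+ b) refl _ _ γ)) (+-mono-≤ gapped (mono false))
      colour false refl = ≤-trans (≤-reflexive (+-assoc _ _ γ)) (+-mono-≤ (mono true) gapped)
      regroup : M true + M false ≡ mix (energy W₁₁) (energy W₁₂) (energy W₂)
      regroup = solve 10 (λ p q p′ q′ a b c d e f → p :* (p′ :* a :+ q′ :* b) :+ q :* c :+ (p :* (p′ :* d :+ q′ :* e) :+ q :* f)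
          := p :* (p′ :* (a :+ d) :+ q′ :* (b :+ e)) :+ q :* (c :+ f)) refl p q p′ q′ _ _ _ _ _ _

  -- Outside the witness X a step makes one split, inside it two; the depth bound of the shallower
  -- branch is padded to match.
  weaken : ∀ {t W} → Tree t W → Tree (suc t) W
  weaken leaf = leaf
  weaken (node l S bal a b) = node l S bal (weaken a) (weaken b)

  AVG-weaken : ∀ {t W} (τ : Tree t W) f → AVG (weaken τ) f ≡ AVG τ f
  AVG-weaken leaf f = refl
  AVG-weaken (node l S bal a b) f = cong₂ (λ x y → _ * x + _ * y) (AVG-weaken a f) (AVG-weaken b f)

  bad : Cyl → F
  bad W = ι (𝟙 (not (isGood W)))

  build : ∀ t W → Nonempty W → Tree (t ℕ.* 2) W
  build zero    W ne = leaf
  build (suc t) W ne with good? W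
  ... | inj₁ _ = leaf
  ... | inj₂ (c , i , j , i≢j , dense , X , Y , sparse) =
    node i X balX (node j Y balY (build t W₁₁ ne₁₁) (build t W₁₂ ne₁₂)) (weaken (build t W₂ ne₂))
    where open Step ne i≢j dense sparse

  -- A leaf that is still bad at the end comes from t successive splits along witnesses, each of
  -- which gains γ on average. A tuple that has become good stops being split and contributes 0 to
  -- the mean of `bad`.
  energy-build : ∀ t W ne → energy W + γ * ι t * AVG (build t W ne) bad ≤ AVG (build t W ne) energy
  energy-build zero W ne = ≤-reflexive (solve 3 (λ e g b → e :+ g :* con (ℤ.+ 0) :* b := e) refl (energy W) γ (bad W))
  energy-build (suc t) W ne with good? W in eq
  ... | inj₁ _ rewrite eq = ≤-reflexive (solve 3 (λ e g b → e :+ g :* b :* con (ℤ.+ 0) := e) refl (energy W) γ (ι (suc t)))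
  ... | inj₂ (c , i , j , i≢j , dense , X , Y , sparse) = begin
    energy W + γ * ι (suc t) * B ≡⟨ cong (λ s → energy W + γ * s * B) (ι-+ 1 t) ⟩
    energy W + γ * (1F + ι t) * B ≡⟨ solve 4 (λ e g t b → e :+ g :* (con (ℤ.+ 1) :+ t) :* b := e :+ g :* b :+ g :* t :* b) refl (energy W) γ (ι t) B ⟩
    -- The current split gains a full γ, and γ · B is at most that because B is a probability.
    energy W + γ * B + γ * ι t * B ≤⟨ +-mono-≤ (+-mono-≤ ≤-refl (≤-trans (*-monoˡ-≤ 0≤γ B≤1) (≤-reflexive (*-identityʳ γ)))) ≤-refl ⟩
    energy W + γ + γ * ι t * B ≤⟨ +-mono-≤ energy-step ≤-refl ⟩
    mix (energy W₁₁) (energy W₁₂) (energy W₂) + γ * ι t * B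
      ≡⟨ cong (λ z → mix (energy W₁₁) (energy W₁₂) (energy W₂) + γ * ι t * (p * (p′ * AVG (build t W₁₁ ne₁₁) bad + q′ * AVG (build t W₁₂ ne₁₂) bad) + q * z)) (AVG-weaken (build t W₂ ne₂) bad) ⟩
    mix (energy W₁₁) (energy W₁₂) (energy W₂) + γ * ι t * mix (AVG (build t W₁₁ ne₁₁) bad) (AVG (build t W₁₂ ne₁₂) bad) (AVG (build t W₂ ne₂) bad)
      ≡⟨ solve 11 (λ p q p′ q′ a b c d e f g → p :* (p′ :* a :+ q′ :* b) :+ q :* c :+ g :* (p :* (p′ :* d :+ q′ :* e) :+ q :* f)
          := p :* (p′ :* (a :+ g :* d) :+ q′ :* (b :+ g :* e)) :+ q :* (c :+ g :* f)) refl p q p′ q′ _ _ _ _ _ _ (γ * ι t) ⟩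
    mix (energy W₁₁ + γ * ι t * AVG (build t W₁₁ ne₁₁) bad) (energy W₁₂ + γ * ι t * AVG (build t W₁₂ ne₁₂) bad) (energy W₂ + γ * ι t * AVG (build t W₂ ne₂) bad)
      ≤⟨ mix-mono₃ (energy-build t W₁₁ ne₁₁) (energy-build t W₁₂ ne₁₂) (energy-build t W₂ ne₂) ⟩
    mix (AVG (build t W₁₁ ne₁₁) energy) (AVG (build t W₁₂ ne₁₂) energy) (AVG (build t W₂ ne₂) energy)
      ≡⟨ cong (λ z → p * (p′ * AVG (build t W₁₁ ne₁₁) energy + q′ * AVG (build t W₁₂ ne₁₂) energy) + q * z) (sym (AVG-weaken (build t W₂ ne₂) energy)) ⟩
    AVG τ energy ∎
    where
    open ≤-Reasoning
    open Step ne i≢j dense sparse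
    τ : Tree (suc (suc (t ℕ.* 2))) W
    τ = node i X balX (node j Y balY (build t W₁₁ ne₁₁) (build t W₁₂ ne₁₂)) (weaken (build t W₂ ne₂))
    B = AVG τ bad
    0≤γ : 0F ≤ γ
    0≤γ = *-nonneg (*-nonneg (inv-nonneg A) (inv-nonneg A)) (sq-nonneg _)
    B≤1 : B ≤ 1F
    B≤1 = ≤-trans (AVG-mono τ ne (λ V _ → ι-mono (𝟙-≤1 (not (isGood V))))) (≤-reflexive (AVG-const τ ne 1F))

-- Good leaves that represent the root, and the step function of a tree

-- The energy of a cylinder is at most 2K² and each step gains 1/(2NA)², so less than half of the leaves can be bad after
-- this many steps.
steps : ℕ → ℕ → ℕ → ℕ
steps N A K = suc (4 ℕ.* (K ℕ.* K)) ℕ.* (A ℕ.* A ℕ.* (2 ℕ.* N ℕ.* (2 ℕ.* N)))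

-- This is 2^(2^t - 1): one bit for each node of a full binary tree of depth t. A label says on
-- which side of every splitting set of the tree a vertex lies, so that equal labels mean the same
-- cell of the common refinement.
labels : ℕ → ℕ
labels zero    = 1
labels (suc t) = 2 ℕ.* (labels t ℕ.* labels t)

module Leaves {n : ℕ} (E : Bool → Sets.Rel n) (N A : ℕ) (0<N : 0 ℕ.< N) (2≤A : 2 ℕ.≤ A) (K : ℕ) where

  open Field
  open Sets
  open Averages {n}
  open Convexity
  open Densities {n}
  open CylinderRegularity E N A 0<N 2≤A K public

  depth : ℕ
  depth = steps N A K ℕ.* 2

  tree : ∀ W → Nonempty W → Tree depth W
  tree W ne = build (steps N A K) W ne

  γ-steps : γ * ι (steps N A K) ≡ ι (suc (4 ℕ.* (K ℕ.* K)))
  γ-steps = begin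
    γ * ι (steps N A K) ≡⟨ cong (γ *_) (trans (ι-* k _) (cong (ι k *_) (trans (ι-* (A ℕ.* A) _) (cong₂ _*_ (ι-* A A) (ι-* (2 ℕ.* N) (2 ℕ.* N)))))) ⟩
    γ * (ι k * (ι A * ι A * (ι (2 ℕ.* N) * ι (2 ℕ.* N))))
      ≡⟨ solve 5 (λ a n i j k → i :* i :* (j :* j) :* (k :* (a :* a :* (n :* n))) := a :* i :* (a :* i) :* (n :* j :* (n :* j)) :* k) refl
           (ι A) (ι (2 ℕ.* N)) (inv A) (inv (2 ℕ.* N)) (ι k) ⟩
    ι A * inv A * (ι A * inv A) * (ι (2 ℕ.* N) * inv (2 ℕ.* N) * (ι (2 ℕ.* N) * inv (2 ℕ.* N))) * ι k
      ≡⟨ cong₂ (λ x y → x * x * (y * y) * ι k) (inv-inverse 0<A) (inv-inverse 0<2N) ⟩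
    1F * 1F * (1F * 1F) * ι k ≡⟨ solve 1 (λ k → con (ℤ.+ 1) :* con (ℤ.+ 1) :* (con (ℤ.+ 1) :* con (ℤ.+ 1)) :* k := k) refl (ι k) ⟩
    ι k ∎
    where
    open ≡-Reasoning
    k = suc (4 ℕ.* (K ℕ.* K))

  bad-rare : ∀ W ne → ¬ (1F ≤ ι 2 * AVG (tree W ne) bad)
  bad-rare W ne h = contradiction (ι-cancel bound) ℕₚ.1+n≰n
    where
    open ≤-Reasoning
    B = AVG (tree W ne) bad
    k = suc (4 ℕ.* (K ℕ.* K))
    bound : ι k ≤ ι (4 ℕ.* (K ℕ.* K))
    bound = begin
      ι k ≡⟨ sym (*-identityʳ _) ⟩
      ι k * 1F ≤⟨ *-monoˡ-≤ (ι-nonneg k) h ⟩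
      ι k * (ι 2 * B) ≡⟨ solve 2 (λ k b → k :* (con (ℤ.+ 2) :* b) := con (ℤ.+ 2) :* (k :* b)) refl (ι k) B ⟩
      ι 2 * (ι k * B) ≡⟨ cong (λ z → ι 2 * (z * B)) (sym γ-steps) ⟩
      ι 2 * (γ * ι (steps N A K) * B) ≤⟨ *-monoˡ-≤ (ι-nonneg 2) (≤-by (energy W) (energy-nonneg W) (+-comm _ _)) ⟩
      ι 2 * (energy W + γ * ι (steps N A K) * B) ≤⟨ *-monoˡ-≤ (ι-nonneg 2) (energy-build (steps N A K) W ne) ⟩
      ι 2 * AVG (tree W ne) energy ≤⟨ *-monoˡ-≤ (ι-nonneg 2) (≤-trans (AVG-mono (tree W ne) ne (λ V neV → energy-≤ neV)) (≤-reflexive (AVG-const (tree W ne) ne _))) ⟩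
      ι 2 * ι (2 ℕ.* (K ℕ.* K)) ≡⟨ sym (ι-* 2 _) ⟩
      ι (2 ℕ.* (2 ℕ.* (K ℕ.* K))) ≡⟨ cong ι (sym (ℕₚ.*-assoc 2 2 (K ℕ.* K))) ⟩
      ι (4 ℕ.* (K ℕ.* K)) ∎

  onGood : (Cyl → F) → Cyl → F
  onGood f W = ι (𝟙 (isGood W)) * f W

  GoodLeaf : ℕ → Cyl → (Cyl → F) → F → Set
  GoodLeaf t W Φ x =
    ∃[ V ] Nonempty V × (∀ i → V i ⊆ W i) × (∀ i → ∣ W i ∣ ℕ.≤ A ℕ.^ t ℕ.* ∣ V i ∣) × Good V × Φ V ≤ x

  onGood-positive : ∀ (Φ : Cyl → F) x V → ¬ (onGood (λ V → x - Φ V) V ≤ 0F) → Good V × Φ V ≤ x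
  onGood-positive Φ x V pos = isGood-sound V (go (isGood V) refl) , bound
    where
    go : ∀ b → isGood V ≡ b → isGood V ≡ true
    go true  e = e
    go false e = contradiction (≤-reflexive (trans (cong (λ b → ι (𝟙 b) * (x - Φ V)) e) (zeroˡ _))) pos
    bound : Φ V ≤ x
    bound with ≤-total (Φ V) x
    ... | inj₁ h = h
    ... | inj₂ h = contradiction (≤-trans (≤-reflexive (cong (λ b → ι (𝟙 b) * (x - Φ V)) (go _ refl)))
            (≤-by (Φ V - x) (≤⇒0≤- h) (solve 2 (λ a b → con (ℤ.+ 0) := con (ℤ.+ 1) :* (b :- a) :+ (a :- b)) refl (Φ V) x))) pos

  module _ {t W} (τ : Tree t W) (ne : Nonempty W) (rare : ¬ (1F ≤ ι 2 * AVG τ bad))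
           (Φ : Cyl → F) {x : F} (0≤x : 0F ≤ x) (¬x≤ : ¬ (x ≤ AVG τ (onGood Φ))) where

    private
      B P : F
      B = AVG τ bad
      P = AVG τ (onGood Φ)

      f : Cyl → F
      f = onGood (λ V → ι 2 * x - Φ V)

      pointwise : ∀ V → f V ≡ ι 2 * x + ((- (ι 2 * x)) * bad V + (- 1F) * onGood Φ V)
      pointwise V with isGood V
      ... | true  = solve 2 (λ x p → con (ℤ.+ 1) :* (con (ℤ.+ 2) :* x :- p) := con (ℤ.+ 2) :* x :+ ((:- (con (ℤ.+ 2) :* x)) :* con (ℤ.+ 0) :+ (:- con (ℤ.+ 1)) :* (con (ℤ.+ 1) :* p))) refl x (Φ V)
      ... | false = solve 2 (λ x p → con (ℤ.+ 0) :* (con (ℤ.+ 2) :* x :- p) := con (ℤ.+ 2) :* x :+ ((:- (con (ℤ.+ 2) :* x)) :* con (ℤ.+ 1) :+ (:- con (ℤ.+ 1)) :* (con (ℤ.+ 0) :* p))) refl x (Φ V)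

      value : AVG τ f ≡ x * (1F - ι 2 * B) + (x - P)
      value = begin
        AVG τ f ≡⟨ AVG-cong τ pointwise ⟩
        AVG τ (λ V → ι 2 * x + ((- (ι 2 * x)) * bad V + (- 1F) * onGood Φ V)) ≡⟨ AVG-+ τ (λ _ → ι 2 * x) (λ V → (- (ι 2 * x)) * bad V + (- 1F) * onGood Φ V) ⟩
        _ ≡⟨ cong₂ _+_ (AVG-const τ ne (ι 2 * x)) (AVG-+ τ (λ V → (- (ι 2 * x)) * bad V) (λ V → (- 1F) * onGood Φ V)) ⟩
        _ ≡⟨ cong (ι 2 * x +_) (cong₂ _+_ (AVG-* τ (- (ι 2 * x)) bad) (AVG-* τ (- 1F) (onGood Φ))) ⟩
        ι 2 * x + ((- (ι 2 * x)) * B + (- 1F) * P) ≡⟨ solve 3 (λ x b p → con (ℤ.+ 2) :* x :+ ((:- (con (ℤ.+ 2) :* x)) :* b :+ (:- con (ℤ.+ 1)) :* p) := x :* (con (ℤ.+ 1) :- con (ℤ.+ 2) :* b) :+ (x :- p)) refl x B P ⟩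
        x * (1F - ι 2 * B) + (x - P) ∎
        where open ≡-Reasoning

      0≤1-2B : 0F ≤ 1F - ι 2 * B
      0≤1-2B with ≤-total 1F (ι 2 * B)
      ... | inj₁ h = contradiction h rare
      ... | inj₂ h = ≤⇒0≤- h

      positive : ¬ (AVG τ f ≤ 0F)
      positive h = ¬x≤ (0≤-⇒≤ (begin
        0F ≤⟨ *-nonneg 0≤x 0≤1-2B ⟩
        x * (1F - ι 2 * B) ≡⟨ solve 3 (λ y x p → y := y :+ (x :- p) :+ (p :- x)) refl (x * (1F - ι 2 * B)) x P ⟩
        x * (1F - ι 2 * B) + (x - P) + (P - x) ≡⟨ cong (_+ (P - x)) (sym value) ⟩
        AVG τ f + (P - x) ≤⟨ +-mono-≤ h ≤-refl ⟩
        0F + (P - x) ≡⟨ +-identityˡ _ ⟩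
        P - x ∎))
        where open ≤-Reasoning

    -- Averaging 2x - Φ over the good leaves, with 0 on the bad ones, gives x(1 - 2B) + (x - P),
    -- where B is the probability of a bad leaf and P the contribution of Φ on good leaves. This is
    -- positive since B is below 1/2 and P below x. The factor 2 in the conclusion pays for the bad
    -- leaves.
    good-leaf : GoodLeaf t W Φ (ι 2 * x)
    good-leaf = let V , neV , sub , size , pos = AVG-positive τ ne {f} positive in
      V , neV , sub , size , onGood-positive Φ (ι 2 * x) V pos

  g : Fin n → Fin n → F
  g u v = ι (𝟙 (E true u v))

  splitBy : Bool → F → F → F
  splitBy b x y = if b then x else y

  -- The average of the leaf densities over the leaves compatible with u ∈ Wᵢ and v ∈ Wⱼ (s on bad leaves).
  stepValue : ∀ {t W} → Tree t W → Fin K → Fin K → F → Fin n → Fin n → F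
  stepValue {W = W} leaf i j s u v = if isGood W then density (E true) (W i) (W j) else s
  stepValue {W = W} (node l S _ a b) i j s u v =
    if ⌊ i ≟ l ⌋ then splitBy (S u) (stepValue a i j s u v) (stepValue b i j s u v)
    else if ⌊ j ≟ l ⌋ then splitBy (S v) (stepValue a i j s u v) (stepValue b i j s u v)
    else ratio (W l) (W l ∩ S) * stepValue a i j s u v + ratio (W l) (W l ∖ S) * stepValue b i j s u v

  deviation : Fin K → Fin K → F → Cyl → F
  deviation i j s W = sq (s - density (E true) (W i) (W j))

  -- Approximating the adjacency matrix by the step function of the tree beats the constant s by at
  -- least the mean squared deviation of the good leaf densities from s. At a leaf this is
  -- `variance`; at a node the two subtrees are mixed with their weights.
  stepValue-gain : ∀ {t W} (τ : Tree t W) → Nonempty W → ∀ {i j} → i ≢ j → ∀ s →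
    avg (W i) (W j) (λ u v → sq (g u v - stepValue τ i j s u v)) + AVG τ (onGood (deviation i j s))
      ≤ avg (W i) (W j) (λ u v → sq (g u v - s))
  stepValue-gain {W = W} leaf ne {i} {j} i≢j s with isGood W
  ... | true  = ≤-reflexive (trans (cong (avg (W i) (W j) (λ u v → sq (g u v - density (E true) (W i) (W j))) +_) (*-identityˡ _)) (sym (variance (E true) (ne i) (ne j) s)))
  ... | false = ≤-reflexive (trans (cong (avg (W i) (W j) (λ u v → sq (g u v - s)) +_) (zeroˡ _)) (+-identityʳ _))
  stepValue-gain {W = W} (node l S bal a b) ne {i} {j} i≢j s = begin
    avg (W i) (W j) ψ + (p * AVG a Δ + q * AVG b Δ) ≤⟨ +-mono-≤ split ≤-refl ⟩
    p * avg (W₁ i) (W₁ j) ψ₁ + q * avg (W₂ i) (W₂ j) ψ₂ + (p * AVG a Δ + q * AVG b Δ)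
      ≡⟨ solve 6 (λ p q x y z w → p :* x :+ q :* y :+ (p :* z :+ q :* w) := p :* (x :+ z) :+ q :* (y :+ w)) refl p q _ _ _ _ ⟩
    p * (avg (W₁ i) (W₁ j) ψ₁ + AVG a Δ) + q * (avg (W₂ i) (W₂ j) ψ₂ + AVG b Δ)
      ≤⟨ mix-mono (weights ne bal) 0≤p 0≤q (stepValue-gain a (child₁ ne bal) i≢j s) (stepValue-gain b (child₂ ne bal) i≢j s) ⟩
    p * avg (W₁ i) (W₁ j) φ + q * avg (W₂ i) (W₂ j) φ ≡⟨ sym (avg-node ne bal i≢j φ) ⟩
    avg (W i) (W j) φ ∎
    where
    open ≤-Reasoning
    W₁ W₂ : Cyl
    W₁ = upd W l (W l ∩ S)
    W₂ = upd W l (W l ∖ S)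
    p = ratio (W l) (W l ∩ S)
    q = ratio (W l) (W l ∖ S)
    0≤p : 0F ≤ p
    0≤p = ratio-nonneg (W l) _
    0≤q : 0F ≤ q
    0≤q = ratio-nonneg (W l) _
    Δ : Cyl → F
    Δ = onGood (deviation i j s)
    φ ψ ψ₁ ψ₂ : Fin n → Fin n → F
    φ u v = sq (g u v - s)
    ψ u v = sq (g u v - stepValue (node l S bal a b) i j s u v)
    ψ₁ u v = sq (g u v - stepValue a i j s u v)
    ψ₂ u v = sq (g u v - stepValue b i j s u v)
    on∩ : ∀ u → (W l ∩ S) u ≡ true → S u ≡ true
    on∩ u e with W l u | S u
    ... | true | true = refl
    on∖ : ∀ u → (W l ∖ S) u ≡ true → S u ≡ false
    on∖ u e with W l u | S u
    ... | true | false = refl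
    mixed : ∀ u v x y → sq (g u v - (p * x + q * y)) ≤ p * sq (g u v - x) + q * sq (g u v - y)
    mixed u v x y = ≤-trans (≤-reflexive (cong sq (trans (cong (_- (p * x + q * y)) (sym (mix-const (weights ne bal) (g u v))))
        (solve 5 (λ p q g x y → p :* g :+ q :* g :- (p :* x :+ q :* y) := p :* (g :- x) :+ q :* (g :- y)) refl p q (g u v) x y))))
      (sq-convex (weights ne bal) 0≤p 0≤q _ _)
    split : avg (W i) (W j) ψ ≤ p * avg (W₁ i) (W₁ j) ψ₁ + q * avg (W₂ i) (W₂ j) ψ₂
    split with i ≟ l in eqi | j ≟ l in eqj
    ... | yes refl | _ = ≤-trans (≤-reflexive (avg-node ne bal i≢j _)) (mix-mono (weights ne bal) 0≤p 0≤q
            (avg-mono-on (W₁ i) (W₁ j) (λ u v e _ → ≤-reflexive (cong (λ c → sq (g u v - splitBy c (stepValue a i j s u v) (stepValue b i j s u v)))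
              (on∩ u (subst (λ Z → Z u ≡ true) (upd-at W i _) e)))))
            (avg-mono-on (W₂ i) (W₂ j) (λ u v e _ → ≤-reflexive (cong (λ c → sq (g u v - splitBy c (stepValue a i j s u v) (stepValue b i j s u v)))
              (on∖ u (subst (λ Z → Z u ≡ true) (upd-at W i _) e))))))
    ... | no _ | yes refl = ≤-trans (≤-reflexive (avg-node ne bal i≢j _)) (mix-mono (weights ne bal) 0≤p 0≤q
            (avg-mono-on (W₁ i) (W₁ j) (λ u v _ e → ≤-reflexive (cong (λ c → sq (g u v - splitBy c (stepValue a i j s u v) (stepValue b i j s u v)))
              (on∩ v (subst (λ Z → Z v ≡ true) (upd-at W j _) e)))))
            (avg-mono-on (W₂ i) (W₂ j) (λ u v _ e → ≤-reflexive (cong (λ c → sq (g u v - splitBy c (stepValue a i j s u v) (stepValue b i j s u v)))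
              (on∖ v (subst (λ Z → Z v ≡ true) (upd-at W j _) e))))))
    -- A split of a third part does not tell which child the pair (u, v) belongs to. The step
    -- function takes the mixture of both values, and convexity of the square suffices.
    ... | no i≢l | no j≢l = ≤-trans (avg-mono (W i) (W j) (λ u v → mixed u v _ _))
      (≤-reflexive (trans (avg-+ (W i) (W j) _ _) (cong₂ _+_ (trans (avg-* (W i) (W j) p _) (cong (p *_) (cong₂ (λ X Y → avg X Y ψ₁) (sym (upd-off W _ i≢l)) (sym (upd-off W _ j≢l)))))
         (trans (avg-* (W i) (W j) q _) (cong (q *_) (cong₂ (λ X Y → avg X Y ψ₂) (sym (upd-off W _ i≢l)) (sym (upd-off W _ j≢l))))))))

  bit : Bool → Fin 2
  bit true  = zero
  bit false = suc zero

  bit-injective : ∀ {a b} → bit a ≡ bit b → a ≡ b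
  bit-injective {true}  {true}  _ = refl
  bit-injective {false} {false} _ = refl

  someLabel : ∀ t → Fin (labels t)
  someLabel zero    = zero
  someLabel (suc t) = combine {2} zero (combine (someLabel t) (someLabel t))

  label : ∀ {t W} → Tree t W → Fin n → Fin (labels t)
  label {t} leaf u = someLabel t
  label (node l S bal a b) u = combine (bit (S u)) (combine (label a u) (label b u))

  stepValue-label : ∀ {t W} (τ : Tree t W) i j s {u u′ v v′} → label τ u ≡ label τ u′ → label τ v ≡ label τ v′ →
                    stepValue τ i j s u v ≡ stepValue τ i j s u′ v′
  stepValue-label leaf i j s p q = refl
  stepValue-label (node l S bal a b) i j s {u} {u′} {v} {v′} p q = helper
    where
    P = Finₚ.combine-injective (bit (S u)) _ (bit (S u′)) _ p
    Q = Finₚ.combine-injective (bit (S v)) _ (bit (S v′)) _ q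
    P′ = Finₚ.combine-injective (label a u) (label b u) (label a u′) (label b u′) (proj₂ P)
    Q′ = Finₚ.combine-injective (label a v) (label b v) (label a v′) (label b v′) (proj₂ Q)
    Su = bit-injective (proj₁ P)
    Sv = bit-injective (proj₁ Q)
    A≡ = stepValue-label a i j s (proj₁ P′) (proj₁ Q′)
    B≡ = stepValue-label b i j s (proj₂ P′) (proj₂ Q′)
    helper : stepValue (node l S bal a b) i j s u v ≡ stepValue (node l S bal a b) i j s u′ v′
    helper rewrite Su | Sv | A≡ | B≡ = refl

open Sets

⌊⌋-true : ∀ {A : Set} (d : Dec A) → ⌊ d ⌋ ≡ true → A
⌊⌋-true (yes a) _ = a

⌊⌋-yes : ∀ {A : Set} (d : Dec A) → A → ⌊ d ⌋ ≡ true
⌊⌋-yes (yes _) _ = refl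
⌊⌋-yes (no ¬a) a = contradiction a ¬a

member : ∀ {n} (X : Sub n) → 0 ℕ.< ∣ X ∣ → ∃[ u ] X u ≡ true
member {zero} X p = contradiction (subst (0 ℕ.<_) (ℕΣ.sum-[] _) p) ℕₚ.1+n≰n
member {suc n} X p with X zero in eq
... | true  = zero , eq
... | false = let u , e = member (X ∘ suc) (subst (0 ℕ.<_) (trans (ℕΣ.sum-∷ _) (cong (λ b → 𝟙 b ℕ.+ ∣ X ∘ suc ∣) eq)) p) in suc u , e

∣∣-positive : ∀ {n} (X : Sub n) u → X u ≡ true → 0 ℕ.< ∣ X ∣
∣∣-positive X zero e = subst (0 ℕ.<_) (sym (trans (ℕΣ.sum-∷ _) (cong (λ b → 𝟙 b ℕ.+ ∣ X ∘ suc ∣) e))) (s≤s z≤n)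
∣∣-positive X (suc u) e = subst (0 ℕ.<_) (sym (ℕΣ.sum-∷ _)) (ℕₚ.<-≤-trans (∣∣-positive (X ∘ suc) u e) (ℕₚ.m≤n+m _ _))

zero-or-positive : ∀ m → m ≡ 0 ⊎ 0 ℕ.< m
zero-or-positive zero    = inj₁ refl
zero-or-positive (suc m) = inj₂ (s≤s z≤n)

full : ∀ {n} → Sub n
full _ = true

∣full∣ : ∀ n → ∣ full {n} ∣ ≡ n
∣full∣ zero    = ℕΣ.sum-[] _
∣full∣ (suc n) = trans (ℕΣ.sum-∷ _) (cong suc (∣full∣ n))

-- Vertex partitions and their mean square defect

module Partitions {n : ℕ} (R : Rel n) where

  open Field
  open Averages {n}
  open Convexity
  open Densities {n}

  cell : ∀ {k} → (Fin n → Fin k) → Fin k → Sub n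
  cell κ i u = ⌊ κ u ≟ i ⌋

  cellDensity : ∀ {k} → (Fin n → Fin k) → Fin k → Fin k → F
  cellDensity κ i j = density R (cell κ i) (cell κ j)

  edgeValue : Fin n → Fin n → F
  edgeValue u v = ι (𝟙 (R u v))

  -- The number of adjacent ordered pairs minus the unnormalised mean square density, so that a drop
  -- of the defect is an increase of the index. As a squared distance it can be bounded by any
  -- competing step function.
  defect : ∀ {k} → (Fin n → Fin k) → F
  defect κ = sum₂ (λ u v → sq (edgeValue u v - cellDensity κ (κ u) (κ v)))

  weight : ∀ {k} → (Fin n → Fin k) → Fin k → Fin k → F
  weight κ i j = ι ∣ cell κ i ∣ * ι ∣ cell κ j ∣

  weight-nonneg : ∀ {k} (κ : Fin n → Fin k) i j → 0F ≤ weight κ i j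
  weight-nonneg κ i j = *-nonneg (ι-nonneg _) (ι-nonneg _)

  ι-*-μ : ∀ X u → ι ∣ X ∣ * μ X u ≡ ι (𝟙 (X u))
  ι-*-μ X u with ∣ X ∣ in eq
  ... | zero = trans (zeroˡ _) (cong (λ b → ι (𝟙 b)) (sym (go (X u) refl)))
    where go : ∀ b → X u ≡ b → X u ≡ false
          go true  e = contradiction (ℕₚ.<-≤-trans (∣∣-positive X u e) (ℕₚ.≤-reflexive eq)) ℕₚ.1+n≰n
          go false e = e
  ... | suc m = trans (sym (*-assoc _ _ _)) (trans (cong (_* ι (𝟙 (X u))) (inv-inverse {suc m} (s≤s z≤n))) (*-identityˡ _))

  sum-pick : ∀ {k} (a : Fin k) (f : Fin k → F) → sum (λ i → ι (𝟙 ⌊ a ≟ i ⌋) * f i) ≡ f a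
  sum-pick zero f = trans (sum-∷ _) (trans (cong₂ _+_ (*-identityˡ _) (sum-zero (λ i → zeroˡ _))) (+-identityʳ _))
  sum-pick (suc a) f = trans (sum-∷ _) (trans (cong₂ _+_ (zeroˡ _)
      (trans (sum-cong (λ i → cong (λ b → ι (𝟙 b) * f (suc i)) (⌊suc≟suc⌋ a i))) (sum-pick a (f ∘ suc)))) (+-identityˡ _))

  sum-cells : ∀ {k} (κ : Fin n → Fin k) (f : Fin n → F) → sum (λ i → sum (λ u → ι (𝟙 (cell κ i u)) * f u)) ≡ sum f
  sum-cells κ f = trans (sum-comm _) (sum-cong (λ u → sum-pick (κ u) (λ _ → f u)))

  weight-avg : ∀ {k} (κ : Fin n → Fin k) i j (φ : Fin n → Fin n → F) →
    weight κ i j * avg (cell κ i) (cell κ j) φ ≡ sum₂ (λ u v → ι (𝟙 (cell κ i u)) * (ι (𝟙 (cell κ j v)) * φ u v))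
  weight-avg κ i j φ = trans (sym (sum₂-* (weight κ i j) _)) (sum₂-cong (λ u v →
    trans (solve 5 (λ a b x y z → a :* b :* (x :* (y :* z)) := a :* x :* (b :* y :* z)) refl (ι ∣ cell κ i ∣) (ι ∣ cell κ j ∣) (μ (cell κ i) u) (μ (cell κ j) v) (φ u v))
      (cong₂ (λ x y → x * (y * φ u v)) (ι-*-μ (cell κ i) u) (ι-*-μ (cell κ j) v))))

  cell-decomposition : ∀ {k} (κ : Fin n → Fin k) (φ : Fin n → Fin n → F) →
    sum₂ (λ i j → weight κ i j * avg (cell κ i) (cell κ j) φ) ≡ sum₂ φ
  cell-decomposition {k} κ φ = begin
    sum₂ (λ i j → weight κ i j * avg (cell κ i) (cell κ j) φ) ≡⟨ sum₂-cong (λ i j → weight-avg κ i j φ) ⟩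
    sum (λ i → sum (λ j → sum (λ u → sum (λ v → c i u * (c j v * φ u v))))) ≡⟨ sum-cong (λ i → sum-comm _) ⟩
    sum (λ i → sum (λ u → sum (λ j → sum (λ v → c i u * (c j v * φ u v))))) ≡⟨ sum-cong (λ i → sum-cong (λ u → trans (sum-cong (λ j → sym (sum-*ˡ (c i u) _))) (sym (sum-*ˡ (c i u) _)))) ⟩
    sum (λ i → sum (λ u → c i u * sum (λ j → sum (λ v → c j v * φ u v)))) ≡⟨ sum-cong (λ i → sum-cong (λ u → cong (c i u *_) (sum-cells κ (φ u)))) ⟩
    sum (λ i → sum (λ u → c i u * sum (φ u))) ≡⟨ sum-cells κ (λ u → sum (φ u)) ⟩
    sum₂ φ ∎
    where
    open ≡-Reasoning
    c : Fin k → Fin n → F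
    c i u = ι (𝟙 (cell κ i u))

  avg-cong-on : ∀ X Y {φ ψ} → (∀ u v → X u ≡ true → Y v ≡ true → φ u v ≡ ψ u v) → avg X Y φ ≡ avg X Y ψ
  avg-cong-on X Y p = antisym (avg-mono-on X Y (λ u v e f → ≤-reflexive (p u v e f)))
                              (avg-mono-on X Y (λ u v e f → ≤-reflexive (sym (p u v e f))))
    where open import Relation.Binary using (IsPartialOrder)
          antisym = IsPartialOrder.antisym ≤-isPartialOrder

  cell-true : ∀ {k} (κ : Fin n → Fin k) {i u} → cell κ i u ≡ true → κ u ≡ i
  cell-true κ {i} {u} = ⌊⌋-true (κ u ≟ i)

  defect-cells : ∀ {k} (κ : Fin n → Fin k) →
    defect κ ≡ sum₂ (λ i j → weight κ i j * avg (cell κ i) (cell κ j) (λ u v → sq (edgeValue u v - cellDensity κ i j)))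
  defect-cells κ = trans (sym (cell-decomposition κ _)) (sum₂-cong (λ i j → cong (weight κ i j *_)
    (avg-cong-on (cell κ i) (cell κ j) (λ u v e f → cong₂ (λ a b → sq (edgeValue u v - cellDensity κ a b)) (cell-true κ e) (cell-true κ f)))))

  -- Conditional expectation is the best approximation in mean square: S is constant on each pair of
  -- cells, and there the mean is the best constant by `variance`. Pairs with an empty cell have
  -- weight 0.
  defect-minimal : ∀ {k} (κ : Fin n → Fin k) (S : Fin n → Fin n → F) →
    (∀ {u u′ v v′} → κ u ≡ κ u′ → κ v ≡ κ v′ → S u v ≡ S u′ v′) → defect κ ≤ sum₂ (λ u v → sq (edgeValue u v - S u v))
  defect-minimal κ S const = begin
    defect κ ≡⟨ defect-cells κ ⟩
    _ ≤⟨ sum₂-mono per-cell ⟩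
    sum₂ (λ i j → weight κ i j * avg (cell κ i) (cell κ j) (λ u v → sq (edgeValue u v - S u v))) ≡⟨ cell-decomposition κ _ ⟩
    sum₂ (λ u v → sq (edgeValue u v - S u v)) ∎
    where
    open ≤-Reasoning
    empty : ∀ i j {x y} → ι ∣ cell κ i ∣ * ι ∣ cell κ j ∣ ≡ 0F → weight κ i j * x ≤ weight κ i j * y
    empty i j {x} {y} e = ≤-reflexive (trans (trans (cong (_* x) e) (zeroˡ x)) (sym (trans (cong (_* y) e) (zeroˡ y))))
    per-cell : ∀ i j → weight κ i j * avg (cell κ i) (cell κ j) (λ u v → sq (edgeValue u v - cellDensity κ i j))
                     ≤ weight κ i j * avg (cell κ i) (cell κ j) (λ u v → sq (edgeValue u v - S u v))
    per-cell i j with zero-or-positive ∣ cell κ i ∣ | zero-or-positive ∣ cell κ j ∣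
    ... | inj₁ e | _ = empty i j (trans (cong (λ m → ι m * ι ∣ cell κ j ∣) e) (zeroˡ _))
    ... | inj₂ _ | inj₁ e = empty i j (trans (cong (λ m → ι ∣ cell κ i ∣ * ι m) e) (zeroʳ _))
    ... | inj₂ p | inj₂ q = *-monoˡ-≤ (weight-nonneg κ i j) (≤-trans (≤-by _ (sq-nonneg (s - cellDensity κ i j)) (variance R p q s))
        (≤-reflexive (avg-cong-on (cell κ i) (cell κ j) (λ u v e f → cong (λ z → sq (edgeValue u v - z))
          (const (trans (cell-true κ (proj₂ mi)) (sym (cell-true κ e))) (trans (cell-true κ (proj₂ mj)) (sym (cell-true κ f))))))))
      where
      mi = member (cell κ i) p
      mj = member (cell κ j) q
      s = S (proj₁ mi) (proj₁ mj)

-- One round: representatives or a refinement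

module Stage {n : ℕ} (0<n : 0 ℕ.< n) (E : Bool → Rel n) (N A : ℕ) (0<N : 0 ℕ.< N) (2≤A : 2 ℕ.≤ A) where

  open Field
  open Averages {n}
  open Convexity
  open Densities {n}
  open Partitions (E true)

  module _ {k : ℕ} (κ : Fin n → Fin k) where

    open Leaves E N A 0<N 2≤A k

    -- The threshold n/(kN) makes the at most k small cells hold at most n/N vertices altogether.
    isBig : Fin k → Bool
    isBig i = ⌊ n ℕ.≤? k ℕ.* N ℕ.* ∣ cell κ i ∣ ⌋

    -- A small cell is represented by the whole vertex set, so that all roots are large; pairs meeting it are never active.
    root : Cyl
    root i = if isBig i then cell κ i else full

    root-size : ∀ i → n ℕ.≤ k ℕ.* N ℕ.* ∣ root i ∣
    root-size i with isBig i in eq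
    ... | true  = ⌊⌋-true (n ℕ.≤? k ℕ.* N ℕ.* ∣ cell κ i ∣) eq
    ... | false = ℕₚ.≤-trans (ℕₚ.≤-reflexive (sym (trans (ℕₚ.*-identityˡ _) (∣full∣ n))))
                    (ℕₚ.*-monoˡ-≤ ∣ full {n} ∣ (ℕₚ.*-mono-≤ (ℕₚ.≤-trans (s≤s z≤n) (Finₚ.toℕ<n i)) 0<N))

    root-nonempty : Nonempty root
    root-nonempty i = pos-of-≤* {m = k ℕ.* N} 0<n (root-size i)

    isActive : Fin k → Fin k → Bool
    isActive i j = not ⌊ i ≟ j ⌋ ∧ (isBig i ∧ isBig j)

    active⇒big : ∀ i j → isActive i j ≡ true → isBig i ≡ true × isBig j ≡ true
    active⇒big i j = conjuncts ⌊ i ≟ j ⌋ (isBig i) (isBig j)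
      where
      conjuncts : ∀ a b c → not a ∧ (b ∧ c) ≡ true → b ≡ true × c ≡ true
      conjuncts false true true _ = refl , refl

    -- Each pair of parts is weighted by the number of its vertex pairs, so that a bound on this sum
    -- becomes a bound on the number of edited pairs.
    totalDeviation : Cyl → F
    totalDeviation V = sum₂ (λ i j → ι (𝟙 (isActive i j)) * (weight κ i j * deviation i j (cellDensity κ i j) V))

    -- Used for τ = tree root only, a tree that is far too large to be unfolded.
    module _ {t} (τ : Tree t root) where

      -- The competitor for `defect-minimal`: the step function of the tree on active pairs of
      -- cells, the old density elsewhere.
      refinedValue : Fin n → Fin n → F
      refinedValue u v = if isActive (κ u) (κ v) then stepValue τ (κ u) (κ v) (cellDensity κ (κ u) (κ v)) u v
                         else cellDensity κ (κ u) (κ v)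

      refined : Fin n → Fin (k ℕ.* labels t)
      refined u = combine (κ u) (label τ u)

      refined-κ : ∀ {u v} → refined u ≡ refined v → κ u ≡ κ v
      refined-κ {u} {v} e = proj₁ (Finₚ.combine-injective (κ u) (label τ u) (κ v) (label τ v) e)

      refined-label : ∀ {u v} → refined u ≡ refined v → label τ u ≡ label τ v
      refined-label {u} {v} e = proj₂ (Finₚ.combine-injective (κ u) (label τ u) (κ v) (label τ v) e)

      refinedValue-const : ∀ {u u′ v v′} → refined u ≡ refined u′ → refined v ≡ refined v′ → refinedValue u v ≡ refinedValue u′ v′
      refinedValue-const {u} {u′} {v} {v′} p q =
        trans (cong (λ x → if isActive (κ u) (κ v) then x else cellDensity κ (κ u) (κ v))
                (stepValue-label τ (κ u) (κ v) (cellDensity κ (κ u) (κ v)) (refined-label p) (refined-label q)))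
              (cong₂ (λ a b → if isActive a b then stepValue τ a b (cellDensity κ a b) u′ v′ else cellDensity κ a b)
                (refined-κ p) (refined-κ q))

      cell-gain : ∀ i j → weight κ i j * avg (cell κ i) (cell κ j) (λ u v → sq (edgeValue u v - refinedValue u v))
          + ι (𝟙 (isActive i j)) * weight κ i j * AVG τ (onGood (deviation i j (cellDensity κ i j)))
        ≤ weight κ i j * avg (cell κ i) (cell κ j) (λ u v → sq (edgeValue u v - cellDensity κ i j))
      cell-gain i j = go (isActive i j) refl
        where
        open ≤-Reasoning
        w = weight κ i j
        s = cellDensity κ i j
        Δ = AVG τ (onGood (deviation i j s))
        onCell : ∀ b → isActive i j ≡ b →
          avg (cell κ i) (cell κ j) (λ u v → sq (edgeValue u v - refinedValue u v)) ≡
          avg (cell κ i) (cell κ j) (λ u v → sq (edgeValue u v - (if b then stepValue τ i j s u v else s)))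
        onCell b eq = avg-cong-on (cell κ i) (cell κ j) (λ u v e f → cong (λ z → sq (edgeValue u v - z))
          (trans (cong₂ (λ a c → if isActive a c then stepValue τ a c (cellDensity κ a c) u v else cellDensity κ a c) (cell-true κ e) (cell-true κ f))
                 (cong (λ b → if b then stepValue τ i j s u v else s) eq)))
        ψ φ : Fin n → Fin n → F
        ψ u v = sq (edgeValue u v - stepValue τ i j s u v)
        φ u v = sq (edgeValue u v - s)
        go : ∀ b → isActive i j ≡ b →
          w * avg (cell κ i) (cell κ j) (λ u v → sq (edgeValue u v - refinedValue u v)) + ι (𝟙 (isActive i j)) * w * Δ
            ≤ w * avg (cell κ i) (cell κ j) φ
        go false eq = ≤-reflexive (trans (cong₂ (λ x b → w * x + ι (𝟙 b) * w * Δ) (onCell false eq) eq)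
          (solve 3 (λ w x d → w :* x :+ con (ℤ.+ 0) :* w :* d := w :* x) refl w _ Δ))
        go true eq = begin
          w * avg (cell κ i) (cell κ j) (λ u v → sq (edgeValue u v - refinedValue u v)) + ι (𝟙 (isActive i j)) * w * Δ
            ≡⟨ cong₂ (λ x b → w * x + ι (𝟙 b) * w * Δ) (trans (onCell true eq) (cong₂ (λ X Y → avg X Y ψ) (sym root-i) (sym root-j))) eq ⟩
          w * avg (root i) (root j) ψ + 1F * w * Δ
            ≡⟨ solve 3 (λ w x d → w :* x :+ con (ℤ.+ 1) :* w :* d := w :* (x :+ d)) refl w (avg (root i) (root j) ψ) Δ ⟩
          w * (avg (root i) (root j) ψ + Δ)
            ≤⟨ *-monoˡ-≤ (weight-nonneg κ i j) (stepValue-gain τ root-nonempty i≢j s) ⟩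
          w * avg (root i) (root j) φ ≡⟨ cong (w *_) (cong₂ (λ X Y → avg X Y φ) root-i root-j) ⟩
          w * avg (cell κ i) (cell κ j) (λ u v → sq (edgeValue u v - s)) ∎
          where
          big : isBig i ≡ true × isBig j ≡ true
          big = active⇒big i j eq
          i≢j : i ≢ j
          i≢j e with trans (sym eq) (cong (λ b → not b ∧ (isBig i ∧ isBig j)) (⌊⌋-yes (i ≟ j) e))
          ... | ()
          root-i : root i ≡ cell κ i
          root-i = cong (λ b → if b then cell κ i else full) (proj₁ big)
          root-j : root j ≡ cell κ j
          root-j = cong (λ b → if b then cell κ j else full) (proj₂ big)

      AVG-totalDeviation : AVG τ (onGood totalDeviation) ≡
        sum₂ (λ i j → ι (𝟙 (isActive i j)) * weight κ i j * AVG τ (onGood (deviation i j (cellDensity κ i j))))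
      AVG-totalDeviation = trans (AVG-cong τ pointwise) (trans (AVG-sum τ _) (sum-cong (λ i → trans (AVG-sum τ _) (sum-cong (λ j → AVG-* τ (ι (𝟙 (isActive i j)) * weight κ i j) _)))))
        where
        pointwise : ∀ V → onGood totalDeviation V ≡
          sum₂ (λ i j → ι (𝟙 (isActive i j)) * weight κ i j * onGood (deviation i j (cellDensity κ i j)) V)
        pointwise V = trans (sym (sum₂-* (ι (𝟙 (isGood V))) _)) (sum₂-cong (λ i j →
          solve 4 (λ b a w d → b :* (a :* (w :* d)) := a :* w :* (b :* d)) refl (ι (𝟙 (isGood V))) (ι (𝟙 (isActive i j))) (weight κ i j) _))

      refined-defect : defect refined + AVG τ (onGood totalDeviation) ≤ defect κ
      refined-defect = begin
        defect refined + AVG τ (onGood totalDeviation)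
          ≤⟨ +-mono-≤ (defect-minimal refined refinedValue refinedValue-const) ≤-refl ⟩
        sum₂ (λ u v → sq (edgeValue u v - refinedValue u v)) + AVG τ (onGood totalDeviation)
          ≡⟨ cong₂ _+_ (sym (cell-decomposition κ _)) AVG-totalDeviation ⟩
        sum₂ (λ i j → weight κ i j * avg (cell κ i) (cell κ j) (λ u v → sq (edgeValue u v - refinedValue u v)))
          + sum₂ (λ i j → ι (𝟙 (isActive i j)) * weight κ i j * AVG τ (onGood (deviation i j (cellDensity κ i j)))) ≡⟨ sym (sum₂-+ _ _) ⟩
        _ ≤⟨ sum₂-mono cell-gain ⟩
        _ ≡⟨ sym (defect-cells κ) ⟩
        defect κ ∎
        where open ≤-Reasoning

    record Representation (x : F) : Set where
      field
        parts     : Fin k → Sub n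
        nonempty  : Nonempty parts
        size      : ∀ i → n ℕ.≤ k ℕ.* N ℕ.* A ℕ.^ depth ℕ.* ∣ parts i ∣
        good      : Good parts
        deviating : totalDeviation parts ≤ ι 2 * x

    Refinement : F → Set
    Refinement x = Σ (Fin n → Fin (k ℕ.* labels depth)) λ κ′ → (∀ {u v} → κ′ u ≡ κ′ v → κ u ≡ κ v) × defect κ′ + x ≤ defect κ

    represent-or-refine : ∀ x → 0F ≤ x → Representation x ⊎ Refinement x
    represent-or-refine x 0≤x = go (tree root root-nonempty) (bad-rare root root-nonempty)
      where
      go : (τ : Tree depth root) → ¬ (1F ≤ ι 2 * AVG τ bad) → Representation x ⊎ Refinement x
      go τ rare with x ≤? AVG τ (onGood totalDeviation)
      ... | yes p = inj₂ (refined τ , refined-κ τ , ≤-trans (+-mono-≤ ≤-refl p) (refined-defect τ))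
      ... | no ¬p = let V , ne , _ , size , good , dev = good-leaf τ root-nonempty rare totalDeviation 0≤x ¬p in
        inj₁ (record { parts = V ; nonempty = ne ; good = good ; deviating = dev
                     ; size = λ i → ℕₚ.≤-trans (root-size i) (ℕₚ.≤-trans (ℕₚ.*-monoʳ-≤ (k ℕ.* N) (size i))
                         (ℕₚ.≤-reflexive (sym (ℕₚ.*-assoc (k ℕ.* N) _ _)))) })

-- Iteration until the parts are represented

-- The round in which the iteration stops is not known beforehand; the sum of the size losses of all
-- possible rounds dominates each of them. The value 0 at `zero` is harmless, as the iteration never
-- exhausts its rounds.
sizeBound : ℕ → ℕ → ℕ → ℕ → ℕ
sizeBound N A zero    k = 0
sizeBound N A (suc J) k = k ℕ.* N ℕ.* A ℕ.^ (steps N A k ℕ.* 2) ℕ.+ sizeBound N A J (k ℕ.* labels (steps N A k ℕ.* 2))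

module Iteration {n : ℕ} (0<n : 0 ℕ.< n) (E : Bool → Rel n) (N A : ℕ) (0<N : 0 ℕ.< N) (2≤A : 2 ℕ.≤ A) where

  open Field
  open Averages {n}
  open Convexity
  open Densities {n}
  open Partitions (E true)
  open Stage 0<n E N A 0<N 2≤A

  0<2NN : 0 ℕ.< 2 ℕ.* (N ℕ.* N)
  0<2NN = ℕₚ.*-mono-< {0} {2} (s≤s z≤n) (ℕₚ.*-mono-< 0<N 0<N)

  -- A representation has total deviation at most 2 · `tolerance` = n²/N². After the factor N lost
  -- in `≤-sq` this is n²/N edited pairs.
  tolerance : F
  tolerance = inv (2 ℕ.* (N ℕ.* N)) * ι (n ℕ.* n)

  tolerance-nonneg : 0F ≤ tolerance
  tolerance-nonneg = *-nonneg (inv-nonneg _) (ι-nonneg _)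

  record Represented {k₀} (κ₀ : Fin n → Fin k₀) (M : ℕ) : Set where
    field
      {k}            : ℕ
      κ              : Fin n → Fin k
      refines        : ∀ {u v} → κ u ≡ κ v → κ₀ u ≡ κ₀ v
      representation : Representation κ tolerance
    open Representation representation public
    field
      bound : ∀ i → n ℕ.≤ M ℕ.* ∣ parts i ∣

  defect-nonneg : ∀ {k} (κ : Fin n → Fin k) → 0F ≤ defect κ
  defect-nonneg κ = ≤-trans (≤-reflexive (sym (sum-zero {n} (λ _ → sum-0 n)))) (sum₂-mono (λ u v → sq-nonneg _))

  iterate : ∀ J k (κ : Fin n → Fin k) → ¬ (ι J * tolerance ≤ defect κ) → Represented κ (sizeBound N A J k)
  iterate zero k κ small = contradiction (≤-trans (≤-reflexive (zeroˡ _)) (defect-nonneg κ)) small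
  iterate (suc J) k κ small = continue (represent-or-refine κ tolerance tolerance-nonneg)
    where
    depth k′ M₁ M₂ : ℕ
    depth = steps N A k ℕ.* 2
    k′    = k ℕ.* labels depth
    M₁    = k ℕ.* N ℕ.* A ℕ.^ depth
    M₂    = sizeBound N A J k′

    refine : (κ′ : Fin n → Fin k′) → defect κ′ + tolerance ≤ defect κ → Represented κ′ M₂
    refine κ′ gain = iterate J k′ κ′ (λ h → small (begin
      ι (suc J) * tolerance ≡⟨ cong (_* tolerance) (ι-+ 1 J) ⟩
      (1F + ι J) * tolerance ≡⟨ solve 2 (λ j x → (con (ℤ.+ 1) :+ j) :* x := j :* x :+ x) refl (ι J) tolerance ⟩
      ι J * tolerance + tolerance ≤⟨ +-mono-≤ h ≤-refl ⟩
      defect κ′ + tolerance ≤⟨ gain ⟩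
      defect κ ∎))
      where open ≤-Reasoning

    coarsen : ∀ {κ′ : Fin n → Fin k′} → (∀ {u v} → κ′ u ≡ κ′ v → κ u ≡ κ v) → Represented κ′ M₂ → Represented κ (M₁ ℕ.+ M₂)
    coarsen coarser next = record
      { κ = Represented.κ next ; refines = λ e → coarser (Represented.refines next e)
      ; representation = Represented.representation next
      ; bound = λ i → ℕₚ.≤-trans (Represented.bound next i) (ℕₚ.*-monoˡ-≤ _ (ℕₚ.m≤n+m M₂ M₁)) }

    continue : Representation κ tolerance ⊎ Refinement κ tolerance → Represented κ (M₁ ℕ.+ M₂)
    continue (inj₁ rep) = record { κ = κ ; refines = id ; representation = rep
      ; bound = λ i → ℕₚ.≤-trans (Representation.size rep i) (ℕₚ.*-monoˡ-≤ _ (ℕₚ.m≤m+n M₁ M₂)) }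
    continue (inj₂ (κ′ , coarser , gain)) = coarsen coarser (refine κ′ gain)

  -- One more than n² / `tolerance`. Each refinement lowers the defect, which lies between 0 and n²,
  -- by `tolerance`.
  iterations : ℕ
  iterations = suc (2 ℕ.* (N ℕ.* N))

  defect-small : ∀ {k} (κ : Fin n → Fin k) → ¬ (ι iterations * tolerance ≤ defect κ)
  defect-small κ h = contradiction (ι-cancel nonpositive) (ℕₚ.<⇒≱ (ℕₚ.*-mono-< 0<n 0<n))
    where
    open ≤-Reasoning
    m = 2 ℕ.* (N ℕ.* N)
    whole : ι m * tolerance ≡ ι (n ℕ.* n)
    whole = trans (sym (*-assoc _ _ _)) (trans (cong (_* ι (n ℕ.* n)) (inv-inverse 0<2NN)) (*-identityˡ _))
    upper : defect κ ≤ ι (n ℕ.* n)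
    upper = begin
      defect κ ≤⟨ defect-minimal κ (λ _ _ → 0F) (λ _ _ → refl) ⟩
      sum₂ (λ u v → sq (edgeValue u v - 0F)) ≤⟨ sum₂-mono (λ u v → unit (E true u v)) ⟩
      sum₂ {n} {n} (λ _ _ → 1F) ≡⟨ sum₂-1 n ⟩
      ι (n ℕ.* n) ∎
      where
      unit : ∀ b → sq (ι (𝟙 b) - 0F) ≤ 1F
      unit true  = ≤-reflexive (solve 0 ((con (ℤ.+ 1) :- con (ℤ.+ 0)) :* (con (ℤ.+ 1) :- con (ℤ.+ 0)) := con (ℤ.+ 1)) refl)
      unit false = ≤-trans (≤-reflexive (solve 0 ((con (ℤ.+ 0) :- con (ℤ.+ 0)) :* (con (ℤ.+ 0) :- con (ℤ.+ 0)) := con (ℤ.+ 0)) refl)) (ι-nonneg 1)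
    tolerance≤0 : tolerance ≤ 0F
    tolerance≤0 = 0≤-⇒≤ (begin
      0F ≤⟨ ≤⇒0≤- (≤-trans h upper) ⟩
      ι (n ℕ.* n) - ι iterations * tolerance ≡⟨ cong (λ z → ι (n ℕ.* n) - z * tolerance) (ι-+ 1 m) ⟩
      ι (n ℕ.* n) - (1F + ι m) * tolerance ≡⟨ solve 3 (λ w m x → w :- (con (ℤ.+ 1) :+ m) :* x := w :- m :* x :- x) refl (ι (n ℕ.* n)) (ι m) tolerance ⟩
      ι (n ℕ.* n) - ι m * tolerance - tolerance ≡⟨ cong (λ z → ι (n ℕ.* n) - z - tolerance) whole ⟩
      ι (n ℕ.* n) - ι (n ℕ.* n) - tolerance ≡⟨ solve 2 (λ w x → w :- w :- x := con (ℤ.+ 0) :- x) refl (ι (n ℕ.* n)) tolerance ⟩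
      0F - tolerance ∎)
    nonpositive : ι (n ℕ.* n) ≤ ι 0
    nonpositive = begin
      ι (n ℕ.* n) ≡⟨ sym whole ⟩
      ι m * tolerance ≤⟨ *-monoˡ-≤ (ι-nonneg m) tolerance≤0 ⟩
      ι m * 0F ≡⟨ zeroʳ _ ⟩
      0F ∎

  represented : ∀ {k} (κ : Fin n → Fin k) → Represented κ (sizeBound N A iterations k)
  represented κ = iterate iterations _ κ (defect-small κ)

  -- The number of pairs edited because of a forbidden colour

  module Cost (disjoint : ∀ u v → 𝟙 (E true u v) ℕ.+ 𝟙 (E false u v) ℕ.≤ 1)
              (exhaustive : ∀ u v → 1 ℕ.≤ 𝟙 (E true u v) ℕ.+ (𝟙 (E false u v) ℕ.+ 𝟙 ⌊ u ≟ v ⌋))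
              {k} (κ : Fin n → Fin k) (rep : Representation κ tolerance)
              (large : ∀ i → N ℕ.≤ ∣ Representation.parts rep i ∣) where

    open Representation rep

    forbidden : Bool → Fin k → Fin k → Bool
    forbidden c i j = ⌊ N ℕ.* edges (E c) (parts i) (parts j) ℕ.<? ∣ parts i ∣ ℕ.* ∣ parts j ∣ ⌋

    i₁ : F
    i₁ = inv N

    N*i₁ : ι N * i₁ ≡ 1F
    N*i₁ = inv-inverse 0<N

    -- Expand N(y - 1/N)². The inequality passes from squared deviations, which the defect controls,
    -- to the linear ones that count edits.
    ≤-sq : ∀ y → y ≤ ι N * sq y + i₁
    ≤-sq y with ≤-total 0F y
    ... | inj₂ y≤0 = ≤-trans y≤0 (+-nonneg (*-nonneg (ι-nonneg N) (sq-nonneg y)) (inv-nonneg N))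
    ... | inj₁ 0≤y = ≤-by (ι N * sq (y - i₁) + y) (+-nonneg (*-nonneg (ι-nonneg N) (sq-nonneg _)) 0≤y) (begin
        ι N * sq y + i₁ ≡⟨ solve 3 (λ n y i → n :* (y :* y) :+ i := n :* (y :* y) :+ con (ℤ.+ 1) :* i) refl (ι N) y i₁ ⟩
        ι N * sq y + 1F * i₁ ≡⟨ cong (λ z → ι N * sq y + z * i₁) (sym N*i₁) ⟩
        ι N * sq y + ι N * i₁ * i₁ ≡⟨ solve 3 (λ n y i → n :* (y :* y) :+ n :* i :* i := n :* ((y :- i) :* (y :- i)) :+ con (ℤ.+ 2) :* (n :* i) :* y) refl (ι N) y i₁ ⟩
        ι N * sq (y - i₁) + ι 2 * (ι N * i₁) * y ≡⟨ cong (λ z → ι N * sq (y - i₁) + ι 2 * z * y) N*i₁ ⟩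
        ι N * sq (y - i₁) + ι 2 * 1F * y ≡⟨ solve 2 (λ a y → a :+ con (ℤ.+ 2) :* con (ℤ.+ 1) :* y := y :+ (a :+ y)) refl (ι N * sq (y - i₁)) y ⟩
        y + (ι N * sq (y - i₁) + y) ∎)
      where open ≡-Reasoning

    equal : Rel n
    equal u v = ⌊ u ≟ v ⌋

    -- The hypothesis `exhaustive` promises a colour only off the diagonal. Against a set of at
    -- least N vertices the diagonal has density at most 1/N.
    density-equal : ∀ {X Y} → 0 ℕ.< ∣ X ∣ → N ℕ.≤ ∣ Y ∣ → density equal X Y ≤ i₁
    density-equal {X} {Y} p q = begin
      density equal X Y ≡⟨ sum-cong (λ u → trans (sym (sum-*ˡ (μ X u) _)) (cong (μ X u *_) (trans (sum-cong (λ v → *-comm _ _)) (sum-pick u (μ Y))))) ⟩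
      sum (λ u → μ X u * μ Y u) ≤⟨ sum-mono-≤ (λ u → *-monoˡ-≤ (μ-nonneg X u) (small u)) ⟩
      sum (λ u → μ X u * i₁) ≡⟨ trans (sum-cong (λ u → *-comm _ _)) (sym (sum-*ˡ i₁ (μ X))) ⟩
      i₁ * sum (μ X) ≡⟨ trans (cong (i₁ *_) (sum-μ p)) (*-identityʳ i₁) ⟩
      i₁ ∎
      where
      open ≤-Reasoning
      small : ∀ u → μ Y u ≤ i₁
      small u = ratio-≤-inv (ℕₚ.<-≤-trans 0<N q) 0<N
        (ℕₚ.≤-trans (ℕₚ.*-monoʳ-≤ N (𝟙-≤1 (Y u))) (ℕₚ.≤-trans (ℕₚ.≤-reflexive (ℕₚ.*-identityʳ N)) q))

    module _ (i j : Fin k) where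

      private
        X Y V W : Sub n
        X = cell κ i
        Y = cell κ j
        V = parts i
        W = parts j
        d e : F
        d = cellDensity κ i j
        e = density (E true) V W

      V>0 : 0 ℕ.< ∣ V ∣
      V>0 = nonempty i
      W>0 : 0 ℕ.< ∣ W ∣
      W>0 = nonempty j

      forbidden-density : ∀ c → forbidden c i j ≡ true → density (E c) V W ≤ i₁
      forbidden-density c f = ≤-trans (≤-reflexive (avg-edges (E c) V W V>0 W>0))
        (ratio-≤-inv (ℕₚ.*-mono-< V>0 W>0) 0<N (ℕₚ.<⇒≤ (⌊⌋-true (_ ℕ.<? _) f)))

      density-sum-≤ : 0 ℕ.< ∣ X ∣ → 0 ℕ.< ∣ Y ∣ → d + density (E false) X Y ≤ 1F
      density-sum-≤ p q = ≤-trans (≤-reflexive (sym (avg-+ X Y _ _))) (≤-trans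
        (avg-mono X Y (λ u v → ≤-trans (≤-reflexive (sym (ι-+ _ _))) (ι-mono (disjoint u v)))) (≤-reflexive (avg-const p q 1F)))

      density-sum-≥ : 1F ≤ e + (density (E false) V W + density equal V W)
      density-sum-≥ = ≤-trans (≤-reflexive (sym (avg-const V>0 W>0 1F))) (≤-trans
        (avg-mono V W (λ u v → ≤-trans (ι-mono (exhaustive u v)) (≤-reflexive (trans (ι-+ _ _) (cong (_ +_) (ι-+ _ _))))))
        (≤-reflexive (trans (avg-+ V W _ _) (cong (e +_) (avg-+ V W _ _)))))

      -- Only edge densities are tracked by the deviation, so the density of non-edges is reached
      -- through complements. The 3/N consists of one 1/N from `≤-sq`, one from the sparsity of c on
      -- the representatives and, for non-edges, one from the diagonal.
      edited-density : 0 ℕ.< ∣ X ∣ → 0 ℕ.< ∣ Y ∣ → ∀ c → forbidden c i j ≡ true →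
        density (E c) X Y ≤ ι N * sq (d - e) + ι 3 * i₁
      edited-density p q true f = begin
        d ≡⟨ solve 2 (λ d e → d := d :- e :+ e) refl d e ⟩
        d - e + e ≤⟨ +-mono-≤ (≤-sq (d - e)) (forbidden-density true f) ⟩
        ι N * sq (d - e) + i₁ + i₁ ≤⟨ ≤-by i₁ (inv-nonneg N) (solve 2 (λ a i → a :+ con (ℤ.+ 3) :* i := a :+ i :+ i :+ i) refl (ι N * sq (d - e)) i₁) ⟩
        ι N * sq (d - e) + ι 3 * i₁ ∎
        where open ≤-Reasoning
      edited-density p q false f = begin
        δ ≤⟨ ≤-by (1F - (d + δ)) (≤⇒0≤- (density-sum-≤ p q)) (solve 2 (λ d x → con (ℤ.+ 1) :- d := x :+ (con (ℤ.+ 1) :- (d :+ x))) refl d δ) ⟩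
        1F - d ≤⟨ +-mono-≤ density-sum-≥ ≤-refl ⟩
        e + (density (E false) V W + density equal V W) - d ≤⟨ +-mono-≤ (+-mono-≤ ≤-refl (+-mono-≤ (forbidden-density false f) (density-equal V>0 (large j)))) ≤-refl ⟩
        e + (i₁ + i₁) - d ≡⟨ solve 3 (λ d e i → e :+ (i :+ i) :- d := (e :- d) :+ (i :+ i)) refl d e i₁ ⟩
        (e - d) + (i₁ + i₁) ≤⟨ +-mono-≤ (≤-sq (e - d)) ≤-refl ⟩
        ι N * sq (e - d) + i₁ + (i₁ + i₁) ≡⟨ solve 4 (λ n d e i → n :* ((e :- d) :* (e :- d)) :+ i :+ (i :+ i) := n :* ((d :- e) :* (d :- e)) :+ con (ℤ.+ 3) :* i) refl (ι N) d e i₁ ⟩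
        ι N * sq (d - e) + ι 3 * i₁ ∎
        where
        open ≤-Reasoning
        δ = density (E false) X Y

    edited : Bool → Fin n → Fin n → Bool
    edited c u v = isActive κ (κ u) (κ v) ∧ (forbidden c (κ u) (κ v) ∧ E c u v)

    edited-cell : ∀ c i j → weight κ i j * avg (cell κ i) (cell κ j) (λ u v → ι (𝟙 (edited c u v)))
      ≤ weight κ i j * avg (cell κ i) (cell κ j) (λ _ _ → ι 3 * i₁)
        + ι N * (ι (𝟙 (isActive κ i j)) * (weight κ i j * sq (cellDensity κ i j - density (E true) (parts i) (parts j))))
    edited-cell c i j = go (isActive κ i j) refl (forbidden c i j) refl
      where
      open ≤-Reasoning
      w = weight κ i j
      X = cell κ i
      Y = cell κ j
      D = sq (cellDensity κ i j - density (E true) (parts i) (parts j))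
      onCell : ∀ {a f} → isActive κ i j ≡ a → forbidden c i j ≡ f →
        avg X Y (λ u v → ι (𝟙 (edited c u v))) ≡ avg X Y (λ u v → ι (𝟙 (a ∧ (f ∧ E c u v))))
      onCell refl refl = avg-cong-on X Y (λ u v p q → cong₂ (λ x y → ι (𝟙 (isActive κ x y ∧ (forbidden c x y ∧ E c u v)))) (cell-true κ p) (cell-true κ q))
      rhs-nonneg : ∀ a → 0F ≤ w * avg X Y (λ _ _ → ι 3 * i₁) + ι N * (ι (𝟙 a) * (w * D))
      rhs-nonneg a = +-nonneg (*-nonneg (weight-nonneg κ i j) (≤-trans (≤-reflexive (sym avg-0)) (avg-mono X Y (λ _ _ → *-nonneg (ι-nonneg 3) (inv-nonneg N)))))
        (*-nonneg (ι-nonneg N) (*-nonneg (ι-nonneg _) (*-nonneg (weight-nonneg κ i j) (sq-nonneg _))))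
        where
        avg-0 : avg X Y (λ _ _ → 0F) ≡ 0F
        avg-0 = trans (sum₂-cong {g = λ _ _ → 0F} (λ u v → trans (cong (μ X u *_) (zeroʳ _)) (zeroʳ _))) (sum-zero {n} (λ _ → sum-0 n))
      vanish : ∀ a f → isActive κ i j ≡ a → forbidden c i j ≡ f → a ∧ f ≡ false →
        w * avg X Y (λ u v → ι (𝟙 (edited c u v))) ≡ 0F
      vanish a f p q e = trans (cong (w *_) (trans (onCell p q) (trans (sum₂-cong {g = λ _ _ → 0F} (λ u v → trans (cong (λ b → μ X u * (μ Y v * ι (𝟙 b))) (off a f (E c u v) e))
          (trans (cong (μ X u *_) (zeroʳ _)) (zeroʳ _)))) (sum-zero {n} (λ _ → sum-0 n))))) (zeroʳ w)
        where
        off : ∀ a f x → a ∧ f ≡ false → a ∧ (f ∧ x) ≡ false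
        off false f x _ = refl
        off true false x _ = refl
      go : ∀ a → isActive κ i j ≡ a → ∀ f → forbidden c i j ≡ f →
        w * avg X Y (λ u v → ι (𝟙 (edited c u v))) ≤ w * avg X Y (λ _ _ → ι 3 * i₁) + ι N * (ι (𝟙 (isActive κ i j)) * (w * D))
      go false p f q = ≤-trans (≤-reflexive (vanish false f p q refl)) (rhs-nonneg _)
      go true p false q = ≤-trans (≤-reflexive (vanish true false p q refl)) (rhs-nonneg _)
      go true p true q = begin
        w * avg X Y (λ u v → ι (𝟙 (edited c u v))) ≡⟨ cong (w *_) (onCell p q) ⟩
        w * density (E c) X Y ≤⟨ *-monoˡ-≤ (weight-nonneg κ i j) (edited-density i j X>0 Y>0 c q) ⟩
        w * (ι N * D + ι 3 * i₁) ≡⟨ solve 4 (λ w n d y → w :* (n :* d :+ y) := w :* y :+ n :* (con (ℤ.+ 1) :* (w :* d))) refl w (ι N) D (ι 3 * i₁) ⟩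
        w * (ι 3 * i₁) + ι N * (1F * (w * D)) ≡⟨ cong₂ (λ x b → w * x + ι N * (ι (𝟙 b) * (w * D))) (sym (avg-const X>0 Y>0 _)) (sym p) ⟩
        _ ∎
        where
        big = active⇒big κ i j p
        positive : ∀ i → isBig κ i ≡ true → 0 ℕ.< ∣ cell κ i ∣
        positive i b with zero-or-positive ∣ cell κ i ∣
        ... | inj₂ p = p
        ... | inj₁ e = contradiction (ℕₚ.<-≤-trans 0<n (ℕₚ.≤-trans (⌊⌋-true (n ℕ.≤? _) b) (ℕₚ.≤-reflexive (trans (cong (k ℕ.* N ℕ.*_) e) (ℕₚ.*-zeroʳ (k ℕ.* N)))))) ℕₚ.1+n≰n
        X>0 : 0 ℕ.< ∣ X ∣
        X>0 = positive i (proj₁ big)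
        Y>0 : 0 ℕ.< ∣ Y ∣
        Y>0 = positive j (proj₂ big)

    -- After multiplication by N, the term 3/N per vertex pair gives 3n², and the deviation gives N
    -- · N · 2 · `tolerance` = n².
    edited-count : ∀ c → N ℕ.* ℕΣ.sum (λ u → ℕΣ.sum (λ v → 𝟙 (edited c u v))) ℕ.≤ 4 ℕ.* (n ℕ.* n)
    edited-count c = ι-cancel (begin
      ι (N ℕ.* T) ≡⟨ ι-* N T ⟩
      ι N * ι T ≡⟨ cong (ι N *_) (trans (ι-sum _) (sum-cong (λ u → ι-sum _))) ⟩
      ι N * sum₂ (λ u v → ι (𝟙 (edited c u v))) ≤⟨ *-monoˡ-≤ (ι-nonneg N) inner ⟩
      ι N * (ι 3 * i₁ * ι nn + ι N * (ι 2 * tolerance)) ≡⟨ solve 5 (λ n i j w y → n :* (con (ℤ.+ 3) :* i :* w :+ n :* (con (ℤ.+ 2) :* (j :* w)))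
            := con (ℤ.+ 3) :* (n :* i) :* w :+ con (ℤ.+ 2) :* (n :* n) :* j :* w) refl (ι N) i₁ (inv (2 ℕ.* (N ℕ.* N))) (ι nn) 0F ⟩
      ι 3 * (ι N * i₁) * ι nn + ι 2 * (ι N * ι N) * inv (2 ℕ.* (N ℕ.* N)) * ι nn ≡⟨ cong₂ (λ x y → ι 3 * x * ι nn + y * ι nn) N*i₁
            (trans (cong (_* inv (2 ℕ.* (N ℕ.* N))) (sym (trans (ι-* 2 (N ℕ.* N)) (cong (ι 2 *_) (ι-* N N))))) (inv-inverse 0<2NN)) ⟩
      ι 3 * 1F * ι nn + 1F * ι nn ≡⟨ solve 1 (λ w → con (ℤ.+ 3) :* con (ℤ.+ 1) :* w :+ con (ℤ.+ 1) :* w := con (ℤ.+ 4) :* w) refl (ι nn) ⟩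
      ι 4 * ι nn ≡⟨ sym (ι-* 4 nn) ⟩
      ι (4 ℕ.* nn) ∎)
      where
      open ≤-Reasoning
      nn = n ℕ.* n
      T = ℕΣ.sum (λ u → ℕΣ.sum (λ v → 𝟙 (edited c u v)))
      inner : sum₂ (λ u v → ι (𝟙 (edited c u v))) ≤ ι 3 * i₁ * ι nn + ι N * (ι 2 * tolerance)
      inner = begin
        sum₂ (λ u v → ι (𝟙 (edited c u v))) ≡⟨ sym (cell-decomposition κ _) ⟩
        _ ≤⟨ sum₂-mono (edited-cell c) ⟩
        _ ≡⟨ sum₂-+ _ _ ⟩
        _ ≡⟨ cong₂ _+_ (trans (cell-decomposition κ _) (trans (sum₂-cong {n} {n} (λ _ _ → sym (*-identityʳ _))) (trans (sum₂-* {n} {n} (ι 3 * i₁) (λ _ _ → 1F)) (cong (ι 3 * i₁ *_) (sum₂-1 n))))) (sum₂-* (ι N) _) ⟩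
        ι 3 * i₁ * ι nn + ι N * totalDeviation κ parts ≤⟨ +-mono-≤ ≤-refl (*-monoˡ-≤ (ι-nonneg N) deviating) ⟩
        ι 3 * i₁ * ι nn + ι N * (ι 2 * tolerance) ∎

-- Passing between rational and integral inequalities

module Estimates where

  open Field

  module _ {e : F} {p q E : ℕ} (0<q : 0 ℕ.< q) (e*q : e * ι q ≡ ι p) where

    e≡p/q : e ≡ ι p * inv q
    e≡p/q = begin
      e ≡⟨ sym (*-identityʳ e) ⟩
      e * 1F ≡⟨ cong (e *_) (sym (inv-inverse 0<q)) ⟩
      e * (ι q * inv q) ≡⟨ sym (*-assoc e (ι q) (inv q)) ⟩
      e * ι q * inv q ≡⟨ cong (_* inv q) e*q ⟩
      ι p * inv q ∎
      where open ≡-Reasoning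

    E*e : ι E * e ≡ ι (E ℕ.* p) * inv q
    E*e = trans (cong (ι E *_) e≡p/q) (trans (sym (*-assoc (ι E) (ι p) (inv q))) (cong (_* inv q) (sym (ι-* E p))))

    1≤E*e : q ℕ.≤ E ℕ.* p → 1F ≤ ι E * e
    1≤E*e h = begin
      1F ≡⟨ sym (inv-inverse 0<q) ⟩
      ι q * inv q ≤⟨ *-mono-≤ (ι-nonneg q) (inv-nonneg q) (ι-mono h) ≤-refl ⟩
      ι (E ℕ.* p) * inv q ≡⟨ sym E*e ⟩
      ι E * e ∎
      where open ≤-Reasoning

    E*e≤2 : E ℕ.* p ℕ.≤ 2 ℕ.* q → ι E * e ≤ ι 2
    E*e≤2 h = begin
      ι E * e ≡⟨ E*e ⟩
      ι (E ℕ.* p) * inv q ≤⟨ *-mono-≤ (ι-nonneg (E ℕ.* p)) (inv-nonneg q) (ι-mono h) ≤-refl ⟩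
      ι (2 ℕ.* q) * inv q ≡⟨ cong (_* inv q) (ι-* 2 q) ⟩
      ι 2 * ι q * inv q ≡⟨ *-assoc (ι 2) (ι q) (inv q) ⟩
      ι 2 * (ι q * inv q) ≡⟨ cong (ι 2 *_) (inv-inverse 0<q) ⟩
      ι 2 * 1F ≡⟨ *-identityʳ (ι 2) ⟩
      ι 2 ∎
      where open ≤-Reasoning

  -- The factor 4 bounds (E ε)², as E ε ≤ 2. The square is written in the form to which `_^ℚ_`
  -- unfolds.
  height-bound : ∀ {e E j K} → 0F ≤ e → ι E * e ≤ ι 2 → j ℕ.≤ K ℕ.* (E ℕ.* E) → ι j * (e * (e * 1F)) ≤ ι (K ℕ.* 4)
  height-bound {e} {E} {j} {K} 0≤e E*e≤2 h = begin
    ι j * (e * (e * 1F)) ≤⟨ *-mono-≤ (ι-nonneg j) (*-nonneg 0≤e (*-nonneg 0≤e (ι-nonneg 1))) (ι-mono h) ≤-refl ⟩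
    ι (K ℕ.* (E ℕ.* E)) * (e * (e * 1F)) ≡⟨ cong (_* (e * (e * 1F))) (trans (ι-* K (E ℕ.* E)) (cong (ι K *_) (ι-* E E))) ⟩
    ι K * (ι E * ι E) * (e * (e * 1F)) ≡⟨ solve 3 (λ k n e → k :* (n :* n) :* (e :* (e :* con (ℤ.+ 1))) := k :* (n :* e :* (n :* e))) refl (ι K) (ι E) e ⟩
    ι K * (ι E * e * (ι E * e)) ≤⟨ *-monoˡ-≤ (ι-nonneg K) (*-mono-≤ 0≤E*e 0≤E*e E*e≤2 E*e≤2) ⟩
    ι K * (ι 2 * ι 2) ≡⟨ trans (cong (ι K *_) (sym (ι-* 2 2))) (sym (ι-* K 4)) ⟩
    ι (K ℕ.* 4) ∎
    where
    open ≤-Reasoning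
    0≤E*e : 0F ≤ ι E * e
    0≤E*e = *-nonneg (ι-nonneg E) 0≤e

  edit-bound : ∀ {e E d m} → 1F ≤ ι E * e → 0F ≤ e → E ℕ.* d ℕ.≤ m → ι d ≤ e * ι m
  edit-bound {e} {E} {d} {m} 1≤E*e 0≤e h = begin
    ι d ≡⟨ sym (*-identityˡ (ι d)) ⟩
    1F * ι d ≤⟨ *-mono-≤ (ι-nonneg 1) (ι-nonneg d) 1≤E*e ≤-refl ⟩
    ι E * e * ι d ≡⟨ solve 3 (λ n e d → n :* e :* d := e :* (n :* d)) refl (ι E) e (ι d) ⟩
    e * (ι E * ι d) ≡⟨ cong (e *_) (sym (ι-* E d)) ⟩
    e * ι (E ℕ.* d) ≤⟨ *-monoˡ-≤ 0≤e (ι-mono h) ⟩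
    e * ι m ∎
    where open ≤-Reasoning

  clear-denominator : ∀ {D a b} → 0 ℕ.< D → ι a ≤ inv D * ι b → D ℕ.* a ℕ.≤ b
  clear-denominator {D} {a} {b} 0<D h = ι-cancel (begin
    ι (D ℕ.* a) ≡⟨ ι-* D a ⟩
    ι D * ι a ≤⟨ *-monoˡ-≤ (ι-nonneg D) h ⟩
    ι D * (inv D * ι b) ≡⟨ sym (*-assoc (ι D) (inv D) (ι b)) ⟩
    ι D * inv D * ι b ≡⟨ cong (_* ι b) (inv-inverse 0<D) ⟩
    1F * ι b ≡⟨ *-identityˡ (ι b) ⟩
    ι b ∎)
    where open ≤-Reasoning

  1≤inv : ∀ {D m} → 0 ℕ.< D → D ℕ.≤ m → 1F ≤ inv D * ι m
  1≤inv {D} {m} 0<D h = begin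
    1F ≡⟨ sym (inv-inverse 0<D) ⟩
    ι D * inv D ≡⟨ *-comm (ι D) (inv D) ⟩
    inv D * ι D ≤⟨ *-monoˡ-≤ (inv-nonneg D) (ι-mono h) ⟩
    inv D * ι m ∎
    where open ≤-Reasoning

-- Counting lemma under one-sided regularity

module Counting where

  open Arithmetic
  open import Defs using (maps)
  open import Data.List using (List; []; _∷_; map; concatMap; filter; length; tabulate; allFin)
  open import Data.List.Properties using (length-++; filter-++)
  open ≤-Reasoning

  #maps : ∀ {h n} → ((Fin h → Fin n) → Bool) → ℕ
  #maps {h} {n} P = length (filter (λ f → P f Bool.≟ true) (maps h n))

  filter-map : ∀ {A B : Set} (P : B → Bool) (c : A → B) (xs : List A) →
    length (filter (λ y → P y Bool.≟ true) (map c xs)) ≡ length (filter (λ x → P (c x) Bool.≟ true) xs)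
  filter-map P c [] = refl
  filter-map P c (x ∷ xs) with does (P (c x) Bool.≟ true)
  ... | true  = cong suc (filter-map P c xs)
  ... | false = filter-map P c xs

  filter-concatMap : ∀ {m} {A B : Set} (P : B → Bool) (g : A → List B) (t : Fin m → A) →
    length (filter (λ y → P y Bool.≟ true) (concatMap g (tabulate t)))
      ≡ ℕΣ.sum (λ i → length (filter (λ y → P y Bool.≟ true) (g (t i))))
  filter-concatMap {zero}  P g t = sym (ℕΣ.sum-[] _)
  filter-concatMap {suc m} P g t = trans (cong length (filter-++ _ (g (t zero)) _))
    (trans (length-++ (filter _ (g (t zero)))) (trans (cong (_ +_) (filter-concatMap P g (t ∘ suc))) (sym (ℕΣ.sum-∷ _))))

  sum-mono-*ˡ : ∀ {m} c (f : Fin m → ℕ) g → (∀ i → c * f i ≤ g i) → c * ℕΣ.sum f ≤ ℕΣ.sum g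
  sum-mono-*ˡ c f g p = ≤-trans (≤-reflexive (ℕΣ.sum-*ˡ c f)) (ℕ-sum-mono p)

  -- The thresholds w and w′ are numbers independent of X and Y. They stay the same when X and Y
  -- shrink to neighbourhoods, and so the property is inherited by subsets as it stands.
  record LowerRegular {n} (A r : ℕ) (E : Rel n) (w w′ : ℕ) (X Y : Sub n) : Set where
    constructor lowerRegular
    field
      many-edges : ∀ X′ Y′ → X′ ⊆ X → Y′ ⊆ Y → w ≤ A * ∣ X′ ∣ → w′ ≤ A * ∣ Y′ ∣ → ∣ X′ ∣ * ∣ Y′ ∣ ≤ r * edges E X′ Y′
  open LowerRegular

  LowerRegular-⊆ : ∀ {n A r} {E : Rel n} {w w′ X X₁ Y Y₁} → X₁ ⊆ X → Y₁ ⊆ Y →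
    LowerRegular A r E w w′ X Y → LowerRegular A r E w w′ X₁ Y₁
  LowerRegular-⊆ p q reg .many-edges X′ Y′ s s′ = many-edges reg X′ Y′ (λ u → p u ∘ s u) (λ u → q u ∘ s′ u)

  edges-rows : ∀ {n} (E : Rel n) X Y → edges E X Y ≡ ℕΣ.sum (λ u → 𝟙 (X u) * ∣ Y ∩ E u ∣)
  edges-rows E X Y = ℕΣ.sum-cong (λ u → trans (sym (ℕΣ.sum-*ˡ (𝟙 (X u)) _)) (cong (𝟙 (X u) *_) (ℕΣ.sum-cong (λ v → 𝟙-∧ (Y v) (E u v)))))
    where
    𝟙-∧ : ∀ a b → 𝟙 a * 𝟙 b ≡ 𝟙 (a ∧ b)
    𝟙-∧ true  b = +-identityʳ _
    𝟙-∧ false b = refl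

  module _ {n A r : ℕ} {E : Rel n} {w w′ : ℕ} {X Y : Sub n} (reg : LowerRegular A r E w w′ X Y)
           (0<w : 0 < w) (Y-large : w′ ≤ A * ∣ Y ∣) where

    lowDegree : Sub n
    lowDegree u = X u ∧ not ⌊ ∣ Y ∣ ℕ.≤? r * ∣ Y ∩ E u ∣ ⌋

    -- If at least w/A vertices had too few neighbours in Y, they would form, together with all of
    -- Y, a pair contradicting regularity.
    lowDegree-few : A * ∣ lowDegree ∣ < w
    lowDegree-few = ≰⇒> λ big → contradiction (≤-trans 0<w (≤-trans big (≤-reflexive (trans (cong (A *_) (none big)) (*-zeroʳ A))))) 1+n≰n
      where
      L = lowDegree
      -- The summand 1 records that the degree bound fails strictly. Summation leaves a surplus of
      -- the size of L, which regularity forces to be 0.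
      pointwise : ∀ u → 𝟙 (L u) * (1 + r * ∣ Y ∩ E u ∣) ≤ 𝟙 (L u) * ∣ Y ∣
      pointwise u with X u | ∣ Y ∣ ℕ.≤? r * ∣ Y ∩ E u ∣
      ... | true  | no ¬p = *-monoʳ-≤ 1 (≰⇒> ¬p)
      ... | true  | yes _ = z≤n
      ... | false | _     = z≤n
      total : ∣ L ∣ + r * edges E L Y ≤ ∣ L ∣ * ∣ Y ∣
      total = begin
        ∣ L ∣ + r * edges E L Y ≡⟨ cong (∣ L ∣ +_) (trans (cong (r *_) (edges-rows E L Y)) (ℕΣ.sum-*ˡ r _)) ⟩
        ∣ L ∣ + ℕΣ.sum (λ u → r * (𝟙 (L u) * ∣ Y ∩ E u ∣)) ≡⟨ sym (ℕΣ.sum-+ _ _) ⟩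
        ℕΣ.sum (λ u → 𝟙 (L u) + r * (𝟙 (L u) * ∣ Y ∩ E u ∣)) ≡⟨ ℕΣ.sum-cong (λ u → rearrange (𝟙 (L u)) r ∣ Y ∩ E u ∣) ⟩
        ℕΣ.sum (λ u → 𝟙 (L u) * (1 + r * ∣ Y ∩ E u ∣)) ≤⟨ ℕ-sum-mono pointwise ⟩
        ℕΣ.sum (λ u → 𝟙 (L u) * ∣ Y ∣) ≡⟨ trans (ℕΣ.sum-cong (λ u → *-comm (𝟙 (L u)) ∣ Y ∣)) (sym (ℕΣ.sum-*ˡ ∣ Y ∣ _)) ⟩
        ∣ Y ∣ * ∣ L ∣ ≡⟨ *-comm ∣ Y ∣ ∣ L ∣ ⟩
        ∣ L ∣ * ∣ Y ∣ ∎
        where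
        rearrange : ∀ l r y → l + r * (l * y) ≡ l * (1 + r * y)
        rearrange = solve-∀
      none : w ≤ A * ∣ L ∣ → ∣ L ∣ ≡ 0
      none big = n≤0⇒n≡0 (+-cancelʳ-≤ (r * edges E L Y) ∣ L ∣ 0
        (≤-trans total (many-edges reg L Y (λ u e → ∧-left (X u) e) (λ _ e → e) big Y-large)))
        where
        ∧-left : ∀ a {b} → a ∧ b ≡ true → a ≡ true
        ∧-left true _ = refl

  -- Greedy embedding. The first vertex is taken from those keeping a 1/r share of every later set:
  -- each later set rules out fewer than w/A vertices, and the factor H leaves w/A choices, at least
  -- m/(QA) of them. The later sets shrink by a factor r with every vertex while the thresholds
  -- stay, which the power of r in the size hypothesis allows for.
  embeddings-many : ∀ {n} h {H A r Q m} → h ≤ H → 0 < r →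
    (X : Fin h → Sub n) (w : Fin h → ℕ) (E : Fin h → Fin h → Rel n) →
    (∀ a b → a Fin.< b → LowerRegular A r (E a b) (w a) (w b) (X a) (X b)) →
    (∀ a → 0 < w a) → (∀ a → H * w a * r ^ h ≤ A * ∣ X a ∣) → (∀ a → m ≤ Q * w a) →
    (P : (Fin h → Fin n) → Bool) →
    (∀ f → (∀ a → X a (f a) ≡ true) → (∀ a b → a Fin.< b → E a b (f a) (f b) ≡ true) → P f ≡ true) →
    m ^ h ≤ (Q * A) ^ h * #maps P
  embeddings-many zero _ _ X w E reg 0<w size bound P sound =
    ≤-reflexive (sym (trans (+-identityʳ _) (count-one P _ (sound _ (λ ()) (λ ())))))
    where
    count-one : ∀ {A : Set} (P : A → Bool) f → P f ≡ true → length (filter (λ f → P f Bool.≟ true) (f ∷ [])) ≡ 1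
    count-one P f e with P f Bool.≟ true
    ... | yes _ = refl
    ... | no ¬e = contradiction e ¬e
  embeddings-many {n} (suc h) {H} {A} {r} {Q} {m} h≤H 0<r X w E reg 0<w size bound P sound =
    -- Extending a tuple by a vertex is an anonymous function inside `maps`. It is left to
    -- unification and used only through its two defining equations.
    count _ (λ _ _ → refl) (λ _ _ _ → refl)
    where
    regroup : ∀ q a g x → q * (a * g) * x ≡ q * a * (x * g)
    regroup = solve-∀

    neighbours : Fin h → Fin n → Sub n
    neighbours b v = X (suc b) ∩ E zero (suc b) v

    rich? : ∀ v → Dec (∀ b → ∣ X (suc b) ∣ ≤ r * ∣ neighbours b v ∣)
    rich? v = Finₚ.all? (λ b → ∣ X (suc b) ∣ ℕ.≤? r * ∣ neighbours b v ∣)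

    G : Sub n
    G v = X zero v ∧ ⌊ rich? v ⌋

    w≤size : ∀ a → w a ≤ A * ∣ X a ∣
    w≤size a = ≤-trans (≤-trans (m≤n*m (w a) H {{ℕ.>-nonZero (≤-trans (s≤s z≤n) h≤H)}})
      (m≤m*n (H * w a) (r ^ suc h) {{m^n≢0 r (suc h) {{ℕ.>-nonZero 0<r}}}})) (size a)

    low : Fin h → Sub n
    low b = lowDegree (reg zero (suc b) (s≤s z≤n)) (0<w zero) (w≤size (suc b))

    cover : ∀ v → 𝟙 (X zero v) ≤ 𝟙 (G v) + ℕΣ.sum (λ b → 𝟙 (low b v))
    cover v with X zero v in eq | rich? v
    ... | false | _ = z≤n
    ... | true | yes _ = s≤s z≤n
    ... | true | no ¬p with Finₚ.¬∀⟶∃¬ h _ (λ b → ∣ X (suc b) ∣ ℕ.≤? r * ∣ neighbours b v ∣) ¬p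
    ... | b , ¬q = ∣∣-positive (λ b → low′ b) b member-low
      where
      low′ : Fin h → Bool
      low′ b = not ⌊ ∣ X (suc b) ∣ ℕ.≤? r * ∣ neighbours b v ∣ ⌋
      member-low : low′ b ≡ true
      member-low with ∣ X (suc b) ∣ ℕ.≤? r * ∣ neighbours b v ∣
      ... | yes q = contradiction q ¬q
      ... | no _ = refl

    first-many : w zero ≤ A * ∣ G ∣
    first-many = +-cancelʳ-≤ (h * w zero) (w zero) (A * ∣ G ∣) (begin
      w zero + h * w zero ≤⟨ *-monoˡ-≤ (w zero) h≤H ⟩
      H * w zero ≤⟨ m≤m*n (H * w zero) (r ^ suc h) {{m^n≢0 r (suc h) {{ℕ.>-nonZero 0<r}}}} ⟩
      H * w zero * r ^ suc h ≤⟨ size zero ⟩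
      A * ∣ X zero ∣ ≤⟨ *-monoʳ-≤ A (≤-trans (ℕ-sum-mono cover) (≤-reflexive (ℕΣ.sum-+ _ _))) ⟩
      A * (∣ G ∣ + ℕΣ.sum (λ v → ℕΣ.sum (λ b → 𝟙 (low b v)))) ≡⟨ *-distribˡ-+ A _ _ ⟩
      A * ∣ G ∣ + A * ℕΣ.sum (λ v → ℕΣ.sum (λ b → 𝟙 (low b v))) ≡⟨ cong (λ z → A * ∣ G ∣ + A * z) (ℕΣ.sum-comm (λ v b → 𝟙 (low b v))) ⟩
      A * ∣ G ∣ + A * ℕΣ.sum (λ b → ∣ low b ∣) ≤⟨ +-monoʳ-≤ (A * ∣ G ∣) (sum-mono-*ˡ A _ _ (λ b → <⇒≤ (lowDegree-few (reg zero (suc b) (s≤s z≤n)) (0<w zero) (w≤size (suc b))))) ⟩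
      A * ∣ G ∣ + ℕΣ.sum {h} (λ b → w zero) ≡⟨ cong (A * ∣ G ∣ +_) (ℕ-sum-const h (w zero)) ⟩
      A * ∣ G ∣ + h * w zero ∎)

    module _ (cons : Fin n → (Fin h → Fin n) → Fin (suc h) → Fin n)
             (cons-zero : ∀ v f → cons v f zero ≡ v) (cons-suc : ∀ v f a → cons v f (suc a) ≡ f a) where

      N : Fin n → ℕ
      N v = #maps (λ f → P (cons v f))

      per-vertex : ∀ v → m ^ h * 𝟙 (G v) ≤ (Q * A) ^ h * N v
      per-vertex v with X zero v in eq | rich? v
      ... | false | _ = ≤-trans (≤-reflexive (*-zeroʳ (m ^ h))) z≤n
      ... | true | no _ = ≤-trans (≤-reflexive (*-zeroʳ (m ^ h))) z≤n
      ... | true | yes rich = ≤-trans (≤-reflexive (*-identityʳ _))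
        (embeddings-many h {H} {A} {r} {Q} {m} (≤-trans (n≤1+n h) h≤H) 0<r (λ b → neighbours b v) (w ∘ suc) (λ a b → E (suc a) (suc b))
           (λ a b a<b → LowerRegular-⊆ (∩-⊆ (X (suc a)) (E zero (suc a) v)) (∩-⊆ (X (suc b)) (E zero (suc b) v)) (reg (suc a) (suc b) (s≤s a<b)))
           (0<w ∘ suc) size′ (bound ∘ suc) (λ f → P (cons v f))
           (λ f inside edge → sound (cons v f) (in-parts f inside) (compatible f inside edge)))
        where
        ∩-right : ∀ a {b} → a ∧ b ≡ true → b ≡ true
        ∩-right true e = e
        in-parts : ∀ f → (∀ b → neighbours b v (f b) ≡ true) → ∀ a → X a (cons v f a) ≡ true
        in-parts f inside zero    = trans (cong (X zero) (cons-zero v f)) eq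
        in-parts f inside (suc a) = trans (cong (X (suc a)) (cons-suc v f a)) (∩-⊆ (X (suc a)) (E zero (suc a) v) (f a) (inside a))
        compatible : ∀ f → (∀ b → neighbours b v (f b) ≡ true) → (∀ a b → a Fin.< b → E (suc a) (suc b) (f a) (f b) ≡ true) →
                     ∀ a b → a Fin.< b → E a b (cons v f a) (cons v f b) ≡ true
        compatible f inside edge zero (suc b) _ =
          trans (cong₂ (E zero (suc b)) (cons-zero v f) (cons-suc v f b)) (∩-right (X (suc b) (f b)) (inside b))
        compatible f inside edge (suc a) (suc b) (s≤s a<b) =
          trans (cong₂ (E (suc a) (suc b)) (cons-suc v f a) (cons-suc v f b)) (edge a b a<b)
        size′ : ∀ b → H * w (suc b) * r ^ h ≤ A * ∣ neighbours b v ∣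
        size′ b = *-cancelˡ-≤ r {{ℕ.>-nonZero 0<r}} (begin
          r * (H * w (suc b) * r ^ h) ≡⟨ shuffle r (H * w (suc b)) (r ^ h) ⟩
          H * w (suc b) * r ^ suc h ≤⟨ size (suc b) ⟩
          A * ∣ X (suc b) ∣ ≤⟨ *-monoʳ-≤ A (rich b) ⟩
          A * (r * ∣ neighbours b v ∣) ≡⟨ swap A r _ ⟩
          r * (A * ∣ neighbours b v ∣) ∎)
          where
          shuffle : ∀ r x y → r * (x * y) ≡ x * (r * y)
          shuffle = solve-∀
          swap : ∀ a r x → a * (r * x) ≡ r * (a * x)
          swap = solve-∀

      total : ℕ
      total = length (filter (λ f → P f Bool.≟ true) (concatMap (λ v → map (cons v) (maps h n)) (allFin n)))

      total-split : total ≡ ℕΣ.sum N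
      total-split = trans (filter-concatMap P (λ v → map (cons v) (maps h n)) id) (ℕΣ.sum-cong (λ v → filter-map P (cons v) (maps h n)))

      count : m ^ suc h ≤ (Q * A) ^ suc h * total
      count = begin
        m * m ^ h ≤⟨ *-monoˡ-≤ (m ^ h) (bound zero) ⟩
        Q * w zero * m ^ h ≤⟨ *-monoˡ-≤ (m ^ h) (*-monoʳ-≤ Q first-many) ⟩
        Q * (A * ∣ G ∣) * m ^ h ≡⟨ regroup Q A ∣ G ∣ (m ^ h) ⟩
        Q * A * (m ^ h * ∣ G ∣) ≤⟨ *-monoʳ-≤ (Q * A) (sum-mono-*ˡ (m ^ h) (λ v → 𝟙 (G v)) (λ v → (Q * A) ^ h * N v) per-vertex) ⟩
        Q * A * ℕΣ.sum (λ v → (Q * A) ^ h * N v) ≡⟨ cong (Q * A *_) (sym (ℕΣ.sum-*ˡ ((Q * A) ^ h) N)) ⟩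
        Q * A * ((Q * A) ^ h * ℕΣ.sum N) ≡⟨ sym (*-assoc (Q * A) _ _) ⟩
        (Q * A) ^ suc h * ℕΣ.sum N ≡⟨ cong ((Q * A) ^ suc h *_) (sym total-split) ⟩
        (Q * A) ^ suc h * total ∎

-- Ramsey's theorem for two colours

module Ramsey {A : Set} (Distinct : A → A → Set) (χ : A → A → Bool) where

  open Arithmetic
  open import Data.List using (List; []; _∷_; filter; length; lookup)
  open import Data.List.Membership.Propositional.Properties using (∈-lookup)
  open import Data.List.Relation.Unary.All as All using (All)
  import Data.List.Relation.Unary.All.Properties as Allₚ
  open import Data.List.Relation.Unary.AllPairs using (AllPairs; []; _∷_)
  import Data.List.Relation.Unary.AllPairs.Properties as AllPairsₚ
  open import Data.List.Relation.Binary.Sublist.Propositional using (_∷_; _∷ʳ_; minimum; ⊆-trans) renaming (_⊆_ to _⊆ₗ_)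
  open import Data.List.Relation.Binary.Sublist.Propositional.Properties using (filter-⊆; All-resp-⊆)

  Mono : Bool → A → A → Set
  Mono c x y = Distinct x y × χ x y ≡ c

  Clique : Bool → ℕ → List A → Set
  Clique c k xs = ∃[ ys ] ys ⊆ₗ xs × length ys ≡ k × AllPairs (Mono c) ys

  neighbours : Bool → A → List A → List A
  neighbours c x = filter (λ y → χ x y Bool.≟ c)

  neighbours-length : ∀ x ys → length (neighbours true x ys) + length (neighbours false x ys) ≡ length ys
  neighbours-length x [] = refl
  neighbours-length x (y ∷ ys) with χ x y
  ... | true  = cong suc (neighbours-length x ys)
  ... | false = trans (+-suc _ _) (cong suc (neighbours-length x ys))

  extend : ∀ c {k x ys} → All (Distinct x) ys → Clique c k (neighbours c x ys) → Clique c (suc k) (x ∷ ys)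
  extend c {x = x} {ys} ds (zs , sub , len , pairs) =
    x ∷ zs , refl ∷ ⊆-trans sub (filter-⊆ _ ys) , cong suc len ,
    All.zip (All-resp-⊆ (⊆-trans sub (filter-⊆ _ ys)) ds , All-resp-⊆ sub (Allₚ.all-filter _ ys)) ∷ pairs

  weaken : ∀ c {k x d ys} → Clique c k (neighbours d x ys) → Clique c k (x ∷ ys)
  weaken c {x = x} {ys = ys} (zs , sub , rest) = zs , x ∷ʳ ⊆-trans sub (filter-⊆ _ ys) , rest

  -- The `suc` stands for the vertex whose neighbours are being divided.
  pigeonhole : ∀ m {a b} → m + m ≤ suc (a + b) → m ≤ a ⊎ m ≤ b
  pigeonhole m {a} {b} p with m ℕ.≤? a
  ... | yes q = inj₁ q
  ... | no ¬q = inj₂ (+-cancelˡ-≤ m m b (≤-trans p (+-monoˡ-≤ b (≰⇒> ¬q))))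

  -- Every vertex halves 2^(p + q) and lowers p or q by one. Colours are read in list order, so that
  -- χ may be asymmetric.
  ramsey : ∀ p q xs → 2 ^ (p + q) ≤ length xs → AllPairs Distinct xs → Clique true p xs ⊎ Clique false q xs
  ramsey zero    q       xs       _   _  = inj₁ ([] , minimum xs , refl , [])
  ramsey (suc p) zero    xs       _   _  = inj₂ ([] , minimum xs , refl , [])
  ramsey (suc p) (suc q) []       len _  = contradiction (≤-trans (m^n>0 2 (suc p + suc q)) len) 1+n≰n
  ramsey (suc p) (suc q) (x ∷ xs) len (d ∷ ds)
    with pigeonhole (2 ^ (p + suc q)) {length (neighbours true x xs)} {length (neighbours false x xs)}
           (≤-trans (≤-reflexive (cong (2 ^ (p + suc q) +_) (sym (+-identityʳ _)))) (≤-trans len (s≤s (≤-reflexive (sym (neighbours-length x xs))))))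
  ... | inj₁ large with ramsey p (suc q) (neighbours true x xs) large (AllPairsₚ.filter⁺ _ ds)
  ...   | inj₁ clique = inj₁ (extend true d clique)
  ...   | inj₂ clique = inj₂ (weaken false {d = true} clique)
  ramsey (suc p) (suc q) (x ∷ xs) len (d ∷ ds) | inj₂ large
    with ramsey (suc p) q (neighbours false x xs) (≤-trans (≤-reflexive (cong (2 ^_) (sym (+-suc p q)))) large) (AllPairsₚ.filter⁺ _ ds)
  ...   | inj₁ clique = inj₁ (weaken true {d = false} clique)
  ...   | inj₂ clique = inj₂ (extend false d clique)

  AllPairs-lookup : ∀ {R : A → A → Set} {xs} → AllPairs R xs → ∀ a b → a Fin.< b → R (lookup xs a) (lookup xs b)
  AllPairs-lookup (r ∷ _)  zero    (suc b) _         = All.lookup r (∈-lookup b)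
  AllPairs-lookup (_ ∷ rs) (suc a) (suc b) (s≤s a<b) = AllPairs-lookup rs a b a<b

module FiniteRamsey where

  open Arithmetic
  open import Data.List using (allFin; lookup)
  open import Data.List.Properties using (length-tabulate)
  import Data.List.Relation.Unary.Unique.Propositional.Properties as Uniqueₚ

  ramsey-Fin : ∀ h (χ : Fin (2 ^ (h + h)) → Fin (2 ^ (h + h)) → Bool) →
    ∃[ c ] Σ (Fin h → Fin (2 ^ (h + h))) λ σ → ∀ a b → a Fin.< b → σ a ≢ σ b × χ (σ a) (σ b) ≡ c
  ramsey-Fin h χ = index (ramsey h h (allFin R) (≤-reflexive (sym (length-tabulate id))) (Uniqueₚ.allFin⁺ R))
    where
    R = 2 ^ (h + h)
    open Ramsey (_≢_ {A = Fin R}) χ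
    select : ∀ c {k} → Clique c k (allFin R) →
             Σ (Fin k → Fin R) λ σ → ∀ a b → a Fin.< b → σ a ≢ σ b × χ (σ a) (σ b) ≡ c
    select c (ys , _ , refl , pairs) = lookup ys , AllPairs-lookup pairs
    index : Clique true h (allFin R) ⊎ Clique false h (allFin R) → _
    index (inj₁ clique) = true  , select true clique
    index (inj₂ clique) = false , select false clique

-- Subsets of about half the size

module Halves where

  open Arithmetic

  subset-of-size : ∀ {n} (X : Sub n) m → m ≤ ∣ X ∣ → ∃[ Y ] Y ⊆ X × ∣ Y ∣ ≡ m
  subset-of-size {zero} X zero p = (λ ()) , (λ ()) , ℕΣ.sum-[] _
  subset-of-size {zero} X (suc m) p = contradiction (≤-trans p (≤-reflexive (ℕΣ.sum-[] _))) λ ()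
  subset-of-size {suc n} X zero p = (λ _ → false) , (λ _ ()) , ℕΣ.sum-0 (suc n)
  subset-of-size {suc n} X (suc m) p with X zero in eq
  ... | true =
    let Y , sub , e = subset-of-size (X ∘ suc) m (ℕ.s≤s⁻¹ (subst (suc m ≤_) (trans (ℕΣ.sum-∷ _) (cong (λ b → 𝟙 b + ∣ X ∘ suc ∣) eq)) p)) in
    (λ { zero → true ; (suc u) → Y u }) , (λ { zero _ → eq ; (suc u) → sub u }) , trans (ℕΣ.sum-∷ _) (cong suc e)
  ... | false =
    let Y , sub , e = subset-of-size (X ∘ suc) (suc m) (subst (suc m ≤_) (trans (ℕΣ.sum-∷ _) (cong (λ b → 𝟙 b + ∣ X ∘ suc ∣) eq)) p) in
    (λ { zero → false ; (suc u) → Y u }) , (λ { zero () ; (suc u) → sub u }) , trans (ℕΣ.sum-∷ _) e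

  -- The factor 3 in place of 2 pays for rounding down; it is attained at size 3.
  half : ∀ {n} (X : Sub n) → 2 ≤ ∣ X ∣ → ∃[ Y ] Y ⊆ X × 2 * ∣ Y ∣ ≤ ∣ X ∣ × ∣ X ∣ ≤ 3 * ∣ Y ∣
  half X 2≤X = let Y , sub , e = subset-of-size X ⌊ ∣ X ∣ /2⌋ (⌊n/2⌋≤n ∣ X ∣) in
    Y , sub , subst (λ z → 2 * z ≤ ∣ X ∣) (sym e) (lower ∣ X ∣) , subst (λ z → ∣ X ∣ ≤ 3 * z) (sym e) (upper ∣ X ∣ 2≤X)
    where
    lower : ∀ z → 2 * ⌊ z /2⌋ ≤ z
    lower z = ≤-trans (+-monoʳ-≤ ⌊ z /2⌋ (≤-trans (≤-reflexive (+-identityʳ _)) (⌊n/2⌋≤⌈n/2⌉ z))) (≤-reflexive (⌊n/2⌋+⌈n/2⌉≡n z))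
    upper : ∀ z → 2 ≤ z → z ≤ 3 * ⌊ z /2⌋
    upper (suc zero) (s≤s ())
    upper (suc (suc zero)) _ = s≤s (s≤s z≤n)
    upper (suc (suc (suc zero))) _ = ≤-refl
    upper (suc (suc (suc (suc z)))) _ = ≤-trans (s≤s (s≤s (upper (suc (suc z)) (s≤s (s≤s z≤n)))))
      (≤-trans (n≤1+n _) (≤-reflexive (sym (three ⌊ suc (suc z) /2⌋))))
      where
      three : ∀ y → 3 * suc y ≡ 3 + 3 * y
      three = solve-∀

-- The two colours, and homogeneous pieces inside a set

module Colours {n : ℕ} (E : Bool → Rel n)
               (exhaustive : ∀ u v → 1 ℕ.≤ 𝟙 (E true u v) ℕ.+ (𝟙 (E false u v) ℕ.+ 𝟙 ⌊ u ≟ v ⌋)) where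

  open Arithmetic
  open ≤-Reasoning

  private
    equal : Rel n
    equal u v = ⌊ u ≟ v ⌋

  edges-equal : ∀ X Y → edges equal X Y ≤ ∣ X ∣
  edges-equal X Y = ℕ-sum-mono (λ u → begin
    ℕΣ.sum (λ v → 𝟙 (X u) * (𝟙 (Y v) * 𝟙 (equal u v))) ≡⟨ sym (ℕΣ.sum-*ˡ (𝟙 (X u)) _) ⟩
    𝟙 (X u) * ℕΣ.sum (λ v → 𝟙 (Y v) * 𝟙 (equal u v)) ≤⟨ *-monoʳ-≤ (𝟙 (X u)) (≤-trans (ℕ-sum-mono (λ v → ≤-trans (*-monoˡ-≤ (𝟙 (equal u v)) (𝟙-≤1 (Y v))) (≤-reflexive (trans (*-identityˡ _) (sym (*-identityʳ _)))))) (≤-reflexive (ℕ-sum-pick u (λ _ → 1)))) ⟩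
    𝟙 (X u) * 1 ≡⟨ *-identityʳ _ ⟩
    𝟙 (X u) ∎)

  edges-total : ∀ X Y → ∣ X ∣ * ∣ Y ∣ ≤ edges (E true) X Y + (edges (E false) X Y + edges equal X Y)
  edges-total X Y = begin
    ∣ X ∣ * ∣ Y ∣ ≡⟨ *-comm ∣ X ∣ ∣ Y ∣ ⟩
    ∣ Y ∣ * ∣ X ∣ ≡⟨ ℕΣ.sum-*ˡ ∣ Y ∣ _ ⟩
    ℕΣ.sum (λ u → ∣ Y ∣ * 𝟙 (X u)) ≡⟨ ℕΣ.sum-cong (λ u → trans (*-comm ∣ Y ∣ _) (ℕΣ.sum-*ˡ (𝟙 (X u)) _)) ⟩
    ℕΣ.sum (λ u → ℕΣ.sum (λ v → 𝟙 (X u) * 𝟙 (Y v))) ≤⟨ ℕ-sum-mono (λ u → ℕ-sum-mono (λ v → pointwise (𝟙 (X u)) (𝟙 (Y v)) _ _ _ (exhaustive u v))) ⟩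
    ℕΣ.sum (λ u → ℕΣ.sum (λ v → p true u v + (p false u v + q u v))) ≡⟨ ℕΣ.sum-cong (λ u → trans (ℕΣ.sum-+ _ _) (cong (ℕΣ.sum (p true u) +_) (ℕΣ.sum-+ _ _))) ⟩
    ℕΣ.sum (λ u → ℕΣ.sum (p true u) + (ℕΣ.sum (p false u) + ℕΣ.sum (q u))) ≡⟨ trans (ℕΣ.sum-+ _ _) (cong (edges (E true) X Y +_) (ℕΣ.sum-+ _ _)) ⟩
    edges (E true) X Y + (edges (E false) X Y + edges equal X Y) ∎
    where
    p : Bool → Fin n → Fin n → ℕ
    p c u v = 𝟙 (X u) * (𝟙 (Y v) * 𝟙 (E c u v))
    q : Fin n → Fin n → ℕ
    q u v = 𝟙 (X u) * (𝟙 (Y v) * 𝟙 (equal u v))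
    pointwise : ∀ x y a b c → 1 ≤ a + (b + c) → x * y ≤ x * (y * a) + (x * (y * b) + x * (y * c))
    pointwise x y a b c h = ≤-trans (m≤m*n (x * y) (a + (b + c)) {{ℕ.>-nonZero h}}) (≤-reflexive (expand x y a b c))
      where
      expand : ∀ x y a b c → x * y * (a + (b + c)) ≡ x * (y * a) + (x * (y * b) + x * (y * c))
      expand = solve-∀

  -- The two colours and the diagonal cover all pairs. The sparse colour and the diagonal each take
  -- at most a share of 1/N, which leaves at least 1/N when 3 ≤ N.
  other-colour : ∀ {N} → 3 ≤ N → ∀ X Y → N ≤ ∣ Y ∣ → ∀ c → N * edges (E c) X Y < ∣ X ∣ * ∣ Y ∣ →
                 ∣ X ∣ * ∣ Y ∣ ≤ N * edges (E (not c)) X Y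
  other-colour {N} 3≤N X Y N≤Y c sparse = +-cancelˡ-≤ (xy + xy) _ _ (begin
    xy + xy + xy ≡⟨ three xy ⟩
    3 * xy ≤⟨ *-monoˡ-≤ xy 3≤N ⟩
    N * xy ≤⟨ *-monoʳ-≤ N (total c) ⟩
    N * (edges (E c) X Y + (edges (E (not c)) X Y + edges equal X Y)) ≡⟨ distribute N (edges (E c) X Y) (edges (E (not c)) X Y) (edges equal X Y) ⟩
    N * edges (E c) X Y + N * edges equal X Y + N * edges (E (not c)) X Y ≤⟨ +-monoˡ-≤ (N * edges (E (not c)) X Y) (+-mono-≤ (<⇒≤ sparse)
        (≤-trans (*-mono-≤ N≤Y (edges-equal X Y)) (≤-reflexive (*-comm ∣ Y ∣ ∣ X ∣)))) ⟩
    xy + xy + N * edges (E (not c)) X Y ∎)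
    where
    xy = ∣ X ∣ * ∣ Y ∣
    three : ∀ z → z + z + z ≡ 3 * z
    three = solve-∀
    distribute : ∀ N a b c → N * (a + (b + c)) ≡ N * a + N * c + N * b
    distribute = solve-∀
    total : ∀ c → xy ≤ edges (E c) X Y + (edges (E (not c)) X Y + edges equal X Y)
    total true  = edges-total X Y
    total false = ≤-trans (edges-total X Y) (≤-reflexive (swap (edges (E true) X Y) (edges (E false) X Y) (edges equal X Y)))
      where
      swap : ∀ a b c → a + (b + c) ≡ b + (a + c)
      swap = solve-∀

  module Monochromatic (N A : ℕ) (3≤N : 3 ≤ N) (2≤A : 2 ≤ A) (h : ℕ) where

    open Robustness
    open FiniteRamsey

    R shrink : ℕ
    R = 2 ^ (h + h)
    shrink = A ^ (steps N A R * 2)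

    0<N : 0 < N
    0<N = ≤-trans (s≤s z≤n) 3≤N

    0<shrink : 0 < shrink
    0<shrink = m^n>0 A {{ℕ.>-nonZero (≤-trans (s≤s z≤n) 2≤A)}} (steps N A R * 2)

    record Homogeneous (W : Sub n) : Set where
      field
        colour   : Bool
        pieces   : Fin h → Sub n
        pieces-⊆ : ∀ a → pieces a ⊆ W
        size     : ∀ a → ∣ W ∣ ≤ shrink * ∣ pieces a ∣
        robust   : ∀ a b → a Fin.< b → Robust A (2 * N) (E colour) (pieces a) (pieces b)

    -- Cylinder regularity is applied to the tuple consisting of R copies of W. A good leaf gives R
    -- large subsets of W; any two of them are dense in some colour by `other-colour`, hence robust
    -- in it, and Ramsey's theorem selects h of them with a common colour.
    homogeneous : ∀ W → shrink * N ≤ ∣ W ∣ → Homogeneous W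
    -- Only goodness of the leaf is wanted here, so Φ is 0 and any positive x would do.
    homogeneous W W-large = select (good-leaf (tree root root>0) root>0 (bad-rare root root>0) (λ _ → Field.0F) {x = Field.1F} (Field.ι-nonneg 1) nontrivial)
      where
      open Leaves E N A 0<N 2≤A R
      W>0 : 0 < ∣ W ∣
      W>0 = <-≤-trans (*-mono-< 0<shrink 0<N) W-large
      root : Cyl
      root _ = W
      root>0 : Nonempty root
      root>0 _ = W>0
      vanish : ∀ {t V} (τ : Tree t V) → Nonempty V → AVG τ (onGood (λ _ → Field.0F)) ≡ Field.0F
      vanish τ ne = trans (AVG-cong τ (λ V → Field.zeroʳ _)) (AVG-const τ ne Field.0F)
      nontrivial : ¬ (Field.1F Field.≤ AVG (tree root root>0) (onGood (λ _ → Field.0F)))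
      nontrivial h = contradiction (Field.ι-cancel (Field.≤-trans h (Field.≤-reflexive (vanish (tree root root>0) root>0)))) 1+n≰n
      select : GoodLeaf depth root (λ _ → Field.0F) _ → Homogeneous W
      select (V , ne , sub , size , good , _) = record
        { colour = c ; pieces = V ∘ σ ; pieces-⊆ = λ a → sub (σ a) ; size = λ a → size (σ a)
        ; robust = λ a b a<b → let σa≢σb , e = mono a b a<b in
            good c (σ a) (σ b) σa≢σb (dense (σ a) (σ b) c e) }
        where
        large : ∀ i → N ≤ ∣ V i ∣
        large i = *-cancelˡ-≤ shrink {{ℕ.>-nonZero 0<shrink}} (≤-trans W-large (size i))
        χ : Fin R → Fin R → Bool
        χ i j = ⌊ ∣ V i ∣ * ∣ V j ∣ ℕ.≤? N * edges (E true) (V i) (V j) ⌋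
        dense : ∀ i j c → χ i j ≡ c → ∣ V i ∣ * ∣ V j ∣ ≤ N * edges (E c) (V i) (V j)
        dense i j c e with ∣ V i ∣ * ∣ V j ∣ ℕ.≤? N * edges (E true) (V i) (V j)
        dense i j true  e | yes p = p
        dense i j false e | no ¬p = other-colour 3≤N (V i) (V j) (large j) true (≰⇒> ¬p)
        found = ramsey-Fin h χ
        c = proj₁ found
        σ = proj₁ (proj₂ found)
        mono = proj₂ (proj₂ found)

-- The starting partition into residue classes

module Residues (N : ℕ) .{{_ : ℕ.NonZero N}} where

  open Arithmetic
  open import Data.Nat.DivMod using (_%_; m<n⇒m%n≡m; [m+n]%n≡m%n; m%n<n)

  ∑< : ∀ n → (ℕ → ℕ) → ℕ
  ∑< n g = ℕΣ.sum {n} (g ∘ toℕ)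

  ∑<-+ : ∀ m {n} g → ∑< (m + n) g ≡ ∑< m g + ∑< n (λ v → g (m + v))
  ∑<-+ zero {n} g = cong (_+ ∑< n g) (sym (ℕΣ.sum-[] _))
  ∑<-+ (suc m) {n} g = trans (ℕΣ.sum-∷ _) (trans (cong (g 0 +_) (∑<-+ m (g ∘ suc)))
    (trans (sym (+-assoc (g 0) _ _)) (cong (_+ ∑< n (λ v → g (suc m + v))) (sym (ℕΣ.sum-∷ _)))))

  hit : ℕ → ℕ → ℕ
  hit r v = 𝟙 ⌊ r ℕ.≟ v % N ⌋

  one-period : ∀ r m → m ≤ N → ∑< m (hit r) ≤ 1
  one-period r m m≤N = ≤-trans (≤-reflexive (ℕΣ.sum-cong (λ v → cong (λ x → 𝟙 ⌊ r ℕ.≟ x ⌋) (m<n⇒m%n≡m (<-≤-trans (Finₚ.toℕ<n v) m≤N))))) (once r m)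
    where
    once : ∀ r m → ℕΣ.sum {m} (λ v → 𝟙 ⌊ r ℕ.≟ toℕ v ⌋) ≤ 1
    once r zero = ≤-trans (≤-reflexive (ℕΣ.sum-[] _)) z≤n
    once zero (suc m) = ≤-reflexive (trans (ℕΣ.sum-∷ _) (cong suc (ℕΣ.sum-0 m)))
    once (suc r) (suc m) = ≤-trans (≤-reflexive (trans (ℕΣ.sum-∷ _) (ℕΣ.sum-cong (λ v → cong 𝟙 (suc-≟ r (toℕ v)))))) (once r m)
      where
      suc-≟ : ∀ r v → ⌊ suc r ℕ.≟ suc v ⌋ ≡ ⌊ r ℕ.≟ v ⌋
      suc-≟ r v with r ℕ.≟ v | suc r ℕ.≟ suc v
      ... | yes _ | yes _ = refl
      ... | no _  | no _  = refl
      ... | yes e | no ¬e = contradiction (cong suc e) ¬e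
      ... | no ¬e | yes e = contradiction (suc-injective e) ¬e

  -- A class has at most n/N + 1 members; the proof removes one period of length N at a time.
  residue-count : ∀ r n → N * ∑< n (hit r) ≤ N + n
  residue-count r n = go n n ≤-refl
    where
    go : ∀ fuel n → n ≤ fuel → N * ∑< n (hit r) ≤ N + n
    go fuel n n≤fuel with n ℕ.≤? N
    ... | yes n≤N = ≤-trans (*-monoʳ-≤ N (one-period r n n≤N)) (≤-trans (≤-reflexive (*-identityʳ N)) (m≤m+n N n))
    go zero n n≤fuel | no n≰N = contradiction (≤-trans n≤fuel z≤n) n≰N
    go (suc fuel) n n≤fuel | no n≰N = subst (λ n → N * ∑< n (hit r) ≤ N + n) (m+[n∸m]≡n N≤n) (begin
      N * ∑< (N + n′) (hit r) ≡⟨ cong (N *_) (∑<-+ N (hit r)) ⟩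
      N * (∑< N (hit r) + ∑< n′ (λ v → hit r (N + v))) ≡⟨ cong (λ z → N * (∑< N (hit r) + z)) (ℕΣ.sum-cong (λ v → cong (λ x → 𝟙 ⌊ r ℕ.≟ x ⌋) (trans (cong (_% N) (+-comm N (toℕ v))) ([m+n]%n≡m%n (toℕ v) N)))) ⟩
      N * (∑< N (hit r) + ∑< n′ (hit r)) ≡⟨ *-distribˡ-+ N _ _ ⟩
      N * ∑< N (hit r) + N * ∑< n′ (hit r) ≤⟨ +-mono-≤ (≤-trans (*-monoʳ-≤ N (one-period r N ≤-refl)) (≤-reflexive (*-identityʳ N))) (go fuel n′ n′≤) ⟩
      N + (N + n′) ∎)
      where
      open ≤-Reasoning
      N≤n : N ≤ n
      N≤n = <⇒≤ (≰⇒> n≰N)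
      n′ = n ∸ N
      n′≤ : n′ ≤ fuel
      n′≤ = ℕ.s≤s⁻¹ (≤-trans (≤-trans (+-monoˡ-≤ n′ (ℕ.>-nonZero⁻¹ N)) (≤-reflexive (m+[n∸m]≡n N≤n))) n≤fuel)

  -- Every part of the final partition lies in one of these N nearly equal classes, which bounds the
  -- number of pairs inside parts.
  residue : ∀ {n} → Fin n → Fin N
  residue u = fromℕ< (m%n<n (toℕ u) N)

  collisions : ∀ n → N ≤ n → N * ℕΣ.sum {n} (λ u → ℕΣ.sum {n} (λ v → 𝟙 ⌊ residue u ≟ residue v ⌋)) ≤ 2 * (n * n)
  collisions n N≤n = begin
    N * ℕΣ.sum {n} (λ u → ℕΣ.sum {n} (λ v → 𝟙 ⌊ residue u ≟ residue v ⌋)) ≡⟨ ℕΣ.sum-*ˡ N _ ⟩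
    ℕΣ.sum {n} (λ u → N * ℕΣ.sum {n} (λ v → 𝟙 ⌊ residue u ≟ residue v ⌋)) ≤⟨ ℕ-sum-mono (λ u → ≤-trans (*-monoʳ-≤ N (ℕ-sum-mono (same u))) (residue-count (toℕ u % N) n)) ⟩
    ℕΣ.sum {n} (λ _ → N + n) ≡⟨ ℕ-sum-const n (N + n) ⟩
    n * (N + n) ≤⟨ *-monoʳ-≤ n (+-monoˡ-≤ n N≤n) ⟩
    n * (n + n) ≡⟨ twice n ⟩
    2 * (n * n) ∎
    where
    open ≤-Reasoning
    twice : ∀ n → n * (n + n) ≡ 2 * (n * n)
    twice = solve-∀
    same : ∀ {n} (u v : Fin n) → 𝟙 ⌊ residue u ≟ residue v ⌋ ≤ hit (toℕ u % N) (toℕ v)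
    same u v = 𝟙-mono (λ e → ⌊⌋-yes (_ ℕ.≟ _) (trans (sym (Finₚ.toℕ-fromℕ< _)) (trans (cong toℕ (⌊⌋-true (residue u ≟ residue v) e)) (Finₚ.toℕ-fromℕ< _))))

-- Boolean tests and induced embeddings

module Embeddings where

  open Arithmetic
  open import Defs using (Graph; adj; _==_; allB; maps; isInducedEmbedding; inducedCount)
  open import Data.List using ([]; _∷_; map; concatMap; filter; length; tabulate; allFin)
  open Counting

  filter-pairs : ∀ {m n} {A : Set} (P : A → Bool) (c : Fin m → Fin n → A) →
    length (filter (λ p → P p Bool.≟ true) (concatMap (λ i → map (c i) (allFin n)) (allFin m)))
      ≡ ℕΣ.sum (λ i → ℕΣ.sum (λ j → 𝟙 (P (c i j))))
  filter-pairs {m} {n} P c = trans (filter-concatMap P (λ i → map (c i) (allFin n)) id)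
    (ℕΣ.sum-cong (λ i → trans (filter-map P (c i) (allFin n)) (filter-tabulate (P ∘ c i) id)))
    where
    filter-tabulate : ∀ {k} {A : Set} (Q : A → Bool) (t : Fin k → A) →
      length (filter (λ x → Q x Bool.≟ true) (tabulate t)) ≡ ℕΣ.sum (λ i → 𝟙 (Q (t i)))
    filter-tabulate {zero} Q t = sym (ℕΣ.sum-[] _)
    filter-tabulate {suc k} Q t with Q (t zero) in eq
    ... | true  = trans (cong suc (filter-tabulate Q (t ∘ suc))) (sym (trans (ℕΣ.sum-∷ _) (cong (λ b → 𝟙 b + ℕΣ.sum (λ i → 𝟙 (Q (t (suc i))))) eq)))
    ... | false = trans (filter-tabulate Q (t ∘ suc)) (sym (trans (ℕΣ.sum-∷ _) (cong (λ b → 𝟙 b + ℕΣ.sum (λ i → 𝟙 (Q (t (suc i))))) eq)))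

  allB-elim : ∀ {k} {A : Set} (p : A → Bool) (t : Fin k → A) → allB p (tabulate t) ≡ true → ∀ i → p (t i) ≡ true
  allB-elim {suc k} p t e i with p (t zero) in eq
  allB-elim {suc k} p t e zero    | true = eq
  allB-elim {suc k} p t e (suc i) | true = allB-elim p (t ∘ suc) e i

  allB-fails : ∀ {k} {A : Set} (p : A → Bool) (t : Fin k → A) → allB p (tabulate t) ≡ false → ∃[ i ] p (t i) ≡ false
  allB-fails {suc k} p t e with p (t zero) in eq
  ... | true  = let i , e′ = allB-fails p (t ∘ suc) e in suc i , e′
  ... | false = zero , eq

  ==-true : ∀ {a b} → (a == b) ≡ true → a ≡ b
  ==-true {true}  {true}  _ = refl
  ==-true {false} {false} _ = refl

  ==-refl : ∀ a → (a == a) ≡ true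
  ==-refl true  = refl
  ==-refl false = refl

  Embedding : ∀ {h n} → Graph h → Graph n → (Fin h → Fin n) → Set
  Embedding H G f = ∀ a b → a ≢ b → f a ≢ f b × adj H a b ≡ adj G (f a) (f b)

  embedding-sound : ∀ {h n} (H : Graph h) (G : Graph n) f → isInducedEmbedding H G f ≡ true → Embedding H G f
  embedding-sound H G f e a b a≢b with allB-elim _ id (allB-elim _ id e a) b
  ... | r with a ≟ b | f a ≟ f b
  ... | yes a≡b | _      = contradiction a≡b a≢b
  ... | no _    | no ¬eq = ¬eq , ==-true r

  embedding-complete : ∀ {h n} (H : Graph h) (G : Graph n) f → Embedding H G f → isInducedEmbedding H G f ≡ true
  embedding-complete H G f emb with isInducedEmbedding H G f in eq
  ... | true  = refl
  ... | false with allB-fails _ id eq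
  ... | a , e with allB-fails _ id e
  ... | b , r with a ≟ b | f a ≟ f b
  ... | no a≢b | yes e′ = contradiction e′ (proj₁ (emb a b a≢b))
  ... | no a≢b | no _   = contradiction (trans (sym r) (subst (λ x → (adj H a b == x) ≡ true) (proj₂ (emb a b a≢b)) (==-refl (adj H a b)))) λ ()

  some-embedding : ∀ {h n} (H : Graph h) (G : Graph n) → inducedCount H G ≡ 0 ⊎ ∃[ f ] Embedding H G f
  some-embedding {h} {n} H G = search-list (maps h n)
    where
    search-list : ∀ xs → length (filter (λ f → isInducedEmbedding H G f Bool.≟ true) xs) ≡ 0 ⊎ ∃[ f ] Embedding H G f
    search-list [] = inj₁ refl
    search-list (f ∷ xs) with isInducedEmbedding H G f in eq
    ... | true = inj₂ (f , embedding-sound H G f eq)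
    ... | false = search-list xs

-- Editing the graph, and counting copies of H that survive

-- r is the inverse of the lower density on robust pairs; the other constants are inverse ratios of set sizes.
module Constants (h N : ℕ) where

  open Arithmetic

  r inner shrink outer spread threshold : ℕ
  r         = 2 * N
  inner     = 3 * (suc h * r ^ suc h)
  shrink    = inner ^ (steps N inner (2 ^ (h + h)) * 2)
  outer     = shrink * inner
  spread    = sizeBound N outer (suc (2 * (N * N))) N
  threshold = spread * shrink * inner

module Removal {h : ℕ} (H : Defs.Graph h) (N : ℕ) (3≤N : 3 ℕ.≤ N) {n : ℕ} (0<n : 0 ℕ.< n) (G : Defs.Graph n) where

  open Arithmetic
  open import Defs using (Graph; adj; irrfl; _==_; isInducedEmbedding; inducedCount; editDistance) renaming (sym to adj-sym)

  open Constants h N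
  open Robustness
  open Embeddings
  open Counting

  0<N : 0 < N
  0<N = ≤-trans (s≤s z≤n) 3≤N

  0<r : 0 < r
  0<r = *-mono-< {0} {2} (s≤s z≤n) 0<N

  0<power : 0 < suc h * r ^ suc h
  0<power = *-mono-< {0} {suc h} (s≤s z≤n) (m^n>0 r {{ℕ.>-nonZero 0<r}} (suc h))

  3≤inner : 3 ≤ inner
  3≤inner = *-monoʳ-≤ 3 0<power

  2≤inner : 2 ≤ inner
  2≤inner = ≤-trans (n≤1+n 2) 3≤inner

  N≤inner : N ≤ inner
  N≤inner = ≤-trans (m≤n*m N 2) (≤-trans (m≤m*n r (r ^ h) {{m^n≢0 r h {{ℕ.>-nonZero 0<r}}}}) (≤-trans (m≤n*m (r ^ suc h) (suc h)) (m≤n*m (suc h * r ^ suc h) 3)))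

  0<inner : 0 < inner
  0<inner = ≤-trans (s≤s z≤n) 2≤inner

  0<shrink : 0 < shrink
  0<shrink = m^n>0 inner {{ℕ.>-nonZero 0<inner}} (steps N inner (2 ^ (h + h)) * 2)

  2≤outer : 2 ≤ outer
  2≤outer = ≤-trans 2≤inner (m≤n*m inner shrink {{ℕ.>-nonZero 0<shrink}})

  -- The diagonal belongs to neither colour, so that a tuple with prescribed colours is injective.
  colour : Bool → Rel n
  colour true  u v = adj G u v
  colour false u v = not ⌊ u ≟ v ⌋ ∧ not (adj G u v)

  disjoint : ∀ u v → 𝟙 (colour true u v) + 𝟙 (colour false u v) ≤ 1
  disjoint u v with adj G u v | ⌊ u ≟ v ⌋
  ... | true  | true  = ≤-refl
  ... | true  | false = ≤-refl
  ... | false | true  = z≤n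
  ... | false | false = ≤-refl

  exhaustive : ∀ u v → 1 ≤ 𝟙 (colour true u v) + (𝟙 (colour false u v) + 𝟙 ⌊ u ≟ v ⌋)
  exhaustive u v with adj G u v | ⌊ u ≟ v ⌋
  ... | true  | _     = s≤s z≤n
  ... | false | true  = ≤-refl
  ... | false | false = s≤s z≤n

  ⌊≟⌋-sym : ∀ {m} (i j : Fin m) → ⌊ i ≟ j ⌋ ≡ ⌊ j ≟ i ⌋
  ⌊≟⌋-sym i j with i ≟ j | j ≟ i
  ... | yes _ | yes _ = refl
  ... | no _  | no _  = refl
  ... | yes e | no ¬e = contradiction (sym e) ¬e
  ... | no ¬e | yes e = contradiction (sym e) ¬e

  colour-sym : ∀ c u v → colour c u v ≡ colour c v u
  colour-sym true  u v = adj-sym G u v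
  colour-sym false u v = cong₂ (λ a b → not a ∧ not b) (⌊≟⌋-sym u v) (adj-sym G u v)

  colour-value : ∀ c {u v} → colour c u v ≡ true → u ≢ v × c ≡ adj G u v
  colour-value true {u} e = (λ { refl → contradiction (trans (sym e) (irrfl G u)) λ () }) , sym e
  colour-value false {u} {v} e with u ≟ v | adj G u v
  ... | no u≢v | false = u≢v , refl

  edges-sym : ∀ c X Y → edges (colour c) X Y ≡ edges (colour c) Y X
  edges-sym c X Y = trans (ℕΣ.sum-comm (λ u v → 𝟙 (X u) * (𝟙 (Y v) * 𝟙 (colour c u v)))) (ℕΣ.sum-cong (λ v → ℕΣ.sum-cong (λ u →
    trans (cong (λ b → 𝟙 (X u) * (𝟙 (Y v) * 𝟙 b)) (colour-sym c u v)) (swap (𝟙 (X u)) (𝟙 (Y v)) _))))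
    where
    swap : ∀ x y z → x * (y * z) ≡ y * (x * z)
    swap = solve-∀

  open Iteration 0<n colour N outer 0<N 2≤outer
  open Colours colour exhaustive
  module Mono = Monochromatic N inner 3≤N 2≤inner h
  open Mono using (Homogeneous; homogeneous)
  open Stage 0<n colour N outer 0<N 2≤outer using (isBig; isActive)

  instance
    N-nonZero : ℕ.NonZero N
    N-nonZero = ℕ.>-nonZero 0<N

  open Residues N using (residue; collisions)

  opaque
    initial : Represented (residue {n}) spread
    initial = represented residue

  open Represented initial

  module _ (large-n : threshold ≤ n) where

    0<spread : 0 < spread
    0<spread with zero-or-positive spread | member (full {n}) (subst (0 <_) (sym (∣full∣ n)) 0<n)
    ... | inj₂ p | _ = p
    ... | inj₁ e | u , _ = contradiction (<-≤-trans 0<n (≤-trans (bound (κ u)) (≤-reflexive (cong (_* ∣ parts (κ u) ∣) e)))) 1+n≰n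

    -- The reason for the remaining factors of `threshold`: dividing out `spread` leaves parts so
    -- large that their pieces, smaller by a factor of at most `shrink`, still have `inner`
    -- vertices.
    part-size : ∀ i → shrink * inner ≤ ∣ parts i ∣
    part-size i = *-cancelˡ-≤ spread {{ℕ.>-nonZero 0<spread}} (≤-trans (≤-reflexive (sym (*-assoc spread shrink inner))) (≤-trans large-n (bound i)))

    part-large : ∀ i → N ≤ ∣ parts i ∣
    part-large i = ≤-trans (≤-trans N≤inner (m≤n*m inner shrink {{ℕ.>-nonZero 0<shrink}})) (part-size i)

    opaque
      hom : ∀ i → Homogeneous (parts i)
      hom i = homogeneous (parts i) (≤-trans (*-monoʳ-≤ shrink N≤inner) (part-size i))

    pieces : Fin k → Fin h → Sub n
    pieces i = Homogeneous.pieces (hom i)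

    open Cost disjoint exhaustive κ representation part-large

    piece-size : ∀ i a → inner ≤ ∣ pieces i a ∣
    piece-size i a = *-cancelˡ-≤ shrink {{ℕ.>-nonZero 0<shrink}} (≤-trans (part-size i) (Homogeneous.size (hom i) a))

    -- Robustness tests only subsets of at most half a set. Copies are counted inside halves of the
    -- pieces, where every subset meets this condition.
    halved : ∀ i a → ∃[ Y ] Y ⊆ pieces i a × 2 * ∣ Y ∣ ≤ ∣ pieces i a ∣
                            × ∣ pieces i a ∣ ≤ 3 * ∣ Y ∣
    halved i a = Halves.half (pieces i a) (≤-trans 2≤inner (piece-size i a))

    forbidden-sym : ∀ c i j → forbidden c i j ≡ forbidden c j i
    forbidden-sym c i j = cong₂ (λ x y → ⌊ N * x ℕ.<? y ⌋) (edges-sym c (parts i) (parts j)) (*-comm ∣ parts i ∣ ∣ parts j ∣)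

    forbidden-other : ∀ c i j → forbidden c i j ≡ true → forbidden (not c) i j ≡ false
    forbidden-other c i j e with N * edges (colour (not c)) (parts i) (parts j) ℕ.<? ∣ parts i ∣ * ∣ parts j ∣
    ... | no _  = refl
    ... | yes p = contradiction (≤-trans p (other-colour 3≤N (parts i) (parts j) (part-large j) c (⌊⌋-true (_ ℕ.<? _) e))) 1+n≰n

    -- Between different parts a colour changes only if it is forbidden. The order of the two tests
    -- is immaterial, because by `forbidden-other` at most one colour is forbidden.
    recolour : Fin k → Fin k → Bool → Bool
    recolour i j b = if ⌊ i ≟ j ⌋ then Homogeneous.colour (hom i)
                     else if forbidden true i j then false else if forbidden false i j then true else b

    recolour-sym : ∀ i j b → recolour i j b ≡ recolour j i b
    recolour-sym i j b with i ≟ j | j ≟ i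
    ... | yes refl | yes _ = refl
    ... | yes e | no ¬e = contradiction (sym e) ¬e
    ... | no ¬e | yes e = contradiction (sym e) ¬e
    ... | no _  | no _  = cong₂ (λ x y → if x then false else if y then true else b) (forbidden-sym true i j) (forbidden-sym false i j)

    recolour-same : ∀ {i j} b → i ≡ j → recolour i j b ≡ Homogeneous.colour (hom i)
    recolour-same {i} {j} b e with i ≟ j
    ... | yes _ = refl
    ... | no ¬e = contradiction e ¬e

    recolour-allowed : ∀ {i j} b → i ≢ j → forbidden (recolour i j b) i j ≡ false
    recolour-allowed {i} {j} b i≢j with i ≟ j
    ... | yes e = contradiction e i≢j
    ... | no _ = go (forbidden true i j) refl (forbidden false i j) refl b
      where
      go : ∀ x → forbidden true i j ≡ x → ∀ y → forbidden false i j ≡ y → ∀ b →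
           forbidden (if x then false else if y then true else b) i j ≡ false
      go true  p y     q b     = forbidden-other true i j p
      go false p true  q b     = p
      go false p false q true  = p
      go false p false q false = q

    edit : Graph n
    edit = record
      { adj   = λ u v → if ⌊ u ≟ v ⌋ then false else recolour (κ u) (κ v) (adj G u v)
      ; sym   = λ u v → trans (cong₂ (λ x y → if x then false else y) (⌊≟⌋-sym u v) (recolour-sym (κ u) (κ v) (adj G u v)))
                          (cong (λ b → if ⌊ v ≟ u ⌋ then false else recolour (κ v) (κ u) b) (adj-sym G u v))
      ; irrfl = λ u → cong (λ x → if x then false else recolour (κ u) (κ u) (adj G u u)) (⌊⌋-yes (u ≟ u) refl) }

    edit-adj : ∀ {u v} → u ≢ v → adj edit u v ≡ recolour (κ u) (κ v) (adj G u v)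
    edit-adj {u} {v} u≢v with u ≟ v
    ... | yes e = contradiction e u≢v
    ... | no _  = refl

    module _ (f : Fin h → Fin n) (emb : Embedding H edit f) where

      private
        part : Fin h → Fin k
        part a = κ (f a)

        -- Of the surviving copy only the parts of its vertices are used. Vertex a of H takes piece
        -- number a of its part, so that vertices sharing a part get different pieces.
        piece X : Fin h → Sub n
        piece a = pieces (part a) a
        X a = proj₁ (halved (part a) a)

        X⊆piece : ∀ a → X a ⊆ piece a
        X⊆piece a = proj₁ (proj₂ (halved (part a) a))

        X-small : ∀ a → 2 * ∣ X a ∣ ≤ ∣ piece a ∣
        X-small a = proj₁ (proj₂ (proj₂ (halved (part a) a)))

        X-large : ∀ a → ∣ piece a ∣ ≤ 3 * ∣ X a ∣
        X-large a = proj₂ (proj₂ (proj₂ (halved (part a) a)))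

        E : Fin h → Fin h → Rel n
        E a b = colour (adj H a b)

        subpiece-small : ∀ a {Y} → Y ⊆ X a → 2 * ∣ Y ∣ ≤ ∣ piece a ∣
        subpiece-small a s = ≤-trans (*-monoʳ-≤ 2 (⊆⇒≤ s)) (X-small a)

        robust-across : ∀ {i j Z Z′ c} → Robust outer r (colour c) (parts i) (parts j) → ∀ {w w′} →
          (∀ {Y} → Y ⊆ Z → w ≤ inner * ∣ Y ∣ → Y ⊆ parts i × ∣ parts i ∣ ≤ outer * ∣ Y ∣ × 2 * ∣ Y ∣ ≤ ∣ parts i ∣) →
          (∀ {Y} → Y ⊆ Z′ → w′ ≤ inner * ∣ Y ∣ → Y ⊆ parts j × ∣ parts j ∣ ≤ outer * ∣ Y ∣ × 2 * ∣ Y ∣ ≤ ∣ parts j ∣) →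
          LowerRegular inner r (colour c) w w′ Z Z′
        robust-across rob P Q = lowerRegular λ X′ Y′ s s′ l l′ →
          let a , b , c = P s l ; d , e , g = Q s′ l′ in rob X′ Y′ (a , d , b , c , e , g)

        -- Shares multiply: a subset of share 1/`inner` in a piece of share 1/`shrink` has share
        -- 1/`outer` in the part. This is the origin of `outer`.
        outer-admissible : ∀ a {Y} → Y ⊆ X a → ∣ piece a ∣ ≤ inner * ∣ Y ∣ →
          Y ⊆ parts (part a) × ∣ parts (part a) ∣ ≤ outer * ∣ Y ∣ × 2 * ∣ Y ∣ ≤ ∣ parts (part a) ∣
        outer-admissible a {Y} s l =
          (λ u e → piece⊆ u (X⊆piece a u (s u e))) ,
          ≤-trans (Homogeneous.size (hom (part a)) a) (≤-trans (*-monoʳ-≤ shrink l) (≤-reflexive (sym (*-assoc shrink inner ∣ Y ∣)))) ,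
          ≤-trans (subpiece-small a s) (⊆⇒≤ piece⊆)
          where
          piece⊆ : piece a ⊆ parts (part a)
          piece⊆ = Homogeneous.pieces-⊆ (hom (part a)) a

        regular-within : ∀ {i j} → i ≡ j → ∀ {c} → c ≡ Homogeneous.colour (hom i) → ∀ {a b} → a Fin.< b →
          Robust inner r (colour c) (pieces i a) (pieces j b)
        regular-within refl refl a<b = Homogeneous.robust (hom _) _ _ a<b

        allowed-robust : ∀ {i j} c → i ≢ j → forbidden c i j ≡ false → Robust outer r (colour c) (parts i) (parts j)
        allowed-robust {i} {j} c i≢j e = good c i j i≢j (dense e)
          where
          dense : forbidden c i j ≡ false → ∣ parts i ∣ * ∣ parts j ∣ ≤ N * edges (colour c) (parts i) (parts j)
          dense e with N * edges (colour c) (parts i) (parts j) ℕ.<? ∣ parts i ∣ * ∣ parts j ∣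
          ... | no ¬p = ≮⇒≥ ¬p

        -- Since the copy survived the editing, the colour required by H is the colour of the part
        -- when a and b share one, and the pieces are robust in it by `homogeneous`. Otherwise it is
        -- a colour that is not forbidden, hence dense on the representatives, and robust because
        -- these form a good tuple.
        regular : ∀ a b → a Fin.< b → LowerRegular inner r (E a b) ∣ piece a ∣ ∣ piece b ∣ (X a) (X b)
        regular a b a<b with part a ≟ part b
        ... | yes same = lowerRegular λ X′ Y′ s s′ l l′ →
            regular-within same (trans agree (recolour-same _ same)) a<b X′ Y′
              ((λ u e → X⊆piece a u (s u e)) , (λ u e → X⊆piece b u (s′ u e)) , l , subpiece-small a s , l′ , subpiece-small b s′)
          where
          agree : adj H a b ≡ recolour (part a) (part b) (adj G (f a) (f b))
          agree = let fa≢fb , e = emb a b (λ { refl → <-irrefl refl a<b }) in trans e (edit-adj fa≢fb)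
        ... | no different = robust-across {c = adj H a b} (allowed-robust (adj H a b) different allowed) (outer-admissible a) (outer-admissible b)
          where
          agree : adj H a b ≡ recolour (part a) (part b) (adj G (f a) (f b))
          agree = let fa≢fb , e = emb a b (λ { refl → <-irrefl refl a<b }) in trans e (edit-adj fa≢fb)
          allowed : forbidden (adj H a b) (part a) (part b) ≡ false
          allowed = subst (λ c → forbidden c (part a) (part b) ≡ false) (sym agree) (recolour-allowed _ different)

        piece-positive : ∀ a → 0 < ∣ piece a ∣
        piece-positive a = <-≤-trans 0<inner (piece-size (part a) a)

        -- The origin of `inner`: 3 for passing to half a piece, `suc h` for excluding low-degree
        -- vertices, the powers of r for the shrinking candidate sets. The exponent `suc h` also
        -- ensures that `inner` is at least N when h = 0.
        X-threshold : ∀ a → suc h * ∣ piece a ∣ * r ^ h ≤ inner * ∣ X a ∣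
        X-threshold a = begin
          suc h * ∣ piece a ∣ * r ^ h ≤⟨ *-mono-≤ (*-monoʳ-≤ (suc h) (X-large a)) (m≤n*m (r ^ h) r {{ℕ.>-nonZero 0<r}}) ⟩
          suc h * (3 * ∣ X a ∣) * r ^ suc h ≡⟨ shuffle (suc h) ∣ X a ∣ (r ^ suc h) ⟩
          inner * ∣ X a ∣ ∎
          where
          open ≤-Reasoning
          shuffle : ∀ h x p → h * (3 * x) * p ≡ 3 * (h * p) * x
          shuffle = solve-∀

        piece-spread : ∀ a → n ≤ spread * shrink * ∣ piece a ∣
        piece-spread a = ≤-trans (bound (part a)) (≤-trans (*-monoʳ-≤ spread (Homogeneous.size (hom (part a)) a)) (≤-reflexive (sym (*-assoc spread shrink _))))

        sound : ∀ g → (∀ a → X a (g a) ≡ true) → (∀ a b → a Fin.< b → E a b (g a) (g b) ≡ true) → isInducedEmbedding H G g ≡ true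
        sound g _ edge = embedding-complete H G g pair
          where
          pair : Embedding H G g
          pair a b a≢b with Finₚ.<-cmp a b
          ... | tri< a<b _ _ = colour-value (adj H a b) (edge a b a<b)
          ... | tri≈ _ e _   = contradiction e a≢b
          ... | tri> _ _ b<a = let ne , e = colour-value (adj H b a) (edge b a b<a) in
                ne ∘ sym , trans (adj-sym H a b) (trans e (adj-sym G (g b) (g a)))

      many-embeddings : n ^ h ≤ threshold ^ h * inducedCount H G
      many-embeddings = embeddings-many h {suc h} {inner} {r} {spread * shrink} {n} (n≤1+n h) 0<r X (λ a → ∣ piece a ∣) E
        regular piece-positive X-threshold piece-spread (isInducedEmbedding H G) sound

    smallVertices : N * ℕΣ.sum (λ u → 𝟙 (not (isBig κ (κ u)))) ≤ n
    smallVertices = *-cancelˡ-≤ k {{ℕ.>-nonZero 0<k}} (begin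
      k * (N * ℕΣ.sum (λ u → s (κ u))) ≡⟨ cong (λ z → k * (N * z)) (ℕΣ.sum-cong (λ u → sym (ℕ-sum-pick (κ u) s))) ⟩
      k * (N * ℕΣ.sum (λ u → ℕΣ.sum (λ i → 𝟙 ⌊ κ u ≟ i ⌋ * s i))) ≡⟨ cong (λ z → k * (N * z)) (trans (ℕΣ.sum-comm _) (ℕΣ.sum-cong (λ i →
           trans (ℕΣ.sum-cong (λ u → *-comm (𝟙 ⌊ κ u ≟ i ⌋) (s i))) (sym (ℕΣ.sum-*ˡ (s i) _))))) ⟩
      k * (N * ℕΣ.sum (λ i → s i * ∣ cell κ i ∣)) ≡⟨ trans (sym (*-assoc k N _)) (ℕΣ.sum-*ˡ (k * N) _) ⟩
      ℕΣ.sum (λ i → k * N * (s i * ∣ cell κ i ∣)) ≤⟨ ℕ-sum-mono small ⟩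
      ℕΣ.sum {k} (λ _ → n) ≡⟨ ℕ-sum-const k n ⟩
      k * n ∎)
      where
      open ≤-Reasoning
      open Partitions (colour true) using (cell)
      s : Fin k → ℕ
      s i = 𝟙 (not (isBig κ i))
      0<k : 0 < k
      0<k = let u , _ = member (full {n}) (subst (0 <_) (sym (∣full∣ n)) 0<n) in ≤-trans (s≤s z≤n) (Finₚ.toℕ<n (κ u))
      small : ∀ i → k * N * (s i * ∣ cell κ i ∣) ≤ n
      small i with n ℕ.≤? k * N * ∣ cell κ i ∣
      ... | yes _ = ≤-trans (≤-reflexive (*-zeroʳ (k * N))) z≤n
      ... | no ¬p = ≤-trans (≤-reflexive (cong (k * N *_) (*-identityˡ _))) (<⇒≤ (≰⇒> ¬p))

    ∑∑ : (Fin n → Fin n → ℕ) → ℕ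
    ∑∑ φ = ℕΣ.sum (λ u → ℕΣ.sum (φ u))

    ∑∑-mono : ∀ {φ ψ} → (∀ u v → φ u v ≤ ψ u v) → ∑∑ φ ≤ ∑∑ ψ
    ∑∑-mono p = ℕ-sum-mono (λ u → ℕ-sum-mono (p u))

    ∑∑-+ : ∀ φ ψ → ∑∑ (λ u v → φ u v + ψ u v) ≡ ∑∑ φ + ∑∑ ψ
    ∑∑-+ φ ψ = trans (ℕΣ.sum-cong (λ u → ℕΣ.sum-+ (φ u) (ψ u))) (ℕΣ.sum-+ _ _)

    changed sameCell smallLeft smallRight : Fin n → Fin n → ℕ
    changed u v = 𝟙 ((toℕ u <ᵇ toℕ v) ∧ not (adj G u v == adj edit u v))
    sameCell u v = 𝟙 ⌊ residue u ≟ residue v ⌋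
    smallLeft u v = 𝟙 (not (isBig κ (κ u)))
    smallRight u v = 𝟙 (not (isBig κ (κ v)))

    changed-cases : ∀ u v → changed u v ≤ sameCell u v + (smallLeft u v + (smallRight u v + (𝟙 (edited true u v) + 𝟙 (edited false u v))))
    changed-cases u v with u ≟ v
    ... | yes refl = ≤-trans (≤-reflexive (cong (λ b → 𝟙 (b ∧ not (adj G u u == false))) (irreflexive (toℕ u)))) z≤n
      where
      irreflexive : ∀ m → (m <ᵇ m) ≡ false
      irreflexive zero    = refl
      irreflexive (suc m) = irreflexive m
    ... | no u≢v with κ u ≟ κ v in same
    -- Parts refine the residue classes, so a pair inside a part is charged to a collision of
    -- residues.
    ... | yes e rewrite ⌊⌋-yes (residue u ≟ residue v) (refines e) = ≤-trans (𝟙-≤1 _) (s≤s z≤n)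
    ... | no κu≢κv with isBig κ (κ u) | isBig κ (κ v)
    ... | false | _ = ≤-trans (𝟙-≤1 _) (≤-trans (s≤s z≤n) (m≤n+m _ (sameCell u v)))
    ... | true | false = ≤-trans (𝟙-≤1 _) (≤-trans (s≤s z≤n) (m≤n+m _ (sameCell u v)))
    ... | true | true = ≤-trans (go (forbidden true (κ u) (κ v)) (forbidden false (κ u) (κ v)) (adj G u v)) (m≤n+m _ (sameCell u v))
      where
      go : ∀ x y b → 𝟙 ((toℕ u <ᵇ toℕ v) ∧ not (b == (if x then false else if y then true else b)))
                   ≤ 𝟙 (x ∧ b) + 𝟙 (y ∧ not b)
      go x y b with toℕ u <ᵇ toℕ v
      go x     y     b     | false = z≤n
      go true  y     true  | true = s≤s z≤n
      go true  y     false | true = z≤n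
      go false true  true  | true = z≤n
      go false true  false | true = s≤s z≤n
      go false false true  | true = z≤n
      go false false false | true = z≤n

    -- The charges are 2 for pairs inside a part, 1 for each end in a small cell and 4 for each
    -- forbidden colour. They count ordered pairs, which is ample for edits with u below v.
    few-edits : N * editDistance G edit ≤ 12 * (n * n)
    few-edits = begin
      N * editDistance G edit ≡⟨ cong (N *_) (filter-pairs _ _) ⟩
      N * ∑∑ changed ≤⟨ *-monoʳ-≤ N (∑∑-mono changed-cases) ⟩
      N * ∑∑ (λ u v → sameCell u v + (smallLeft u v + (smallRight u v + (𝟙 (edited true u v) + 𝟙 (edited false u v))))) ≡⟨ cong (N *_)
         (trans (∑∑-+ sameCell _) (cong (∑∑ sameCell +_) (trans (∑∑-+ smallLeft _) (cong (∑∑ smallLeft +_) (trans (∑∑-+ smallRight _) (cong (∑∑ smallRight +_) (∑∑-+ _ _))))))) ⟩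
      N * (∑∑ sameCell + (∑∑ smallLeft + (∑∑ smallRight + (∑∑ (λ u v → 𝟙 (edited true u v)) + ∑∑ (λ u v → 𝟙 (edited false u v)))))) ≡⟨ expand N _ _ _ _ _ ⟩
      N * ∑∑ sameCell + (N * ∑∑ smallLeft + (N * ∑∑ smallRight + (N * ∑∑ (λ u v → 𝟙 (edited true u v)) + N * ∑∑ (λ u v → 𝟙 (edited false u v)))))
        ≤⟨ +-mono-≤ (collisions n N≤n) (+-mono-≤ left (+-mono-≤ right (+-mono-≤ (edited-count true) (edited-count false)))) ⟩
      2 * (n * n) + (n * n + (n * n + (4 * (n * n) + 4 * (n * n)))) ≡⟨ collect (n * n) ⟩
      12 * (n * n) ∎
      where
      open ≤-Reasoning
      expand : ∀ N a b c d e → N * (a + (b + (c + (d + e)))) ≡ N * a + (N * b + (N * c + (N * d + N * e)))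
      expand = solve-∀
      collect : ∀ w → 2 * w + (w + (w + (4 * w + 4 * w))) ≡ 12 * w
      collect = solve-∀
      N≤n : N ≤ n
      N≤n = ≤-trans N≤inner (≤-trans (m≤n*m inner (spread * shrink) {{ℕ.>-nonZero (*-mono-< 0<spread 0<shrink)}}) large-n)
      s : Fin n → ℕ
      s u = 𝟙 (not (isBig κ (κ u)))
      right : N * ∑∑ smallRight ≤ n * n
      right = begin
        N * ∑∑ smallRight ≡⟨ cong (N *_) (ℕ-sum-const n (ℕΣ.sum s)) ⟩
        N * (n * ℕΣ.sum s) ≡⟨ swap N n (ℕΣ.sum s) ⟩
        n * (N * ℕΣ.sum s) ≤⟨ *-monoʳ-≤ n smallVertices ⟩
        n * n ∎
        where
        swap : ∀ a b c → a * (b * c) ≡ b * (a * c)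
        swap = solve-∀
      left : N * ∑∑ smallLeft ≤ n * n
      left = ≤-trans (≤-reflexive (cong (N *_) (ℕΣ.sum-comm (λ u v → s u)))) right

  removal : threshold ≤ n → Σ (Graph n) λ G′ → (N * editDistance G G′ ≤ 12 * (n * n)) ×
            (inducedCount H G′ ≡ 0 ⊎ n ^ h ≤ threshold ^ h * inducedCount H G)
  removal large = edit large , few-edits large , decide (some-embedding H (edit large))
    where
    decide : inducedCount H (edit large) ≡ 0 ⊎ ∃[ f ] Embedding H (edit large) f → _
    decide (inj₁ e)         = inj₁ e
    decide (inj₂ (f , emb)) = inj₂ (many-embeddings large f emb)

-- Tower bounds for the constants

module Towers (h : ℕ) where

  open Arithmetic
  open import Defs using (t)

  open ≤-Reasoning

  n<2^n : ∀ n → n < 2 ^ n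
  n<2^n zero    = s≤s z≤n
  n<2^n (suc n) = ≤-trans (+-mono-≤ (m^n>0 2 n) (n<2^n n)) (≤-reflexive (cong (2 ^ n +_) (sym (+-identityʳ _))))

  2n≤2^n : ∀ n → n + n ≤ 2 ^ n
  2n≤2^n zero    = z≤n
  2n≤2^n (suc n) = ≤-trans (+-mono-≤ (n<2^n n) (n<2^n n)) (≤-reflexive (cong (2 ^ n +_) (sym (+-identityʳ _))))

  -- Opaque, so that heights can be inferred by unification.
  opaque
    tower : ℕ → ℕ
    tower i = t i h

    tower-t : ∀ {a} i → a ≤ tower i → a ≤ t i h
    tower-t i p = p

    h≤tower : h ≤ tower 0
    h≤tower = ≤-refl

    tower-+ : ∀ {i a} k → a ≤ tower i → a ≤ tower (k + i)
    tower-+ zero    p = p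
    tower-+ (suc k) p = ≤-trans (tower-+ k p) (<⇒≤ (n<2^n _))

    -- Valid even for h = 0. Numerical constants and N are reached by height alone, which costs N
    -- extra levels, negligible beside the N² rounds.
    tower-const : ∀ m → m ≤ tower m
    tower-const zero    = z≤n
    tower-const (suc m) = <-≤-trans (s≤s (tower-const m)) (n<2^n _)

    sum-tower : ∀ i {a b} → a ≤ tower i → b ≤ tower i → a + b ≤ tower (1 + i)
    sum-tower i p q = ≤-trans (+-mono-≤ p q) (2n≤2^n (tower i))

    product-tower : ∀ i {a b} → a ≤ tower i → b ≤ tower i → a * b ≤ tower (2 + i)
    product-tower i {a} {b} p q = begin
      a * b ≤⟨ *-mono-≤ (≤-trans p (<⇒≤ (n<2^n _))) (≤-trans q (<⇒≤ (n<2^n _))) ⟩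
      2 ^ tower i * 2 ^ tower i ≡⟨ sym (^-distribˡ-+-* 2 (tower i) (tower i)) ⟩
      2 ^ (tower i + tower i) ≤⟨ ^-monoʳ-≤ 2 (2n≤2^n (tower i)) ⟩
      tower (2 + i) ∎

    power-tower : ∀ i {a b} → a ≤ tower i → b ≤ tower i → a ^ b ≤ tower (3 + i)
    power-tower i {a} {b} p q = begin
      a ^ b ≤⟨ ^-monoˡ-≤ b (≤-trans p (<⇒≤ (n<2^n _))) ⟩
      (2 ^ tower i) ^ b ≤⟨ ^-monoʳ-≤ (2 ^ tower i) {{m^n≢0 2 (tower i)}} q ⟩
      (2 ^ tower i) ^ tower i ≡⟨ ^-*-assoc 2 (tower i) (tower i) ⟩
      2 ^ (tower i * tower i) ≤⟨ ^-monoʳ-≤ 2 (product-tower i ≤-refl ≤-refl) ⟩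
      tower (3 + i) ∎

    labels-tower : ∀ i {a} → a ≤ tower i → labels a ≤ tower (2 + i)
    labels-tower i {a} p = ≤-trans (≤-trans (m≤n*m (labels a) 2) (double a)) (^-monoʳ-≤ 2 (^-monoʳ-≤ 2 p))
      where
      -- Carrying the factor 2 along turns the recursion of `labels` into plain squaring.
      double : ∀ a → 2 * labels a ≤ 2 ^ (2 ^ a)
      double zero    = ≤-refl
      double (suc a) = begin
        2 * (2 * (labels a * labels a)) ≡⟨ square (labels a) ⟩
        2 * labels a * (2 * labels a) ≤⟨ *-mono-≤ (double a) (double a) ⟩
        2 ^ (2 ^ a) * 2 ^ (2 ^ a) ≡⟨ sym (^-distribˡ-+-* 2 (2 ^ a) (2 ^ a)) ⟩
        2 ^ (2 ^ a + 2 ^ a) ≡⟨ cong (λ z → 2 ^ (2 ^ a + z)) (sym (+-identityʳ _)) ⟩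
        2 ^ (2 ^ suc a) ∎
        where
        square : ∀ l → 2 * (2 * (l * l)) ≡ 2 * l * (2 * l)
        square = solve-∀

  module _ {N} (4≤N : 4 ≤ N) where

    module _ {i} (N≤ : N ≤ tower i) where

      small : ∀ {m} → m ≤ 4 → m ≤ tower i
      small p = ≤-trans p (≤-trans 4≤N N≤)

      depth-tower : ∀ {A K} → A ≤ tower i → K ≤ tower i → steps N A K * 2 ≤ tower (10 + i)
      depth-tower {A} {K} pA pK = product-tower (8 + i)
        (product-tower (6 + i)
          (tower-+ 1 (sum-tower (4 + i) (tower-+ 4 (small (s≤s z≤n)))
            (product-tower (2 + i) (tower-+ 2 (small ≤-refl)) (product-tower i pK pK))))
          (product-tower (4 + i) (tower-+ 2 (product-tower i pA pA)) (product-tower (2 + i) 2N 2N)))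
        (tower-+ 8 (small (s≤s (s≤s z≤n))))
        where
        2N : 2 * N ≤ tower (2 + i)
        2N = product-tower i (small (s≤s (s≤s z≤n))) N≤

    -- A round costs a fixed number of levels: the depth of the tree is polynomial in k, A and N,
    -- and the number of labels doubly exponential in that depth. The count 16 is generous; only its
    -- independence of J and k matters.
    sizeBound-tower : ∀ J {A i k} → N ≤ tower i → A ≤ tower i → k ≤ tower i → sizeBound N A J k ≤ tower (16 * J + i)
    sizeBound-tower zero    _ _ _ = z≤n
    sizeBound-tower (suc J) {A} {i} {k} pN pA pk = subst (λ m → sizeBound N A (suc J) k ≤ tower m) (height J i)
      (sum-tower (16 * J + (15 + i))
        (tower-+ (16 * J) (product-tower (13 + i) (tower-+ 11 (product-tower i pk pN)) (power-tower (10 + i) (tower-+ 10 pA) depth)))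
        (sizeBound-tower J (tower-+ 15 pN) (tower-+ 15 pA) (tower-+ 1 (product-tower (12 + i) (tower-+ 12 pk) (labels-tower (10 + i) depth)))))
      where
      depth : steps N A k * 2 ≤ tower (10 + i)
      depth = depth-tower pN pA pk
      height : ∀ J i → 1 + (16 * J + (15 + i)) ≡ 16 * suc J + i
      height = solve-∀

    open Constants h N

    -- Height 24 + N accommodates N and `outer`, each round adds 16, and the last 10 levels absorb
    -- the products and the power that form the denominator of δ.
    towerHeight : ℕ
    towerHeight = 10 + (16 * suc (2 * (N * N)) + (24 + N))

    threshold-tower : 2 * suc threshold ^ h ≤ t towerHeight h
    threshold-tower = tower-t towerHeight (product-tower (8 + m) (tower-+ 8 (lift two))
        (power-tower (5 + m) (sum-tower (4 + m) one (product-tower (2 + m) (product-tower m spread≤ (tower-+ (16 * rounds) (tower-+ 2 shrink≤)))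
          (tower-+ 2 (tower-+ (16 * rounds) (tower-+ 15 inner≤))))) (tower-+ 5 (lift hh))))
      where
      rounds = suc (2 * (N * N))
      m = 16 * rounds + (24 + N)
      lift : ∀ {a} → a ≤ tower N → a ≤ tower m
      lift p = tower-+ (16 * rounds) (tower-+ 24 p)
      NN : N ≤ tower N
      NN = tower-const N
      hh : h ≤ tower N
      hh = subst (λ i → h ≤ tower i) (+-identityʳ N) (tower-+ N h≤tower)
      two : 2 ≤ tower N
      two = small NN (s≤s (s≤s z≤n))
      one : 1 ≤ tower (4 + m)
      one = tower-+ 4 (lift (small NN (s≤s z≤n)))
      inner≤ : inner ≤ tower (9 + N)
      inner≤ = product-tower (7 + N) (tower-+ 7 (small NN (s≤s (s≤s (s≤s z≤n)))))
        (product-tower (5 + N) (tower-+ 4 suc-h) (power-tower (2 + N) (product-tower N two NN) (tower-+ 1 suc-h)))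
        where
        suc-h : suc h ≤ tower (1 + N)
        suc-h = sum-tower N (small NN (s≤s z≤n)) hh
      shrink≤ : shrink ≤ tower (22 + N)
      shrink≤ = power-tower (19 + N) (tower-+ 10 inner≤) (depth-tower (tower-+ 9 NN) inner≤ (tower-+ 4 (power-tower (2 + N)
        (tower-+ 2 two) (tower-+ 1 (sum-tower N hh hh)))))
      spread≤ : spread ≤ tower m
      spread≤ = sizeBound-tower rounds (tower-+ 24 NN) (product-tower (22 + N) shrink≤ (tower-+ 13 inner≤)) (tower-+ 24 NN)

-- The choice of δ, small graphs and the final constants

module Main where

  open Arithmetic
  open import Defs hiding (sym)
  open import Data.Nat.DivMod using (_/_; m≡m%n+[m/n]*n; m%n<n; m/n*n≤m)
  open import Data.Rational using (mkℚ; 0ℚ; ½; ↥_; ↧ₙ_)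

  editDistance-refl : ∀ {n} (G : Graph n) → editDistance G G ≡ 0
  editDistance-refl {n} G = trans (Embeddings.filter-pairs _ _) (trans (ℕΣ.sum-cong (λ i → trans (ℕΣ.sum-cong (λ j → unchanged (toℕ i <ᵇ toℕ j) (adj G i j))) (ℕΣ.sum-0 n))) (ℕΣ.sum-0 n))
    where
    unchanged : ∀ a b → 𝟙 (a ∧ not (b == b)) ≡ 0
    unchanged false b     = refl
    unchanged true  true  = refl
    unchanged true  false = refl

  module _ (h : ℕ) (H : Graph h) (E : ℕ) (0<E : 0 < E) where

    N D : ℕ
    -- The 12 cancels the one in `few-edits`.
    N = 12 * E
    open Constants h N using (threshold)
    -- δ is 1/D. The factor 2 makes the comparisons with a power of `threshold` strict, and `suc`
    -- keeps that power positive.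
    D = 2 * suc threshold ^ h

    0<D : 0 < D
    0<D = *-mono-< {0} {2} (s≤s z≤n) (m^n>0 (suc threshold) h)

    4≤N : 4 ≤ N
    4≤N = ≤-trans (m≤m+n 4 8) (*-monoʳ-≤ 12 0<E)

    height : ℕ
    height = Towers.towerHeight h 4≤N

    D≤tower : D ≤ t height h
    D≤tower = Towers.threshold-tower h 4≤N

    -- The height is 50 + 32N² + N, at most 83N² with N² = 144E², and 83 · 144 = 11952.
    height≤ : height ≤ 12000 * (E * E)
    height≤ = begin
      10 + (16 * suc (2 * w) + (24 + N)) ≡⟨ collect w N ⟩
      50 * 1 + 32 * w + N ≤⟨ +-mono-≤ (+-monoˡ-≤ (32 * w) (*-monoʳ-≤ 50 1≤w)) N≤w ⟩
      50 * w + 32 * w + w ≡⟨ gather w ⟩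
      83 * w ≡⟨ cong (83 *_) ([m*n]*[o*p]≡[m*o]*[n*p] 12 E 12 E) ⟩
      83 * (144 * (E * E)) ≡⟨ sym (*-assoc 83 144 (E * E)) ⟩
      83 * 144 * (E * E) ≤⟨ *-monoˡ-≤ (E * E) (≤ᵇ⇒≤ (83 * 144) 12000 _) ⟩
      12000 * (E * E) ∎
      where
      open ≤-Reasoning
      w = N * N
      N≤w : N ≤ w
      N≤w = m≤m*n N N {{ℕ.>-nonZero (≤-trans (s≤s z≤n) 4≤N)}}
      1≤w : 1 ≤ w
      1≤w = ≤-trans (≤-trans (s≤s z≤n) 4≤N) N≤w
      collect : ∀ w N → 10 + (16 * suc (2 * w) + (24 + N)) ≡ 50 * 1 + 32 * w + N
      collect = solve-∀
      gather : ∀ w → 50 * w + 32 * w + w ≡ 83 * w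
      gather = solve-∀

    -- A single induced copy already forces n beyond `threshold`. In a smaller graph the hypothesis
    -- thus leaves no copy at all, and G itself serves. In a larger one a surviving copy would yield
    -- more copies in G than allowed.
    induced-removal : ∀ {n} (G : Graph n) → D * inducedCount H G ≤ n ^ h →
      Σ (Graph n) λ G′ → (E * editDistance G G′ ≤ n * n) × (inducedCount H G′ ≡ 0)
    induced-removal {n} G rare with inducedCount H G ℕ.≟ 0
    ... | yes none = G , ≤-trans (≤-reflexive (trans (cong (E *_) (editDistance-refl G)) (*-zeroʳ E))) z≤n , none
    ... | no some = conclude (Removal.removal H N (≤-trans (n≤1+n 3) 4≤N) (<-≤-trans (s≤s z≤n) large) G (≤-trans (n≤1+n threshold) large))
      where
      open ≤-Reasoning
      c B : ℕ
      c = inducedCount H G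
      B = suc threshold
      1≤c : 1 ≤ c
      1≤c = n≢0⇒n>0 some
      B^h<n^h : B ^ h < n ^ h
      B^h<n^h = begin-strict
        B ^ h <⟨ m<m+n (B ^ h) (≤-trans (m^n>0 B h) (m≤m+n _ 0)) ⟩
        D ≤⟨ m≤m*n D c {{ℕ.>-nonZero 1≤c}} ⟩
        D * c ≤⟨ rare ⟩
        n ^ h ∎
      large : B ≤ n
      large with B ℕ.≤? n
      ... | yes p = p
      ... | no ¬p = contradiction (<-≤-trans B^h<n^h (^-monoˡ-≤ h (<⇒≤ (≰⇒> ¬p)))) (<-irrefl refl)
      conclude : (Σ (Graph n) λ G′ → (N * editDistance G G′ ≤ 12 * (n * n)) ×
                   (inducedCount H G′ ≡ 0 ⊎ n ^ h ≤ threshold ^ h * c)) →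
                 Σ (Graph n) λ G′ → (E * editDistance G G′ ≤ n * n) × (inducedCount H G′ ≡ 0)
      conclude (G′ , few , inj₁ none) = G′ , *-cancelˡ-≤ 12 (≤-trans (≤-reflexive (sym (*-assoc 12 E _))) few) , none
      conclude (G′ , few , inj₂ many) = contradiction (<-≤-trans (begin-strict
        B ^ h * c <⟨ m<m+n (B ^ h * c) (*-mono-< (m^n>0 B h) 1≤c) ⟩
        B ^ h * c + B ^ h * c ≡⟨ twice (B ^ h) c ⟩
        D * c ≤⟨ rare ⟩
        n ^ h ≤⟨ many ⟩
        threshold ^ h * c ∎) (*-monoˡ-≤ c (^-monoˡ-≤ h (n≤1+n threshold)))) (<-irrefl refl)
        where
        twice : ∀ b c → b * c + b * c ≡ 2 * b * c
        twice = solve-∀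

  -- For ε = p/q the witness E = ⌊1/ε⌋ + 1 satisfies 1 ≤ E ε ≤ 2.
  reciprocal : ∀ p q → 0 < p → p ≤ q → ∃[ E ] 0 < E × q ≤ E * p × E * p ≤ 2 * q
  reciprocal p@(suc _) q _ p≤q = suc (q / p) , s≤s z≤n ,
    ≤-trans (≤-reflexive (m≡m%n+[m/n]*n q p)) (+-monoˡ-≤ _ (<⇒≤ (m%n<n q p))) ,
    ≤-trans (+-mono-≤ p≤q (m/n*n≤m q p)) (≤-reflexive (cong (q +_) (sym (+-identityʳ q))))

  numerator : ∀ ε → 0ℚ ℚ.< ε → ∃[ p ] 0 < p × ↥ ε ≡ ℤ.+ p
  numerator ε@(mkℚ (ℤ.+ suc p) _ _) _ = suc p , s≤s z≤n , refl
  numerator ε@(mkℚ (ℤ.+ zero) _ _) h = contradiction (ℚₚ.positive⁻¹ ε {{ℚ.positive h}}) λ { (ℚ.*<* (ℤ.+<+ ())) }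
  numerator ε@(mkℚ ℤ.-[1+ _ ] _ _) h = contradiction h λ { (ℚ.*<* ()) }

  numerator-≤ : ∀ ε {p} → ε ℚ.< ½ → ↥ ε ≡ ℤ.+ p → p ≤ ↧ₙ ε
  numerator-≤ ε {p} h e = ≤-trans (m≤m*n p 2) (<⇒≤ (ℤₚ.drop‿+<+ (subst₂ ℤ._<_
    (trans (cong (ℤ._* ℤ.+ 2) e) (sym (ℤₚ.pos-* p 2))) (ℤₚ.*-identityˡ (ℤ.+ ↧ₙ ε)) (ℚₚ.drop-*<* h))))

  module _ where
    open Field using (F; inv; ι; ⟦_⟧)

    opaque
      unfolding Field.F Field.inv

      fromℚ : ℚ → F
      fromℚ ε = ε

      toℚ : F → ℚ
      toℚ x = x

      ε*denominator : ∀ ε → fromℚ ε Field.* ι (↧ₙ ε) ≡ ⟦ ↥ ε ⟧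
      ε*denominator ε@(mkℚ p q-1 _) = ℚₚ.toℚᵘ-injective (ℚᵘₚ.≃-trans (ℚₚ.toℚᵘ-homo-* ε (ι (suc q-1)))
        (ℚᵘₚ.≃-trans (ℚᵘₚ.*-cong {ℚᵘ.mkℚᵘ p q-1} ℚᵘₚ.≃-refl (ℚₚ.toℚᵘ-fromℚᵘ (ℚᵘ.mkℚᵘ (ℤ.+ suc q-1) 0)))
          (ℚᵘₚ.≃-trans {j = ℚᵘ.mkℚᵘ p 0} (ℚᵘ.*≡* (trans (ℤₚ.*-identityʳ (p ℤ.* ℤ.+ suc q-1)) (cong (λ d → p ℤ.* ℤ.+ d) (sym (*-identityʳ (suc q-1))))))
            (ℚᵘₚ.≃-sym (ℚₚ.toℚᵘ-fromℚᵘ (ℚᵘ.mkℚᵘ p 0))))))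

      inv-positive : ∀ {m} → 0 < m → 0ℚ ℚ.< toℚ (inv m)
      inv-positive {suc m} _ = ℚₚ.positive⁻¹ _ {{ℚₚ.normalize-pos 1 (suc m)}}

      main : (h : ℕ) (H : Graph h) (ε : ℚ) → 0ℚ ℚ.< ε → ε ℚ.< ½ →
        Σ ℚ λ δ → (0ℚ ℚ.< δ) ×
          (Σ ℕ λ j → (ℕ→ℚ j ℚ.* (ε ^ℚ 2) ℚ.≤ ℕ→ℚ 48000) × (ℕ→ℚ 1 ℚ.≤ δ ℚ.* ℕ→ℚ (t j h))) ×
          ((n : ℕ) (G : Graph n) → ℕ→ℚ (inducedCount H G) ℚ.≤ δ ℚ.* ℕ→ℚ (n ^ h) →
            Σ (Graph n) λ G′ → (ℕ→ℚ (editDistance G G′) ℚ.≤ ε ℚ.* ℕ→ℚ (n * n)) × (inducedCount H G′ ≡ 0))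
      main h H ε 0<ε ε<½ =
        let p , 0<p , ε≡p = numerator ε 0<ε
            E , 0<E , low , high = reciprocal p (↧ₙ ε) 0<p (numerator-≤ ε ε<½ ε≡p)
            e*q = trans (ε*denominator ε) (cong ⟦_⟧ ε≡p)
            1≤Eε = Estimates.1≤E*e {ε} {p} {↧ₙ ε} {E} (s≤s z≤n) e*q low
            Eε≤2 = Estimates.E*e≤2 {ε} {p} {↧ₙ ε} {E} (s≤s z≤n) e*q high
            0≤ε  = ℚₚ.<⇒≤ 0<ε
        in inv (D h H E 0<E) , inv-positive (0<D h H E 0<E) ,
           (height h H E 0<E , Estimates.height-bound {ε} {E} {height h H E 0<E} {12000} 0≤ε Eε≤2 (height≤ h H E 0<E) ,
             Estimates.1≤inv {D h H E 0<E} {t (height h H E 0<E) h} (0<D h H E 0<E) (D≤tower h H E 0<E)) ,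
           λ n G rare →
             let G′ , few , none = induced-removal h H E 0<E G (Estimates.clear-denominator {D h H E 0<E} {inducedCount H G} {n ^ h} (0<D h H E 0<E) rare)
             in G′ , Estimates.edit-bound {ε} {E} {editDistance G G′} {n * n} 1≤Eε 0≤ε few , none

open import Defs
open import Data.Nat using (ℕ; _≤_; _≡ᵇ_)
open import Data.Product using (Σ; _×_; ∃)
open import Data.Rational using (ℚ; 0ℚ; ½; _<_; _*_) renaming (_≤_ to _≤ℚ_)
open import Relation.Binary.PropositionalEquality using (_≡_)

theorem1p6 : Σ ℕ λ C → Σ ℕ λ c → (0 Data.Nat.< C) × (0 Data.Nat.< c) ×
    ((h : ℕ) (H : Graph h) (ε : ℚ) → 0ℚ < ε → ε < ½ →
    Σ ℚ λ δ → (0ℚ < δ) ×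
    (Σ ℕ λ j → (ℕ→ℚ j * (ε ^ℚ c) ≤ℚ ℕ→ℚ C) × (ℕ→ℚ 1 ≤ℚ δ * ℕ→ℚ (t j h))) ×
    ((n : ℕ) (G : Graph n) → ℕ→ℚ (inducedCount H G) ≤ℚ δ * ℕ→ℚ (n Data.Nat.^ h) →
    Σ (Graph n) λ G' → (ℕ→ℚ (editDistance G G') ≤ℚ ε * ℕ→ℚ (n Data.Nat.* n)) ×
    (inducedCount H G' ≡ 0)))
-- The exponent 2 reflects the number of rounds, of order N² with N of order 1/ε. 48000 is 12000 ·
-- 4, the 4 coming from E ε ≤ 2.
theorem1p6 = 48000 , 2 , s≤s z≤n , s≤s z≤n , Main.main
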